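{- The Orthogonal Vectors problem $\mathsf{OV}$ on $n+n$ vectors in $\{0,1\}^d$ can be solved by a deterministic algorithm in time $\tilde O(n\cdot 1.155^d)$.
   Context: In $\mathsf{OV}$ one is given vectors $u_1,\dots,u_n,v_1,\dots,v_n\in\{0,1\}^d$ and must decide whether there exist $i,j\in[n]$ with $\langle u_i,v_j\rangle=0$, the inner product being over $\mathbb{Z}$. $\tilde O$ hides factors polynomial in $d$ and $\log n$. -}

module Defs where

open import Data.Fin.Base as Fin using (Fin; toℕ; fromℕ<)
open import Data.Integer.Base as ℤ using (ℤ; +_; -[1+_]; ∣_∣; 0ℤ; 1ℤ)
import Data.Integer.Properties as ℤₚ
open import Data.Nat.Base using (ℕ; zero; suc; _+_; _*_; _^_; _≤_)
open import Data.Nat.Logarithm using (⌊log₂_⌋)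
import Data.Nat.Properties as ℕₚ
open import Data.Product.Base using (∃-syntax; _×_; _,_)
open import Data.Sum.Base using (_⊎_)
open import Data.Vec.Functional using (Vector; concat; _++_)
open import Algebra.Properties.Monoid.Sum ℤₚ.+-0-monoid using (sum)
open import Relation.Binary.PropositionalEquality using (_≡_; refl)
open import Relation.Nullary.Decidable using (yes; no)
open import Relation.Nullary.Negation using (¬_; contradiction)

⟨_,_⟩ : ∀ {d} → Vector (Fin 2) d → Vector (Fin 2) d → ℤ
⟨ x , y ⟩ = sum λ k → (+ toℕ (x k)) ℤ.* (+ toℕ (y k))

HasOrthogonalPair : ∀ {n d} → (u v : Vector (Vector (Fin 2) d) n) → Set
HasOrthogonalPair u v = ∃[ i ] ∃[ j ] ⟨ u i , v j ⟩ ≡ 0ℤ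

-- The machine model is the random access machine with the logarithmic cost
-- criterion, with programs in structured form (if/while in place of jumps).
-- Registers have fixed names in the program; memory is addressed indirectly.
-- Addresses are integers, which saves a convention for negative addresses.

data Expr : Set where
  lit : ℤ → Expr
  reg : ℕ → Expr
  mem : Expr → Expr
  _⊕_ _⊖_ _⊗_ : Expr → Expr → Expr

-- Tests ask whether the value of the expression is strictly positive.
data Cmd : Set where
  skip    : Cmd
  reg[_]≔_  : ℕ → Expr → Cmd
  mem[_]≔_  : Expr → Expr → Cmd
  _⨾_     : Cmd → Cmd → Cmd
  if_then_else_ : Expr → Cmd → Cmd → Cmd
  while_loop_   : Expr → Cmd → Cmd

infixl 6 _⊕_ _⊖_
infixl 7 _⊗_
infix  4 reg[_]≔_ mem[_]≔_
infixr 4 if_then_else_ while_loop_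
infixr 3 _⨾_

record Store : Set where
  constructor store
  field
    regs   : ℕ → ℤ
    memory : ℤ → ℤ

open Store public

setReg : ℕ → ℤ → Store → Store
regs (setReg r x σ) s with s ℕₚ.≟ r
... | yes _ = x
... | no  _ = regs σ s
memory (setReg r x σ) = memory σ

setMem : ℤ → ℤ → Store → Store
regs (setMem a x σ) = regs σ
memory (setMem a x σ) b with b ℤₚ.≟ a
... | yes _ = x
... | no  _ = memory σ b

⟦_⟧ : Expr → Store → ℤ
⟦ lit x ⟧ σ = x
⟦ reg r ⟧ σ = regs σ r
⟦ mem e ⟧ σ = memory σ (⟦ e ⟧ σ)
⟦ e ⊕ f ⟧ σ = ⟦ e ⟧ σ ℤ.+ ⟦ f ⟧ σ
⟦ e ⊖ f ⟧ σ = ⟦ e ⟧ σ ℤ.- ⟦ f ⟧ σ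
⟦ e ⊗ f ⟧ σ = ⟦ e ⟧ σ ℤ.* ⟦ f ⟧ σ

-- The number of binary digits of ∣ x ∣, where 0 counts as having one digit.
bits : ℤ → ℕ
bits x = suc ⌊log₂ ∣ x ∣ ⌋

-- Additions cost the total length of the operands, and multiplications the
-- product of the lengths (the schoolbook bound).
cost : Expr → Store → ℕ
cost (lit x) σ = bits x
cost (reg r) σ = bits (regs σ r)
cost (mem e) σ = cost e σ + bits (⟦ e ⟧ σ) + bits (⟦ mem e ⟧ σ)
cost (e ⊕ f) σ = cost e σ + cost f σ + (bits (⟦ e ⟧ σ) + bits (⟦ f ⟧ σ))
cost (e ⊖ f) σ = cost e σ + cost f σ + (bits (⟦ e ⟧ σ) + bits (⟦ f ⟧ σ))
cost (e ⊗ f) σ = cost e σ + cost f σ + bits (⟦ e ⟧ σ) * bits (⟦ f ⟧ σ)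

-- P ⊢ σ ⇓[ t ] τ : started in σ, the program P halts in τ after time t.
data _⊢_⇓[_]_ : Cmd → Store → ℕ → Store → Set where

  ⇓-skip  : ∀ {σ} → skip ⊢ σ ⇓[ 1 ] σ

  ⇓-reg   : ∀ {σ r e} →
            (reg[ r ]≔ e) ⊢ σ ⇓[ suc (cost e σ) ] setReg r (⟦ e ⟧ σ) σ

  ⇓-mem   : ∀ {σ a e} →
            (mem[ a ]≔ e) ⊢ σ ⇓[ suc (cost a σ + bits (⟦ a ⟧ σ) + cost e σ) ]
            setMem (⟦ a ⟧ σ) (⟦ e ⟧ σ) σ

  ⇓-seq   : ∀ {P Q σ τ υ s t} →
            P ⊢ σ ⇓[ s ] τ → Q ⊢ τ ⇓[ t ] υ →
            (P ⨾ Q) ⊢ σ ⇓[ suc (s + t) ] υ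

  ⇓-then  : ∀ {e P Q σ τ t} →
            0ℤ ℤ.< ⟦ e ⟧ σ → P ⊢ σ ⇓[ t ] τ →
            (if e then P else Q) ⊢ σ ⇓[ suc (cost e σ + t) ] τ

  ⇓-else  : ∀ {e P Q σ τ t} →
            ¬ (0ℤ ℤ.< ⟦ e ⟧ σ) → Q ⊢ σ ⇓[ t ] τ →
            (if e then P else Q) ⊢ σ ⇓[ suc (cost e σ + t) ] τ

  ⇓-loop  : ∀ {e P σ τ υ s t} →
            0ℤ ℤ.< ⟦ e ⟧ σ → P ⊢ σ ⇓[ s ] τ → (while e loop P) ⊢ τ ⇓[ t ] υ →
            (while e loop P) ⊢ σ ⇓[ suc (cost e σ + s + t) ] υ

  ⇓-exit  : ∀ {e P σ} →
            ¬ (0ℤ ℤ.< ⟦ e ⟧ σ) →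
            (while e loop P) ⊢ σ ⇓[ suc (cost e σ) ] σ

⇓-deterministic : ∀ {P σ s t τ υ} →
                  P ⊢ σ ⇓[ s ] τ → P ⊢ σ ⇓[ t ] υ → s ≡ t × τ ≡ υ
⇓-deterministic ⇓-skip ⇓-skip = refl , refl
⇓-deterministic ⇓-reg ⇓-reg = refl , refl
⇓-deterministic ⇓-mem ⇓-mem = refl , refl
⇓-deterministic (⇓-seq p q) (⇓-seq p′ q′)
  with refl , refl ← ⇓-deterministic p p′
  with refl , refl ← ⇓-deterministic q q′ = refl , refl
⇓-deterministic (⇓-then _ p) (⇓-then _ p′)
  with refl , refl ← ⇓-deterministic p p′ = refl , refl
⇓-deterministic (⇓-then y _) (⇓-else n _) = contradiction y n
⇓-deterministic (⇓-else n _) (⇓-then y _) = contradiction y n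
⇓-deterministic (⇓-else _ p) (⇓-else _ p′)
  with refl , refl ← ⇓-deterministic p p′ = refl , refl
⇓-deterministic (⇓-loop _ p q) (⇓-loop _ p′ q′)
  with refl , refl ← ⇓-deterministic p p′
  with refl , refl ← ⇓-deterministic q q′ = refl , refl
⇓-deterministic (⇓-loop y _ _) (⇓-exit n) = contradiction y n
⇓-deterministic (⇓-exit n) (⇓-loop y _ _) = contradiction y n
⇓-deterministic (⇓-exit _) (⇓-exit _) = refl , refl

-- Register 0 holds n and register 1 holds d. The entries u i k and v i k are
-- at the addresses i * d + k and n * d + i * d + k, counting from 0.
-- All other registers and memory cells hold 0.
input : ∀ {n d} → (u v : Vector (Vector (Fin 2) d) n) → Store
input {n} {d} u v = store initialRegs initialMemory
  where
  initialRegs : ℕ → ℤ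
  initialRegs 0 = + n
  initialRegs 1 = + d
  initialRegs (suc (suc _)) = 0ℤ

  initialMemory : ℤ → ℤ
  initialMemory (+ a) with a ℕₚ.<? n * d + n * d
  ... | yes a<2nd = + toℕ ((concat u ++ concat v) (fromℕ< a<2nd))
  ... | no  _     = 0ℤ
  initialMemory -[1+ _ ] = 0ℤ

output : Store → ℤ
output σ = regs σ 0

-- The output 1 means "yes" and the output 0 means "no".
CorrectAnswer : ∀ {n d} → (u v : Vector (Vector (Fin 2) d) n) → ℤ → Set
CorrectAnswer u v x =
  (x ≡ 1ℤ × HasOrthogonalPair u v) ⊎ (x ≡ 0ℤ × ¬ HasOrthogonalPair u v)

-- t ≤ C · n · (p / q) ^ d · (1 + d + ⌊log₂ n⌋) ^ k, with the denominator
-- cleared. Every polynomial in d and log n is at most C (1 + d + ⌊log₂ n⌋) ^ k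
-- for suitable C and k; the 1 keeps this factor positive at d = 0, n = 1.
TimeBound : (p q C k n d t : ℕ) → Set
TimeBound p q C k n d t =
  t * q ^ d ≤ C * (n * p ^ d) * (1 + d + ⌊log₂ n ⌋) ^ k

{-# OPTIONS --safe #-}
module Submission where

-- Split the d coordinates into blocks of a large constant size b.  For disjoint
-- x, y ⊆ [b] of sizes a, a′ with c = b - a - a′ coordinates in neither, choose
-- i + j = c and consider the sets S of size a + i.  A random S that contains x
-- avoids y with a probability such that a suitable family of sets S separates
-- all such pairs (x ⊆ S, y ∩ S = ∅) while x lies in about X = C(i + j + a′, i) /
-- C(i + j, i) of its members and y avoids about Y = C(i + a + j, j) / C(i + j, i)
-- of them.  For the best i both are at most (4 / 3) ^ (b / 2), up to a polynomial
-- in b; the worst case is a = a′ = c = b / 3.  Since 2 / √3 < 1.155, a large b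
-- absorbs the polynomial, and each x needs at most 1.155 ^ b keys (a, a′, S).
--
-- Choosing i: X increases and Y decreases with i, so it is enough that X or Y is
-- small at every i, and for this that some weighted geometric mean
-- X ^ θ * Y ^ (1 - θ) is.  Upper bounds on C(n, k) come from the binomial theorem
-- and lower bounds from unimodality.  The family of sets is found by the method
-- of conditional expectations.
--
-- The algorithm enumerates for each u all sequences of keys of its blocks, marks
-- them in a table, and looks up the sequences of keys of each v.  A common
-- sequence exists exactly if u and v are orthogonal.

open import Defs
open import Data.Bool.Base as Bool using (Bool; true; false; T; _∧_; _∨_; not)
open import Data.Bool.Properties using (∧-zeroʳ; ∧-identityʳ)
open import Data.Fin.Base as Fin using (Fin; toℕ; fromℕ<; _↑ˡ_; _↑ʳ_; combine) renaming (zero to fzero; suc to fsuc)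
open import Data.Fin.Properties using (toℕ-injective; toℕ-fromℕ<; toℕ<n; toℕ-↑ˡ; toℕ-↑ʳ; toℕ-combine; remQuot-combine; splitAt-↑ˡ; splitAt-↑ʳ)
open import Data.List.Base using (List; []; _∷_; _++_; map; length; cartesianProduct; concatMap; upTo; foldl)
open import Data.List.Membership.Propositional using (_∈_)
open import Data.List.Membership.Propositional.Properties
  using (∈-++⁺ˡ; ∈-++⁺ʳ; ∈-map⁺; ∈-map⁻; ∈-cartesianProduct⁺; ∈-upTo⁺; ∈-concatMap⁺; ∈-concatMap⁻)
open import Data.List.Properties using (map-++; map-∘; length-map; length-++; length-upTo; ++-assoc; ++-identityʳ)
open import Data.List.Relation.Binary.Pointwise.Base using ([]; _∷_) renaming (Pointwise to Listwise)
open import Data.List.Relation.Unary.All as All using (All; []; _∷_)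
import Data.List.Relation.Unary.All.Properties as Allₚ
open import Data.List.Relation.Unary.Any as Any using (here; there)
open import Data.Nat.Base hiding (∣_-_∣)
open import Data.Nat.Combinatorics using (nCn≡1; nCk≡nC[n∸k]; nCk+nC[k+1]≡[n+1]C[k+1]) renaming (_C_ to _binom_)
open import Data.Nat.DivMod using (_/_; _%_; m/n*n≤m; m≡m%n+[m/n]*n; m%n<n; m*n/n≡m; /-monoˡ-≤; [m+kn]%n≡m%n; m<n⇒m%n≡m)
open import Data.Nat.ListAction using (sum; product)
open import Data.Nat.ListAction.Properties using (sum-++)
open import Data.Nat.Logarithm using (⌊log₂_⌋; ⌊log₂⌋-mono-≤; ⌊log₂[2^n]⌋≡n)
open import Data.Nat.Properties
open import Data.Nat.Tactic.RingSolver using (solve-∀)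
open import Data.Product.Base using (∃-syntax; _×_; _,_; proj₁; proj₂; swap)
open import Data.Sum.Base as Sum using (_⊎_; inj₁; inj₂)
open import Data.Unit.Base using (⊤; tt)
open import Data.Vec.Base using (Vec; []; _∷_; replicate)
import Data.Vec.Functional as Functional
open import Data.Vec.Functional using (Vector)
open import Data.Vec.Relation.Binary.Pointwise.Inductive using (Pointwise; []; _∷_)
open import Function.Base using (_∘_)
open import Relation.Binary.PropositionalEquality
open import Relation.Nullary.Decidable using (Dec; yes; no; map′)
open import Relation.Nullary.Negation using (¬_; contradiction)

open ≤-Reasoning

-- Binomial coefficients

-- Constant block size settles two matters at once: the families of sets are fixed together with the
-- program, so the work of finding them is not part of the running time, and the polynomial lost per
-- block is a constant that (1.155 / 1.15499) ^ b outgrows. The selection rests on exponential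
-- moments. If a fraction p of the sets of size a + i separates a given pair, a suitable multiple of
-- b / p draws miss it with probability below 4 ^ -b, while the mean of 2 ^ degree stays exponential
-- in the mean degree, of order b X or b Y. Both conditions are products over the draws, whose means
-- are powers, so one weighted sum controls all pairs and all degrees. All estimates are between
-- natural numbers: denominators are cleared and rational exponents removed by taking powers. Rates
-- are compared only at finitely many proportions i : j, as numerals; unimodality fills the gaps. In
-- the running time every stored number has O(d + log n) bits, so an instruction costs O((d + log n)
-- ^ 2); the number of blocks, at most d, gives the third factor of (1 + d + log n) ^ 3.

^-distribʳ-* : ∀ n x y → (x * y) ^ n ≡ x ^ n * y ^ n
^-distribʳ-* zero    x y = refl
^-distribʳ-* (suc n) x y rewrite ^-distribʳ-* n x y = interchange x y (x ^ n) (y ^ n)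
  where
  interchange : ∀ x y p q → x * y * (p * q) ≡ x * p * (y * q)
  interchange = solve-∀

^-swap : ∀ x m n → (x ^ m) ^ n ≡ (x ^ n) ^ m
^-swap x m n rewrite ^-*-assoc x m n | ^-*-assoc x n m = cong (x ^_) (*-comm m n)

^-cancelʳ-≤ : ∀ n .{{_ : NonZero n}} {x y} → x ^ n ≤ y ^ n → x ≤ y
^-cancelʳ-≤ n {x} {y} le with x ≤? y
... | yes x≤y = x≤y
... | no  x≰y = contradiction le (<⇒≱ (^-monoˡ-< n (≰⇒> x≰y)))

-- The smaller of two numbers is at most their weighted geometric mean: if both were at least
-- `suc s`, the product would reach `suc s ^ (m + n)`.
^-splitting : ∀ m n .{{_ : NonZero (m + n)}} u v s → u ^ m * v ^ n ≤ s ^ (m + n) → u ≤ s ⊎ v ≤ s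
^-splitting m n u v s le with u ≤? s | v ≤? s
... | yes u≤s | _       = inj₁ u≤s
... | no  _   | yes v≤s = inj₂ v≤s
... | no  u≰s | no v≰s  = contradiction (≤-trans both le) (<⇒≱ (^-monoˡ-< (m + n) (n<1+n s)))
  where
  both : suc s ^ (m + n) ≤ u ^ m * v ^ n
  both rewrite ^-distribˡ-+-* (suc s) m n = *-mono-≤ (^-monoˡ-≤ m (≰⇒> u≰s)) (^-monoˡ-≤ n (≰⇒> v≰s))

-- B i j is the binomial coefficient i + j over i; having both i and j as
-- arguments avoids truncated subtraction.
B : ℕ → ℕ → ℕ
B zero    j       = 1
B (suc i) zero    = 1
B (suc i) (suc j) = B i (suc j) + B (suc i) j

B-zeroʳ : ∀ i → B i 0 ≡ 1
B-zeroʳ zero    = refl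
B-zeroʳ (suc i) = refl

B-comm : ∀ i j → B i j ≡ B j i
B-comm zero    zero    = refl
B-comm zero    (suc j) = refl
B-comm (suc i) zero    = refl
B-comm (suc i) (suc j) rewrite B-comm i (suc j) | B-comm (suc i) j = +-comm (B (suc j) i) _

B>0 : ∀ i j → 0 < B i j
B>0 zero    j       = z<s
B>0 (suc i) zero    = z<s
B>0 (suc i) (suc j) = ≤-trans (B>0 i (suc j)) (m≤m+n _ _)

-- A single term of the binomial expansion. Pascal's rule in the definition of `B` mirrors the
-- removal of one factor `x + y`, so the full sum is never formed.
B-binomial : ∀ x y i j → B i j * x ^ i * y ^ j ≤ (x + y) ^ (i + j)
B-binomial x y zero j rewrite +-identityʳ (y ^ j) = ^-monoˡ-≤ j (m≤n+m y x)
B-binomial x y (suc i) zero = begin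
  1 * x ^ suc i * 1      ≡⟨ *-identityʳ _ ⟩
  1 * x ^ suc i          ≡⟨ *-identityˡ _ ⟩
  x ^ suc i              ≤⟨ ^-monoˡ-≤ (suc i) (m≤m+n x y) ⟩
  (x + y) ^ suc i        ≡⟨ cong ((x + y) ^_) (sym (+-identityʳ (suc i))) ⟩
  (x + y) ^ (suc i + 0)  ∎
B-binomial x y (suc i) (suc j) = begin
  (B i (suc j) + B (suc i) j) * x ^ suc i * y ^ suc j
    ≡⟨ split x y (B i (suc j)) (B (suc i) j) (x ^ i) (y ^ j) ⟩
  x * (B i (suc j) * x ^ i * y ^ suc j) + y * (B (suc i) j * x ^ suc i * y ^ j)
    ≤⟨ +-mono-≤ (*-monoʳ-≤ x (B-binomial x y i (suc j))) (*-monoʳ-≤ y (B-binomial x y (suc i) j)) ⟩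
  x * (x + y) ^ (i + suc j) + y * (x + y) ^ (suc i + j)
    ≡⟨ cong (λ k → x * (x + y) ^ (i + suc j) + y * (x + y) ^ k) (sym (+-suc i j)) ⟩
  x * (x + y) ^ (i + suc j) + y * (x + y) ^ (i + suc j)
    ≡⟨ *-distribʳ-+ ((x + y) ^ (i + suc j)) x y ⟨
  (x + y) ^ (suc i + suc j) ∎
  where
  split : ∀ x y b b′ p q → (b + b′) * (x * p) * (y * q) ≡ x * (b * p * (y * q)) + y * (b′ * (x * p) * q)
  split = solve-∀

B-absorb : ∀ i j → suc i * B (suc i) j ≡ suc (i + j) * B i j
B-absorb i zero rewrite B-zeroʳ i | +-identityʳ i = refl
B-absorb zero (suc j) = begin-equality
  1 * (1 + B 1 j)      ≡⟨ cong (λ b → 1 * (1 + b)) (sym (*-identityˡ (B 1 j))) ⟩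
  1 * (1 + 1 * B 1 j)  ≡⟨ cong (λ b → 1 * (1 + b)) (B-absorb zero j) ⟩
  1 * (1 + suc j * 1)  ≡⟨ simp j ⟩
  suc (suc j) * 1      ∎
  where
  simp : ∀ j → 1 * (1 + (1 + j) * 1) ≡ (2 + j) * 1
  simp = solve-∀
B-absorb (suc i) (suc j) = begin-equality
  suc (suc i) * (B (suc i) (suc j) + B (suc (suc i)) j)
    ≡⟨ *-distribˡ-+ (suc (suc i)) (B (suc i) (suc j)) (B (suc (suc i)) j) ⟩
  suc (suc i) * B (suc i) (suc j) + suc (suc i) * B (suc (suc i)) j
    ≡⟨ cong₂ _+_ (cong (B (suc i) (suc j) +_) (B-absorb i (suc j))) (B-absorb (suc i) j) ⟩
  (B (suc i) (suc j) + suc (i + suc j) * B i (suc j)) + suc (suc (i + j)) * B (suc i) j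
    ≡⟨ cong (λ k → (B (suc i) (suc j) + suc (i + suc j) * B i (suc j)) + suc k * B (suc i) j) (sym (+-suc i j)) ⟩
  (B (suc i) (suc j) + suc (i + suc j) * B i (suc j)) + suc (i + suc j) * B (suc i) j
    ≡⟨ simp (suc (i + suc j)) (B i (suc j)) (B (suc i) j) ⟩
  suc (suc i + suc j) * B (suc i) (suc j) ∎
  where
  simp : ∀ k b b′ → (b + b′ + k * b) + k * b′ ≡ (1 + k) * (b + b′)
  simp = solve-∀

-- Neighbours in a row of Pascal's triangle have the ratio `suc j` to `suc i`; the comparisons along
-- a row rest on this.
B-shift : ∀ i j → suc i * B (suc i) j ≡ suc j * B i (suc j)
B-shift i j = begin-equality
  suc i * B (suc i) j    ≡⟨ B-absorb i j ⟩
  suc (i + j) * B i j    ≡⟨ cong₂ (λ k b → suc k * b) (+-comm i j) (B-comm i j) ⟩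
  suc (j + i) * B j i    ≡⟨ B-absorb j i ⟨
  suc j * B (suc j) i    ≡⟨ cong (suc j *_) (B-comm (suc j) i) ⟩
  suc j * B i (suc j)    ∎

-- A large term of the binomial expansion of (m + m′) ^ c, built by raising c
-- one step at a time along the line i : j = m : m′.
large-term : ∀ m m′ c → ∃[ i ] ∃[ j ] i + j ≡ c
           × (m + m′) ^ c ≤ suc c * B i j * (m ^ i * m′ ^ j)
           × (m + m′) * i ≤ m * suc c × (m + m′) * j ≤ m′ * suc c
large-term m m′ zero = 0 , 0 , refl , ≤-refl , zero-≤ m , zero-≤ m′
  where
  zero-≤ : ∀ k → (m + m′) * 0 ≤ k * 1
  zero-≤ k rewrite *-zeroʳ (m + m′) = z≤n
large-term m m′ (suc c) with large-term m m′ c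
... | i , j , refl , big , i≤ , j≤ with (m + m′) * suc i ≤? m * suc (suc (i + j))
...   | yes p = suc i , j , refl , *-cancelˡ-≤ (suc i) (*-cancelˡ-≤ (suc c) grow) , p , ≤-trans j≤ (*-monoʳ-≤ m′ (n≤1+n _))
  where
  M = m + m′
  r₁ : ∀ s i M p → s * (i * (M * p)) ≡ (M * i) * (s * p)
  r₁ = solve-∀
  r₂ : ∀ m S s b p q → (m * S) * (s * (s * b * (p * q))) ≡ s * (S * (s * b) * ((m * p) * q))
  r₂ = solve-∀
  r₃ : ∀ S i b x → S * (i * b) * x ≡ i * (S * b * x)
  r₃ = solve-∀
  -- Raising `i` multiplies the term by `m * suc c / suc i`, which by `p` is at least
  -- `M * suc c / suc (suc c)`. The prefactor grows from `suc c` to `suc (suc c)` and makes up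
  -- exactly for this loss.
  grow : suc c * (suc i * M ^ suc c) ≤ suc c * (suc i * (suc (suc c) * B (suc i) j * (m ^ suc i * m′ ^ j)))
  grow = begin
    suc c * (suc i * (M * M ^ c))                                   ≡⟨ r₁ (suc c) (suc i) M (M ^ c) ⟩
    (M * suc i) * (suc c * M ^ c)                                   ≤⟨ *-mono-≤ p (*-monoʳ-≤ (suc c) big) ⟩
    (m * suc (suc c)) * (suc c * (suc c * B i j * (m ^ i * m′ ^ j))) ≡⟨ r₂ m (suc (suc c)) (suc c) (B i j) (m ^ i) (m′ ^ j) ⟩
    suc c * (suc (suc c) * (suc c * B i j) * (m ^ suc i * m′ ^ j))   ≡⟨ cong (λ b → suc c * (suc (suc c) * b * (m ^ suc i * m′ ^ j))) (sym (B-absorb i j)) ⟩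
    suc c * (suc (suc c) * (suc i * B (suc i) j) * (m ^ suc i * m′ ^ j)) ≡⟨ cong (suc c *_) (r₃ (suc (suc c)) (suc i) (B (suc i) j) _) ⟩
    suc c * (suc i * (suc (suc c) * B (suc i) j * (m ^ suc i * m′ ^ j))) ∎
...   | no ¬p = i , suc j , +-suc i j , *-cancelˡ-≤ (suc j) (*-cancelˡ-≤ (suc c) grow) , ≤-trans i≤ (*-monoʳ-≤ m (n≤1+n _)) , q
  where
  M = m + m′
  -- Since `suc i` and `suc j` add up to `suc (suc c)`, at most one of them can exceed its share; if
  -- `suc i` does, `suc j` does not.
  q : M * suc j ≤ m′ * suc (suc c)
  q = +-cancelˡ-≤ (m * suc (suc c)) _ _ (begin
    m * suc (suc c) + M * suc j  ≤⟨ +-monoˡ-≤ (M * suc j) (<⇒≤ (≰⇒> ¬p)) ⟩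
    M * suc i + M * suc j        ≡⟨ r m m′ i j ⟩
    m * suc (suc c) + m′ * suc (suc c) ∎)
    where
    r : ∀ m m′ i j → (m + m′) * (1 + i) + (m + m′) * (1 + j) ≡ m * (2 + (i + j)) + m′ * (2 + (i + j))
    r = solve-∀
  r₁ : ∀ s i M p → s * (i * (M * p)) ≡ (M * i) * (s * p)
  r₁ = solve-∀
  r₂ : ∀ m S s b p q → (m * S) * (s * (s * b * (q * p))) ≡ s * (S * (s * b) * (q * (m * p)))
  r₂ = solve-∀
  r₃ : ∀ S i b x → S * (i * b) * x ≡ i * (S * b * x)
  r₃ = solve-∀
  grow : suc c * (suc j * M ^ suc c) ≤ suc c * (suc j * (suc (suc c) * B i (suc j) * (m ^ i * m′ ^ suc j)))
  grow = begin
    suc c * (suc j * (M * M ^ c))                                   ≡⟨ r₁ (suc c) (suc j) M (M ^ c) ⟩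
    (M * suc j) * (suc c * M ^ c)                                   ≤⟨ *-mono-≤ q (*-monoʳ-≤ (suc c) big) ⟩
    (m′ * suc (suc c)) * (suc c * (suc c * B i j * (m ^ i * m′ ^ j))) ≡⟨ r₂ m′ (suc (suc c)) (suc c) (B i j) (m′ ^ j) (m ^ i) ⟩
    suc c * (suc (suc c) * (suc c * B i j) * (m ^ i * m′ ^ suc j))   ≡⟨ cong (λ b → suc c * (suc (suc c) * b * (m ^ i * m′ ^ suc j))) (trans (sym (B-absorb i j)) (B-shift i j)) ⟩
    suc c * (suc (suc c) * (suc j * B i (suc j)) * (m ^ i * m′ ^ suc j)) ≡⟨ cong (suc c *_) (r₃ (suc (suc c)) (suc j) (B i (suc j)) _) ⟩
    suc c * (suc j * (suc (suc c) * B i (suc j) * (m ^ i * m′ ^ suc j))) ∎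

-- By `B-shift`, passing from `i`, `suc j` to `suc i`, `j` preserves the bound if
-- `suc i * α ≤ suc j * β`. This is hardest at the last step, so the slope is required only there.
climb : ∀ α β K n i₀ j → (n + i₀) * α ≤ suc j * β →
        α ^ i₀ * β ^ (n + j) ≤ K * B i₀ (n + j) → α ^ (n + i₀) * β ^ j ≤ K * B (n + i₀) j
climb α β K zero    i₀ j slope bound = bound
climb α β K (suc n) i₀ j slope bound = *-cancelˡ-≤ (suc i) (begin
    suc i * (α ^ suc i * β ^ j)        ≡⟨ r₁ (suc i) α (α ^ i) (β ^ j) ⟩
    suc i * α * (α ^ i * β ^ j)        ≤⟨ *-monoˡ-≤ _ slope ⟩
    suc j * β * (α ^ i * β ^ j)        ≡⟨ r₂ (suc j) β (α ^ i) (β ^ j) ⟩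
    suc j * (α ^ i * β ^ suc j)        ≤⟨ *-monoʳ-≤ (suc j) previous ⟩
    suc j * (K * B i (suc j))          ≡⟨ r₃ (suc j) K _ ⟩
    K * (suc j * B i (suc j))          ≡⟨ cong (K *_) (sym (B-shift i j)) ⟩
    K * (suc i * B (suc i) j)          ≡⟨ r₃ K (suc i) _ ⟩
    suc i * (K * B (suc i) j)          ∎)
  where
  i = n + i₀
  slope′ : i * α ≤ suc (suc j) * β
  slope′ = ≤-trans (*-monoˡ-≤ α (n≤1+n i)) (≤-trans slope (*-monoˡ-≤ β (n≤1+n (suc j))))
  previous : α ^ i * β ^ suc j ≤ K * B i (suc j)
  previous = climb α β K n i₀ (suc j) slope′
    (subst (λ k → α ^ i₀ * β ^ k ≤ K * B i₀ k) (sym (+-suc n j)) bound)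
  r₁ : ∀ s a p q → s * (a * p * q) ≡ s * a * (p * q)
  r₁ = solve-∀
  r₂ : ∀ s b p q → s * b * (p * q) ≡ s * (p * (b * q))
  r₂ = solve-∀
  r₃ : ∀ s k b → s * (k * b) ≡ k * (s * b)
  r₃ = solve-∀

-- B i j / (α ^ i * β ^ j) is unimodal along i + j = c, so a lower bound on it
-- extends from two points to all points in between.
between : ∀ α β K {i₀ j₀ i j i₁ j₁} → i₀ + j₀ ≡ i + j → i₁ + j₁ ≡ i + j → i₀ ≤ i → i ≤ i₁ →
          α ^ i₀ * β ^ j₀ ≤ K * B i₀ j₀ → α ^ i₁ * β ^ j₁ ≤ K * B i₁ j₁ → α ^ i * β ^ j ≤ K * B i j
between α β K {i₀} {j₀} {i} {j} {i₁} {j₁} eq₀ eq₁ i₀≤i i≤i₁ bound₀ bound₁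
  -- Left of the maximum of the quotient the bound climbs from the left end. Otherwise the opposite
  -- slope holds and it climbs from the right end, with `α` and `β` exchanged.
  with i * α ≤? suc j * β
... | yes slope = subst (λ k → α ^ k * β ^ j ≤ K * B k j) i≡
      (climb α β K (i ∸ i₀) i₀ j (subst (λ k → k * α ≤ suc j * β) (sym i≡) slope)
        (subst (λ k → α ^ i₀ * β ^ k ≤ K * B i₀ k) j≡ bound₀))
  where
  i≡ : i ∸ i₀ + i₀ ≡ i
  i≡ = m∸n+n≡m i₀≤i
  j≡ : j₀ ≡ i ∸ i₀ + j
  j≡ = +-cancelˡ-≡ i₀ _ _ (trans eq₀ (trans (cong (_+ j) (trans (sym i≡) (+-comm (i ∸ i₀) i₀))) (+-assoc i₀ (i ∸ i₀) j)))
... | no ¬slope = flip i j (subst (λ k → β ^ k * α ^ i ≤ K * B k i) j≡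
      (climb β α K (i₁ ∸ i) j₁ i (subst (λ k → k * β ≤ suc i * α) (sym j≡) slope)
        (flip′ i₁ j₁ (i₁ ∸ i + i) (sym (m∸n+n≡m i≤i₁)) bound₁)))
  where
  j≡ : i₁ ∸ i + j₁ ≡ j
  j≡ = +-cancelˡ-≡ i _ _ (trans (sym (+-assoc i _ j₁)) (trans (cong (_+ j₁) (m+[n∸m]≡n i≤i₁)) eq₁))
  slope : j * β ≤ suc i * α
  slope = ≤-trans (*-monoˡ-≤ β (n≤1+n j)) (≤-trans (<⇒≤ (≰⇒> ¬slope)) (*-monoˡ-≤ α (n≤1+n i)))
  flip : ∀ i j → β ^ j * α ^ i ≤ K * B j i → α ^ i * β ^ j ≤ K * B i j
  flip i j rewrite *-comm (α ^ i) (β ^ j) | B-comm i j = λ le → le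
  flip′ : ∀ i j k → i ≡ k → α ^ i * β ^ j ≤ K * B i j → β ^ j * α ^ k ≤ K * B j k
  flip′ i j .i refl rewrite *-comm (α ^ i) (β ^ j) | B-comm i j = λ le → le

-- The hypotheses say x ^ m * y ^ m′ ≤ 1 and x, y ≥ 1 / 2 for the fractions
-- x = p / s and y = q / s.  Since i and j exceed the proportion m : m′ by at
-- most m and m′, the product x ^ i * y ^ j is at most 2.
near-ray : ∀ m m′ .{{_ : NonZero (m + m′)}} p q s .{{_ : NonZero s}} →
           p ^ m * q ^ m′ ≤ s ^ (m + m′) → s ≤ 2 * p → s ≤ 2 * q →
           ∀ i j → (m + m′) * i ≤ m * suc (i + j) → (m + m′) * j ≤ m′ * suc (i + j) →
           p ^ i * q ^ j ≤ 2 * s ^ (i + j)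
-- In M-th powers the exponents `M * i` and `M * j` fall short of the exact proportion
-- `m * suc c : m′ * suc c` by `e` and `f`, with `e + f ≡ M`. The missing factors are supplied by
-- `s ≤ 2 * p` and `s ≤ 2 * q`; this costs `2 ^ M`, which is 2 after the M-th root.
near-ray m m′ p q s on-ray s≤2p s≤2q i j i≤ j≤ = ^-cancelʳ-≤ M (*-cancelʳ-≤ _ _ (s ^ M) {{m^n≢0 s M}} (begin
    (p ^ i * q ^ j) ^ M * s ^ M
      ≡⟨ cong₂ (λ l k → l * s ^ k) (trans (^-distribʳ-* M _ _) (cong₂ _*_ (pow p i) (pow q j))) (sym e+f) ⟩
    p ^ (M * i) * q ^ (M * j) * s ^ (e + f)
      ≤⟨ *-monoʳ-≤ (p ^ (M * i) * q ^ (M * j)) (begin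
         s ^ (e + f)                          ≡⟨ ^-distribˡ-+-* s e f ⟩
         s ^ e * s ^ f                        ≤⟨ *-mono-≤ (^-monoˡ-≤ e s≤2p) (^-monoˡ-≤ f s≤2q) ⟩
         (2 * p) ^ e * (2 * q) ^ f            ≡⟨ cong₂ _*_ (^-distribʳ-* e 2 p) (^-distribʳ-* f 2 q) ⟩
         2 ^ e * p ^ e * (2 ^ f * q ^ f)      ∎) ⟩
    p ^ (M * i) * q ^ (M * j) * (2 ^ e * p ^ e * (2 ^ f * q ^ f))
      ≡⟨ r (p ^ (M * i)) (q ^ (M * j)) (2 ^ e) (p ^ e) (2 ^ f) (q ^ f) ⟩
    2 ^ e * 2 ^ f * (p ^ (M * i) * p ^ e * (q ^ (M * j) * q ^ f))
      ≡⟨ cong₂ _*_ (sym (^-distribˡ-+-* 2 e f)) (cong₂ _*_ (sym (^-distribˡ-+-* p (M * i) e)) (sym (^-distribˡ-+-* q (M * j) f))) ⟩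
    2 ^ (e + f) * (p ^ (M * i + e) * q ^ (M * j + f))
      ≡⟨ cong₂ _*_ (cong (2 ^_) e+f) (cong₂ (λ k l → p ^ k * q ^ l) e≡ f≡) ⟩
    2 ^ M * (p ^ (m * suc c) * q ^ (m′ * suc c))
      ≡⟨ cong (2 ^ M *_) (trans (cong₂ _*_ (sym (^-*-assoc p m (suc c))) (sym (^-*-assoc q m′ (suc c)))) (sym (^-distribʳ-* (suc c) (p ^ m) (q ^ m′)))) ⟩
    2 ^ M * (p ^ m * q ^ m′) ^ suc c
      ≤⟨ *-monoʳ-≤ (2 ^ M) (^-monoˡ-≤ (suc c) on-ray) ⟩
    2 ^ M * (s ^ M) ^ suc c
      ≡⟨ cong (2 ^ M *_) (*-comm (s ^ M) _) ⟩
    2 ^ M * ((s ^ M) ^ c * s ^ M)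
      ≡⟨ *-assoc (2 ^ M) _ _ ⟨
    2 ^ M * (s ^ M) ^ c * s ^ M
      ≡⟨ cong (_* s ^ M) (trans (cong (2 ^ M *_) (^-swap s M c)) (sym (^-distribʳ-* M 2 (s ^ c)))) ⟩
    (2 * s ^ c) ^ M * s ^ M ∎))
  where
  M = m + m′
  c = i + j
  e = m * suc c ∸ M * i
  f = m′ * suc c ∸ M * j
  e≡ : M * i + e ≡ m * suc c
  e≡ = m+[n∸m]≡n i≤
  f≡ : M * j + f ≡ m′ * suc c
  f≡ = m+[n∸m]≡n j≤
  e+f : e + f ≡ M
  e+f = +-cancelˡ-≡ (M * i + M * j) _ _ (trans (r₁ (M * i) (M * j) e f) (trans (cong₂ _+_ e≡ f≡) (r₂ m m′ i j)))
    where
    r₁ : ∀ x y e f → x + y + (e + f) ≡ (x + e) + (y + f)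
    r₁ = solve-∀
    r₂ : ∀ m m′ i j → m * (1 + (i + j)) + m′ * (1 + (i + j)) ≡ (m + m′) * i + (m + m′) * j + (m + m′)
    r₂ = solve-∀
  pow : ∀ x k → (x ^ k) ^ M ≡ x ^ (M * k)
  pow x k = trans (^-*-assoc x k M) (cong (x ^_) (*-comm k M))
  r : ∀ a b t x u y → a * b * (t * x * (u * y)) ≡ t * u * (a * x * (b * y))
  r = solve-∀

-- The rates are the fractions α / E and β / E, with the denominator cleared.
Good : (α β E i j : ℕ) → Set
Good α β E i j = α ^ i * β ^ j ≤ 2 * suc (i + j) * E ^ (i + j) * B i j

-- The first inequality is the claim without its polynomial factor: in the proportion `m : m′`
-- binomials grow by the factor `(m + m′) ^ (m + m′) / (m ^ m * m′ ^ m′)` per `m + m′` steps. The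
-- large term and the bounds on `i` and `j` come from `large-term`, and `near-ray` accounts for
-- rounding to a lattice point.
good-on-ray : ∀ m m′ .{{_ : NonZero (m + m′)}} α β E .{{_ : NonZero E}} →
              (α * m) ^ m * (β * m′) ^ m′ ≤ (E * (m + m′)) ^ (m + m′) →
              E * (m + m′) ≤ 2 * (α * m) → E * (m + m′) ≤ 2 * (β * m′) →
              ∀ i j → (m + m′) ^ (i + j) ≤ suc (i + j) * B i j * (m ^ i * m′ ^ j) →
              (m + m′) * i ≤ m * suc (i + j) → (m + m′) * j ≤ m′ * suc (i + j) →
              Good α β E i j
good-on-ray m m′ α β E on-ray ≤m ≤m′ i j big i≤ j≤ = *-cancelʳ-≤ _ _ ((m + m′) ^ c) {{m^n≢0 (m + m′) c}} (begin
    α ^ i * β ^ j * M ^ c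
      ≤⟨ *-monoʳ-≤ (α ^ i * β ^ j) big ⟩
    α ^ i * β ^ j * (suc c * B i j * (m ^ i * m′ ^ j))
      ≡⟨ r₁ (α ^ i) (β ^ j) (suc c * B i j) (m ^ i) (m′ ^ j) ⟩
    suc c * B i j * (α ^ i * m ^ i * (β ^ j * m′ ^ j))
      ≡⟨ cong (suc c * B i j *_) (cong₂ _*_ (sym (^-distribʳ-* i α m)) (sym (^-distribʳ-* j β m′))) ⟩
    suc c * B i j * ((α * m) ^ i * (β * m′) ^ j)
      ≤⟨ *-monoʳ-≤ (suc c * B i j) (near-ray m m′ (α * m) (β * m′) (E * M) {{m*n≢0 E M}} on-ray ≤m ≤m′ i j i≤ j≤) ⟩
    suc c * B i j * (2 * (E * M) ^ c)
      ≡⟨ cong (λ z → suc c * B i j * (2 * z)) (^-distribʳ-* c E M) ⟩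
    suc c * B i j * (2 * (E ^ c * M ^ c))
      ≡⟨ r₂ (suc c) (B i j) (E ^ c) (M ^ c) ⟩
    2 * suc c * E ^ c * B i j * M ^ c ∎)
  where
  M = m + m′
  c = i + j
  r₁ : ∀ a b k p q → a * b * (k * (p * q)) ≡ k * (a * p * (b * q))
  r₁ = solve-∀
  r₂ : ∀ s b e d → s * b * (2 * (e * d)) ≡ 2 * s * e * b * d
  r₂ = solve-∀

good-between : ∀ α β E {i₀ j₀ i j i₁ j₁} → i₀ + j₀ ≡ i + j → i₁ + j₁ ≡ i + j → i₀ ≤ i → i ≤ i₁ →
               Good α β E i₀ j₀ → Good α β E i₁ j₁ → Good α β E i j
good-between α β E {i₀} {j₀} {i} {j} {i₁} {j₁} eq₀ eq₁ i₀≤i i≤i₁ g₀ g₁ =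
  between α β (2 * suc (i + j) * E ^ (i + j)) eq₀ eq₁ i₀≤i i≤i₁
    (subst (λ c → α ^ i₀ * β ^ j₀ ≤ 2 * suc c * E ^ c * B i₀ j₀) eq₀ g₀)
    (subst (λ c → α ^ i₁ * β ^ j₁ ≤ 2 * suc c * E ^ c * B i₁ j₁) eq₁ g₁)

-- Balancing the two degrees

-- The binomial theorem at `z / Q` gives `B i j * (z / Q) ^ i ≤ (1 + z / Q) ^ (i +
-- j)`, and the hypothesis says `(1 + z / Q) ^ m ≤ (T / Q) ^ (m +
-- m′)`. The power `m` keeps the weight `m / (m + m′)` of the mean integral.
tilted-bound : ∀ m m′ z Q T → (Q + z) ^ m * Q ^ m′ ≤ T ^ (m + m′) → ∀ i j →
               B i j ^ m * (z ^ m) ^ i * (Q ^ (m + m′)) ^ (i + j) ≤ (T ^ (m + m′)) ^ (i + j) * (Q ^ m) ^ i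
tilted-bound m m′ z Q T tilt i j = begin
  b ^ m * (z ^ m) ^ i * (Q ^ (m + m′)) ^ n
    ≡⟨ cong (λ x → b ^ m * (z ^ m) ^ i * x) (trans (cong (_^ n) (^-distribˡ-+-* Q m m′)) (^-distribʳ-* n (Q ^ m) (Q ^ m′))) ⟩
  b ^ m * (z ^ m) ^ i * ((Q ^ m) ^ n * (Q ^ m′) ^ n)
    ≡⟨ cong (λ x → b ^ m * (z ^ m) ^ i * (x * (Q ^ m′) ^ n)) (^-distribˡ-+-* (Q ^ m) i j) ⟩
  b ^ m * (z ^ m) ^ i * ((Q ^ m) ^ i * (Q ^ m) ^ j * (Q ^ m′) ^ n)
    ≡⟨ r₁ (b ^ m) ((z ^ m) ^ i) ((Q ^ m) ^ i) ((Q ^ m) ^ j) ((Q ^ m′) ^ n) ⟩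
  b ^ m * (z ^ m) ^ i * (Q ^ m) ^ j * (Q ^ m′) ^ n * (Q ^ m) ^ i
    ≡⟨ cong (λ x → x * (Q ^ m′) ^ n * (Q ^ m) ^ i) (cong₂ (λ x y → b ^ m * x * y) (^-swap z m i) (^-swap Q m j)) ⟩
  b ^ m * (z ^ i) ^ m * (Q ^ j) ^ m * (Q ^ m′) ^ n * (Q ^ m) ^ i
    ≡⟨ cong (λ x → x * (Q ^ m′) ^ n * (Q ^ m) ^ i) (trans (cong (_* (Q ^ j) ^ m) (sym (^-distribʳ-* m b (z ^ i)))) (sym (^-distribʳ-* m (b * z ^ i) (Q ^ j)))) ⟩
  (b * z ^ i * Q ^ j) ^ m * (Q ^ m′) ^ n * (Q ^ m) ^ i
    ≤⟨ *-monoˡ-≤ ((Q ^ m) ^ i) (*-monoˡ-≤ ((Q ^ m′) ^ n) (^-monoˡ-≤ m (B-binomial z Q i j))) ⟩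
  ((z + Q) ^ n) ^ m * (Q ^ m′) ^ n * (Q ^ m) ^ i
    ≡⟨ cong (λ x → x * (Q ^ m′) ^ n * (Q ^ m) ^ i) (trans (^-swap (z + Q) n m) (cong (λ x → (x ^ m) ^ n) (+-comm z Q))) ⟩
  ((Q + z) ^ m) ^ n * (Q ^ m′) ^ n * (Q ^ m) ^ i
    ≡⟨ cong (_* (Q ^ m) ^ i) (sym (^-distribʳ-* n ((Q + z) ^ m) (Q ^ m′))) ⟩
  ((Q + z) ^ m * Q ^ m′) ^ n * (Q ^ m) ^ i
    ≤⟨ *-monoˡ-≤ ((Q ^ m) ^ i) (^-monoˡ-≤ n tilt) ⟩
  (T ^ (m + m′)) ^ n * (Q ^ m) ^ i ∎
  where
  b = B i j
  n = i + j
  r₁ : ∀ b z x y w → b * z * (x * y * w) ≡ b * z * y * w * x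
  r₁ = solve-∀

-- X and Y are the numbers of sets that a vector lies in, up to a common
-- factor B i j.  The claim is min(X, Y) ≤ (T / Q) ^ (a + a′ + i + j), up to a
-- polynomial.
Balanced : (T Q a a′ i j : ℕ) → Set
Balanced T Q a a′ i j =
    B i (j + a′) * Q ^ n ≤ 2 * suc n * T ^ n * B i j
  ⊎ B (i + a) j * Q ^ n ≤ 2 * suc n * T ^ n * B i j
  where n = a + a′ + (i + j)

-- With θ = m / (m + m′), the weighted geometric mean of X and Y with weights θ
-- and 1 - θ is bounded.
balanced-by-mean : ∀ m m′ .{{_ : NonZero (m + m′)}} z w α β T Q
  .{{_ : NonZero z}} .{{_ : NonZero w}} .{{_ : NonZero Q}} →
  (Q + z) ^ m * Q ^ m′ ≤ T ^ (m + m′) → (Q + w) ^ m′ * Q ^ m ≤ T ^ (m′ + m) →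
  T ^ (m + m′) * Q ^ m ≤ α ^ (m + m′) * z ^ m → T ^ (m + m′) * Q ^ m′ ≤ β ^ (m + m′) * w ^ m′ →
  ∀ a a′ i j → Good α β Q i j → Balanced T Q a a′ i j
balanced-by-mean m m′ z w α β T Q tilt-z tilt-w α-large β-large a a′ i j good =
  ^-splitting m m′ _ _ _
    (*-cancelˡ-≤ (z₁ ^ i * w₁ ^ j * Q₂ ^ c) {{m*n≢0 _ _ {{m*n≢0 _ _ {{m^n≢0 z₁ i {{m^n≢0 z m}}}} {{m^n≢0 w₁ j {{m^n≢0 w m′}}}}}} {{m^n≢0 Q₂ c {{m^n≢0 Q M}}}}}} (begin
    z₁ ^ i * w₁ ^ j * Q₂ ^ c * ((u * Q ^ n) ^ m * (v * Q ^ n) ^ m′)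
      ≡⟨ cong (z₁ ^ i * w₁ ^ j * Q₂ ^ c *_) (cong₂ _*_ (^-distribʳ-* m u (Q ^ n)) (^-distribʳ-* m′ v (Q ^ n))) ⟩
    z₁ ^ i * w₁ ^ j * Q₂ ^ c * (u ^ m * (Q ^ n) ^ m * (v ^ m′ * (Q ^ n) ^ m′))
      ≡⟨ r₁ (z₁ ^ i) (w₁ ^ j) (Q₂ ^ c) (u ^ m) ((Q ^ n) ^ m) (v ^ m′) ((Q ^ n) ^ m′) ⟩
    u ^ m * z₁ ^ i * (v ^ m′ * w₁ ^ j) * ((Q ^ n) ^ m * (Q ^ n) ^ m′ * Q₂ ^ c)
      ≡⟨ cong (u ^ m * z₁ ^ i * (v ^ m′ * w₁ ^ j) *_) powers ⟩
    u ^ m * z₁ ^ i * (v ^ m′ * w₁ ^ j) * (Q₂ ^ (i + (j + a′)) * Q₂ ^ (j + (i + a)))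
      ≡⟨ r₂ (u ^ m * z₁ ^ i) (v ^ m′ * w₁ ^ j) _ _ ⟩
    u ^ m * z₁ ^ i * Q₂ ^ (i + (j + a′)) * (v ^ m′ * w₁ ^ j * Q₂ ^ (j + (i + a)))
      ≤⟨ *-mono-≤ (tilted-bound m m′ z Q T tilt-z i (j + a′)) v-bound ⟩
    T₂ ^ (i + (j + a′)) * (Q ^ m) ^ i * (T₂ ^ (j + (i + a)) * (Q ^ m′) ^ j)
      ≡⟨ r₃ (T₂ ^ (i + (j + a′))) ((Q ^ m) ^ i) (T₂ ^ (j + (i + a))) ((Q ^ m′) ^ j) ⟩
    T₂ ^ (i + (j + a′)) * T₂ ^ (j + (i + a)) * ((Q ^ m) ^ i * (Q ^ m′) ^ j)
      ≡⟨ cong (_* ((Q ^ m) ^ i * (Q ^ m′) ^ j)) T-powers ⟩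
    T₂ ^ n * (T₂ ^ i * T₂ ^ j) * ((Q ^ m) ^ i * (Q ^ m′) ^ j)
      ≡⟨ r₄ (T₂ ^ n) (T₂ ^ i) (T₂ ^ j) ((Q ^ m) ^ i) ((Q ^ m′) ^ j) ⟩
    T₂ ^ n * (T₂ ^ i * (Q ^ m) ^ i * (T₂ ^ j * (Q ^ m′) ^ j))
      ≡⟨ cong (T₂ ^ n *_) (cong₂ _*_ (sym (^-distribʳ-* i T₂ (Q ^ m))) (sym (^-distribʳ-* j T₂ (Q ^ m′)))) ⟩
    -- The lengths of the two binomial rows add up to `n + c`, so a surplus `(T / Q) ^ c` remains
    -- besides the tilts `Q / z` and `Q / w`. The rates `α / Q` and `β / Q` are chosen to dominate
    -- it, and `good` then turns it into `B i j`.
    T₂ ^ n * ((T₂ * Q ^ m) ^ i * (T₂ * Q ^ m′) ^ j)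
      ≤⟨ *-monoʳ-≤ (T₂ ^ n) (*-mono-≤ (^-monoˡ-≤ i α-large) (^-monoˡ-≤ j β-large)) ⟩
    T₂ ^ n * ((α ^ M * z₁) ^ i * (β ^ M * w₁) ^ j)
      ≡⟨ cong (T₂ ^ n *_) (cong₂ _*_ (^-distribʳ-* i (α ^ M) z₁) (^-distribʳ-* j (β ^ M) w₁)) ⟩
    T₂ ^ n * ((α ^ M) ^ i * z₁ ^ i * ((β ^ M) ^ j * w₁ ^ j))
      ≡⟨ cong (T₂ ^ n *_) (cong₂ (λ x y → x * z₁ ^ i * (y * w₁ ^ j)) (^-swap α M i) (^-swap β M j)) ⟩
    T₂ ^ n * ((α ^ i) ^ M * z₁ ^ i * ((β ^ j) ^ M * w₁ ^ j))
      ≡⟨ r₅ (T₂ ^ n) ((α ^ i) ^ M) (z₁ ^ i) ((β ^ j) ^ M) (w₁ ^ j) ⟩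
    z₁ ^ i * w₁ ^ j * T₂ ^ n * ((α ^ i) ^ M * (β ^ j) ^ M)
      ≡⟨ cong (z₁ ^ i * w₁ ^ j * T₂ ^ n *_) (sym (^-distribʳ-* M (α ^ i) (β ^ j))) ⟩
    z₁ ^ i * w₁ ^ j * T₂ ^ n * (α ^ i * β ^ j) ^ M
      ≤⟨ *-monoʳ-≤ (z₁ ^ i * w₁ ^ j * T₂ ^ n) (^-monoˡ-≤ M good′) ⟩
    z₁ ^ i * w₁ ^ j * T₂ ^ n * (2 * suc n * b * Q ^ c) ^ M
      ≡⟨ cong (z₁ ^ i * w₁ ^ j * T₂ ^ n *_) (trans (^-distribʳ-* M (2 * suc n * b) (Q ^ c)) (cong ((2 * suc n * b) ^ M *_) (^-swap Q c M))) ⟩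
    z₁ ^ i * w₁ ^ j * T₂ ^ n * ((2 * suc n * b) ^ M * Q₂ ^ c)
      ≡⟨ r₆ (z₁ ^ i * w₁ ^ j) (T₂ ^ n) ((2 * suc n * b) ^ M) (Q₂ ^ c) ⟩
    z₁ ^ i * w₁ ^ j * Q₂ ^ c * (T₂ ^ n * (2 * suc n * b) ^ M)
      ≡⟨ cong (z₁ ^ i * w₁ ^ j * Q₂ ^ c *_) (trans (cong (_* (2 * suc n * b) ^ M) (^-swap T M n)) (sym (^-distribʳ-* M (T ^ n) (2 * suc n * b)))) ⟩
    z₁ ^ i * w₁ ^ j * Q₂ ^ c * (T ^ n * (2 * suc n * b)) ^ M
      ≡⟨ cong (λ x → z₁ ^ i * w₁ ^ j * Q₂ ^ c * x ^ M) (r₇ (T ^ n) (2 * suc n) b) ⟩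
    z₁ ^ i * w₁ ^ j * Q₂ ^ c * (2 * suc n * T ^ n * b) ^ M ∎))
  where
  M = m + m′
  n = a + a′ + (i + j)
  c = i + j
  b = B i j
  u = B i (j + a′)
  v = B (i + a) j
  z₁ = z ^ m
  w₁ = w ^ m′
  Q₂ = Q ^ M
  T₂ = T ^ M
  r₁ : ∀ x y z u p v q → x * y * z * (u * p * (v * q)) ≡ u * x * (v * y) * (p * q * z)
  r₁ = solve-∀
  r₂ : ∀ x y p q → x * y * (p * q) ≡ x * p * (y * q)
  r₂ = solve-∀
  r₃ : ∀ x y p q → x * y * (p * q) ≡ x * p * (y * q)
  r₃ = solve-∀
  r₄ : ∀ t x y p q → t * (x * y) * (p * q) ≡ t * (x * p * (y * q))
  r₄ = solve-∀
  r₅ : ∀ t x z y w → t * (x * z * (y * w)) ≡ z * w * t * (x * y)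
  r₅ = solve-∀
  r₆ : ∀ x t p q → x * t * (p * q) ≡ x * q * (t * p)
  r₆ = solve-∀
  r₇ : ∀ t k b → t * (k * b) ≡ k * t * b
  r₇ = solve-∀
  exponents : ∀ a a′ i j → i + (j + a′) + (j + (i + a)) ≡ a + a′ + (i + j) + (i + j)
  exponents = solve-∀
  powers : (Q ^ n) ^ m * (Q ^ n) ^ m′ * Q₂ ^ c ≡ Q₂ ^ (i + (j + a′)) * Q₂ ^ (j + (i + a))
  powers = begin-equality
    (Q ^ n) ^ m * (Q ^ n) ^ m′ * Q₂ ^ c         ≡⟨ cong (_* Q₂ ^ c) (trans (sym (^-distribˡ-+-* (Q ^ n) m m′)) (^-swap Q n M)) ⟩
    Q₂ ^ n * Q₂ ^ c                             ≡⟨ ^-distribˡ-+-* Q₂ n c ⟨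
    Q₂ ^ (n + c)                                ≡⟨ cong (Q₂ ^_) (exponents a a′ i j) ⟨
    Q₂ ^ (i + (j + a′) + (j + (i + a)))         ≡⟨ ^-distribˡ-+-* Q₂ (i + (j + a′)) _ ⟩
    Q₂ ^ (i + (j + a′)) * Q₂ ^ (j + (i + a))    ∎
  T-powers : T₂ ^ (i + (j + a′)) * T₂ ^ (j + (i + a)) ≡ T₂ ^ n * (T₂ ^ i * T₂ ^ j)
  T-powers = begin-equality
    T₂ ^ (i + (j + a′)) * T₂ ^ (j + (i + a))    ≡⟨ ^-distribˡ-+-* T₂ (i + (j + a′)) _ ⟨
    T₂ ^ (i + (j + a′) + (j + (i + a)))         ≡⟨ cong (T₂ ^_) (exponents a a′ i j) ⟩
    T₂ ^ (n + c)                                ≡⟨ ^-distribˡ-+-* T₂ n c ⟩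
    T₂ ^ n * T₂ ^ c                             ≡⟨ cong (T₂ ^ n *_) (^-distribˡ-+-* T₂ i j) ⟩
    T₂ ^ n * (T₂ ^ i * T₂ ^ j)                  ∎
  v-bound : v ^ m′ * w₁ ^ j * Q₂ ^ (j + (i + a)) ≤ T₂ ^ (j + (i + a)) * (Q ^ m′) ^ j
  v-bound = subst₂ (λ x k → x ^ m′ * w₁ ^ j * (Q ^ k) ^ (j + (i + a)) ≤ (T ^ k) ^ (j + (i + a)) * (Q ^ m′) ^ j)
    (B-comm j (i + a)) (+-comm m′ m) (tilted-bound m′ m w Q T tilt-w j (i + a))
  good′ : α ^ i * β ^ j ≤ 2 * suc n * b * Q ^ c
  good′ = begin
    α ^ i * β ^ j            ≤⟨ good ⟩
    2 * suc c * Q ^ c * b    ≡⟨ r (2 * suc c) (Q ^ c) b ⟩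
    2 * suc c * b * Q ^ c    ≤⟨ *-monoˡ-≤ (Q ^ c) (*-monoˡ-≤ b (*-monoʳ-≤ 2 (s≤s (m≤n+m c (a + a′))))) ⟩
    2 * suc n * b * Q ^ c    ∎
    where
    r : ∀ k q b → k * q * b ≡ k * b * q
    r = solve-∀

-- The case θ = 1, in which Y does not enter. The tilt `z / Q` costs `(Q / z) ^ i`, and `Good` with
-- the rates `Q / z` and 1 says that `B i j` pays for it.
balanced-by-X : ∀ z Q .{{_ : NonZero z}} .{{_ : NonZero Q}} a a′ i j →
                Good Q z z i j → Balanced (Q + z) Q a a′ i j
balanced-by-X z Q a a′ i j good = inj₁ (*-cancelˡ-≤ (z ^ i) {{m^n≢0 z i}} (begin
    z ^ i * (u * Q ^ n)
      ≡⟨ cong (λ x → z ^ i * (u * x)) (trans (cong (Q ^_) (exponents a a′ i j)) (trans (^-distribˡ-+-* Q i _) (cong (Q ^ i *_) (^-distribˡ-+-* Q (j + a′) a)))) ⟩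
    z ^ i * (u * (Q ^ i * (Q ^ (j + a′) * Q ^ a)))
      ≡⟨ r₁ (z ^ i) u (Q ^ i) (Q ^ (j + a′)) (Q ^ a) ⟩
    u * z ^ i * Q ^ (j + a′) * Q ^ i * Q ^ a
      ≤⟨ *-mono-≤ (*-mono-≤ (B-binomial z Q i (j + a′)) good′) (^-monoˡ-≤ a (m≤n+m Q z)) ⟩
    (z + Q) ^ (i + (j + a′)) * (2 * suc n * z ^ i * b) * (z + Q) ^ a
      ≡⟨ r₂ ((z + Q) ^ (i + (j + a′))) (2 * suc n) (z ^ i) b _ ⟩
    z ^ i * (2 * suc n * ((z + Q) ^ (i + (j + a′)) * (z + Q) ^ a) * b)
      ≡⟨ cong (λ x → z ^ i * (2 * suc n * x * b)) (trans (sym (^-distribˡ-+-* (z + Q) (i + (j + a′)) a)) (cong₂ _^_ (+-comm z Q) (trans (+-assoc i _ a) (sym (exponents a a′ i j))))) ⟩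
    z ^ i * (2 * suc n * (Q + z) ^ n * b) ∎))
  where
  n = a + a′ + (i + j)
  c = i + j
  b = B i j
  u = B i (j + a′)
  exponents : ∀ a a′ i j → a + a′ + (i + j) ≡ i + ((j + a′) + a)
  exponents = solve-∀
  r₁ : ∀ z u p q r → z * (u * (p * (q * r))) ≡ u * z * q * p * r
  r₁ = solve-∀
  r₂ : ∀ p k z b q → p * (k * z * b) * q ≡ z * (k * (p * q) * b)
  r₂ = solve-∀
  good′ : Q ^ i ≤ 2 * suc n * z ^ i * b
  good′ = *-cancelʳ-≤ _ _ (z ^ j) {{m^n≢0 z j}} (begin
    Q ^ i * z ^ j                    ≤⟨ good ⟩
    2 * suc c * z ^ c * b            ≤⟨ *-monoˡ-≤ b (*-monoˡ-≤ (z ^ c) (*-monoʳ-≤ 2 (s≤s (m≤n+m c (a + a′))))) ⟩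
    2 * suc n * z ^ c * b            ≡⟨ cong (λ x → 2 * suc n * x * b) (^-distribˡ-+-* z i j) ⟩
    2 * suc n * (z ^ i * z ^ j) * b  ≡⟨ r (2 * suc n) (z ^ i) (z ^ j) b ⟩
    2 * suc n * z ^ i * b * z ^ j    ∎)
    where
    r : ∀ k x y b → k * (x * y) * b ≡ k * x * b * y
    r = solve-∀

T₀ Q₀ : ℕ
T₀ = 115499
Q₀ = 100000

-- By the position of i / (i + j) relative to 10 / 29, 13 / 27 and 1 / 2, the
-- weight θ of the mean is 1, 7 / 12 or 1 / 2.  T₀ / Q₀ is slightly less than
-- 1.155, to leave room for the polynomial.  To five digits, z and w are the
-- largest numbers that satisfy the hypotheses of balanced-by-mean, and α and β are
-- then the smallest.
balanced-half : ∀ a a′ i j i₁ j₁ → i₁ + j₁ ≡ i + j → i ≤ i₁ →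
  2 ^ (i₁ + j₁) ≤ suc (i₁ + j₁) * B i₁ j₁ * (1 ^ i₁ * 1 ^ j₁) →
  2 * i₁ ≤ 1 * suc (i₁ + j₁) → 2 * j₁ ≤ 1 * suc (i₁ + j₁) →
  Balanced T₀ Q₀ a a′ i j
balanced-half a a′ i j i₁ j₁ eq₁ i≤i₁ big₁ i₁≤ j₁≤
  with large-term 10 19 (i + j) | large-term 13 14 (i + j)
... | i₃ , j₃ , eq₃ , big₃ , i₃≤ , j₃≤ | i₂ , j₂ , eq₂ , big₂ , i₂≤ , j₂≤
  with i ≤? i₃ | i ≤? i₂
... | yes i≤i₃ | _ =
  -- 15499 is `T₀ - Q₀`, so `Q + z` is exactly `T₀`. The left end of the interval is `i = 0`, where
  -- the claim is immediate.
  balanced-by-X 15499 Q₀ a a′ i j (good-between Q₀ 15499 15499 refl eq₃ z≤n i≤i₃ at-0 at-₃)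
  where
  at-0 : Good Q₀ 15499 15499 0 (i + j)
  at-0 = ≤-trans (m≤n*m _ (2 * suc (i + j)))
           (≤-reflexive (trans (cong (2 * suc (i + j) *_) (*-identityˡ _)) (sym (*-identityʳ _))))
  at-₃ : Good Q₀ 15499 15499 i₃ j₃
  at-₃ = good-on-ray 10 19 Q₀ 15499 15499 (≤ᵇ⇒≤ _ _ tt) (≤ᵇ⇒≤ _ _ tt) (≤ᵇ⇒≤ _ _ tt) i₃ j₃
    (subst (λ c → 29 ^ c ≤ suc c * B i₃ j₃ * (10 ^ i₃ * 19 ^ j₃)) (sym eq₃) big₃)
    (subst (λ c → 29 * i₃ ≤ 10 * suc c) (sym eq₃) i₃≤)
    (subst (λ c → 29 * j₃ ≤ 19 * suc c) (sym eq₃) j₃≤)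
... | no i≰i₃ | yes i≤i₂ =
  balanced-by-mean 7 5 28019 41314 α β T₀ Q₀ (≤ᵇ⇒≤ _ _ tt) (≤ᵇ⇒≤ _ _ tt) (≤ᵇ⇒≤ _ _ tt) (≤ᵇ⇒≤ _ _ tt)
    a a′ i j (good-between α β Q₀ eq₃ eq₂ (<⇒≤ (≰⇒> i≰i₃)) i≤i₂ at-₃ at-₂)
  where
  α = 242604
  β = 166932
  at-₃ : Good α β Q₀ i₃ j₃
  at-₃ = good-on-ray 10 19 α β Q₀ (≤ᵇ⇒≤ _ _ tt) (≤ᵇ⇒≤ _ _ tt) (≤ᵇ⇒≤ _ _ tt) i₃ j₃
    (subst (λ c → 29 ^ c ≤ suc c * B i₃ j₃ * (10 ^ i₃ * 19 ^ j₃)) (sym eq₃) big₃)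
    (subst (λ c → 29 * i₃ ≤ 10 * suc c) (sym eq₃) i₃≤)
    (subst (λ c → 29 * j₃ ≤ 19 * suc c) (sym eq₃) j₃≤)
  at-₂ : Good α β Q₀ i₂ j₂
  at-₂ = good-on-ray 13 14 α β Q₀ (≤ᵇ⇒≤ _ _ tt) (≤ᵇ⇒≤ _ _ tt) (≤ᵇ⇒≤ _ _ tt) i₂ j₂
    (subst (λ c → 27 ^ c ≤ suc c * B i₂ j₂ * (13 ^ i₂ * 14 ^ j₂)) (sym eq₂) big₂)
    (subst (λ c → 27 * i₂ ≤ 13 * suc c) (sym eq₂) i₂≤)
    (subst (λ c → 27 * j₂ ≤ 14 * suc c) (sym eq₂) j₂≤)
... | no i≰i₃ | no i≰i₂ =
  balanced-by-mean 1 1 33400 33400 α α T₀ Q₀ (≤ᵇ⇒≤ _ _ tt) (≤ᵇ⇒≤ _ _ tt) (≤ᵇ⇒≤ _ _ tt) (≤ᵇ⇒≤ _ _ tt)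
    a a′ i j (good-between α α Q₀ eq₂ eq₁ (<⇒≤ (≰⇒> i≰i₂)) i≤i₁ at-₂ at-₁)
  where
  α = 199851
  at-₂ : Good α α Q₀ i₂ j₂
  at-₂ = good-on-ray 13 14 α α Q₀ (≤ᵇ⇒≤ _ _ tt) (≤ᵇ⇒≤ _ _ tt) (≤ᵇ⇒≤ _ _ tt) i₂ j₂
    (subst (λ c → 27 ^ c ≤ suc c * B i₂ j₂ * (13 ^ i₂ * 14 ^ j₂)) (sym eq₂) big₂)
    (subst (λ c → 27 * i₂ ≤ 13 * suc c) (sym eq₂) i₂≤)
    (subst (λ c → 27 * j₂ ≤ 14 * suc c) (sym eq₂) j₂≤)
  at-₁ : Good α α Q₀ i₁ j₁
  at-₁ = good-on-ray 1 1 α α Q₀ (≤ᵇ⇒≤ _ _ tt) (≤ᵇ⇒≤ _ _ tt) (≤ᵇ⇒≤ _ _ tt) i₁ j₁ big₁ i₁≤ j₁≤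

-- Passing to the complements of the sets exchanges `a` with `a′`, `i` with `j` and X with Y, so
-- estimates are needed only on one side of the point `i₁`, `j₁` near the proportion 1 : 1.
balanced : ∀ a a′ i j → Balanced T₀ Q₀ a a′ i j
balanced a a′ i j with large-term 1 1 (i + j)
... | i₁ , j₁ , eq₁ , big₁ , i₁≤ , j₁≤
  with i ≤? i₁ | subst (λ c → 2 ^ c ≤ suc c * B i₁ j₁ * (1 ^ i₁ * 1 ^ j₁)) (sym eq₁) big₁
     | subst (λ c → 2 * i₁ ≤ 1 * suc c) (sym eq₁) i₁≤ | subst (λ c → 2 * j₁ ≤ 1 * suc c) (sym eq₁) j₁≤
... | yes i≤i₁ | big | i≤ | j≤ = balanced-half a a′ i j i₁ j₁ eq₁ i≤i₁ big i≤ j≤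
... | no  i≰i₁ | big | i≤ | j≤ = mirror
  (balanced-half a′ a j i j₁ i₁ eq j≤j₁ big′
    (subst (λ c → 2 * j₁ ≤ 1 * suc c) (+-comm i₁ j₁) j≤) (subst (λ c → 2 * i₁ ≤ 1 * suc c) (+-comm i₁ j₁) i≤))
  where
  eq : j₁ + i₁ ≡ j + i
  eq = trans (+-comm j₁ i₁) (trans eq₁ (+-comm i j))
  j≤j₁ : j ≤ j₁
  j≤j₁ = +-cancelˡ-≤ i j j₁ (≤-trans (≤-reflexive (sym eq₁)) (+-monoˡ-≤ j₁ (<⇒≤ (≰⇒> i≰i₁))))
  big′ : 2 ^ (j₁ + i₁) ≤ suc (j₁ + i₁) * B j₁ i₁ * (1 ^ j₁ * 1 ^ i₁)
  big′ = subst₂ _≤_ (cong (2 ^_) (+-comm i₁ j₁))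
    (cong₂ _*_ (cong₂ (λ c b → suc c * b) (+-comm i₁ j₁) (B-comm i₁ j₁)) (*-comm (1 ^ i₁) _)) big
  n≡ : a′ + a + (j + i) ≡ a + a′ + (i + j)
  n≡ = cong₂ _+_ (+-comm a′ a) (+-comm j i)
  exchange : ∀ u v → v ≡ u → v * Q₀ ^ (a′ + a + (j + i)) ≤ 2 * suc (a′ + a + (j + i)) * T₀ ^ (a′ + a + (j + i)) * B j i →
         u * Q₀ ^ (a + a′ + (i + j)) ≤ 2 * suc (a + a′ + (i + j)) * T₀ ^ (a + a′ + (i + j)) * B i j
  exchange u .u refl = subst₂ (λ n b → u * Q₀ ^ n ≤ 2 * suc n * T₀ ^ n * b) n≡ (B-comm j i)
  mirror : Balanced T₀ Q₀ a′ a j i → Balanced T₀ Q₀ a a′ i j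
  mirror (inj₁ le) = inj₂ (exchange _ _ (B-comm j (i + a)) le)
  mirror (inj₂ le) = inj₁ (exchange _ _ (B-comm (j + a′) i) le)

-- As i grows X increases and Y decreases.  At the last i where X is small, the
-- next i has Y small, and the step from i to i + 1 costs only a linear factor.
both-small : ∀ a a′ K q n → a ≤ n →
  (∀ i j → a + a′ + (i + j) ≡ n → B i (j + a′) * q ≤ K * B i j ⊎ B (i + a) j * q ≤ K * B i j) →
  q ≤ K → ∀ j i → a + a′ + (i + j) ≡ n → B i (j + a′) * q ≤ K * B i j →
  ∃[ i′ ] ∃[ j′ ] i′ + j′ ≡ i + j × B i′ (j′ + a′) * q ≤ suc n * K * B i′ j′
                                  × B (i′ + a) j′ * q ≤ suc n * K * B i′ j′
both-small a a′ K q n a≤n either q≤K zero i eq small = i , 0 , refl , weaken small , weaken trivial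
  where
  weaken : ∀ {u} → u ≤ K * B i 0 → u ≤ suc n * K * B i 0
  weaken le = ≤-trans le (*-monoˡ-≤ (B i 0) (m≤n*m K (suc n)))
  trivial : B (i + a) 0 * q ≤ K * B i 0
  trivial rewrite B-zeroʳ (i + a) | B-zeroʳ i | *-identityʳ K | *-identityˡ q = q≤K
both-small a a′ K q n a≤n either q≤K (suc j) i eq small
  with either (suc i) j (trans (cong (a + a′ +_) (sym (+-suc i j))) eq)
... | inj₁ small′ = let i′ , j′ , e , rest = both-small a a′ K q n a≤n either q≤K j (suc i)
                                               (trans (cong (a + a′ +_) (sym (+-suc i j))) eq) small′
                    in i′ , j′ , trans e (sym (+-suc i j)) , rest
... | inj₂ small′ = i , suc j , refl , ≤-trans small (*-monoˡ-≤ (B i (suc j)) (m≤n*m K (suc n))) , *-cancelˡ-≤ (suc j) (begin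
    suc j * (B (i + a) (suc j) * q)        ≡⟨ *-assoc (suc j) (B (i + a) (suc j)) q ⟨
    suc j * B (i + a) (suc j) * q          ≡⟨ cong (_* q) (B-shift (i + a) j) ⟨
    suc (i + a) * B (suc (i + a)) j * q    ≡⟨ *-assoc (suc (i + a)) (B (suc (i + a)) j) q ⟩
    suc (i + a) * (B (suc i + a) j * q)    ≤⟨ *-mono-≤ factor small′ ⟩
    suc n * suc i * (K * B (suc i) j)      ≡⟨ r (suc n) (suc i) K (B (suc i) j) ⟩
    suc n * K * (suc i * B (suc i) j)      ≡⟨ cong (suc n * K *_) (B-shift i j) ⟩
    suc n * K * (suc j * B i (suc j))      ≡⟨ r′ (suc n * K) (suc j) _ ⟩
    suc j * (suc n * K * B i (suc j))      ∎)
  where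
  r : ∀ n i K b → n * i * (K * b) ≡ n * K * (i * b)
  r = solve-∀
  r′ : ∀ k s b → k * (s * b) ≡ s * (k * b)
  r′ = solve-∀
  -- Going back from `suc i`, `j` to `i`, `suc j` multiplies the numerator of Y by
  -- `suc (i + a) / suc j` and the denominator by `suc i / suc j`; this bounds the quotient of the
  -- two.
  factor : suc (i + a) ≤ suc n * suc i
  factor = begin
    suc i + a              ≤⟨ +-monoʳ-≤ (suc i) (≤-trans a≤n (m≤m*n n (suc i))) ⟩
    suc i + n * suc i      ∎

-- The search for the best `i` starts at `i = 0`, where X is 1. Rounding the ratio up to the integer
-- `s` adds at most one more `T₀ ^ n`, hence the constant 3 in place of 2.
ratio-bound : ∀ a a′ c → let n = a + a′ + c in ∃[ i ] ∃[ j ] ∃[ s ] i + j ≡ c × 1 ≤ s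
            × B i (j + a′) ≤ s * B i j × B (i + a) j ≤ s * B i j
            × s * Q₀ ^ n ≤ 3 * (suc n * suc n) * T₀ ^ n
ratio-bound a a′ c with both-small a a′ K q n a≤n either q≤K c 0 refl at-0
  where
  n = a + a′ + c
  q = Q₀ ^ n
  K = 2 * suc n * T₀ ^ n
  a≤n : a ≤ n
  a≤n = ≤-trans (m≤m+n a a′) (m≤m+n (a + a′) c)
  q≤K : q ≤ K
  q≤K = ≤-trans (^-monoˡ-≤ n (≤ᵇ⇒≤ Q₀ T₀ tt)) (m≤n*m (T₀ ^ n) (2 * suc n))
  either : ∀ i j → a + a′ + (i + j) ≡ n → B i (j + a′) * q ≤ K * B i j ⊎ B (i + a) j * q ≤ K * B i j
  either i j eq = subst (λ n → B i (j + a′) * Q₀ ^ n ≤ 2 * suc n * T₀ ^ n * B i j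
                             ⊎ B (i + a) j * Q₀ ^ n ≤ 2 * suc n * T₀ ^ n * B i j) eq (balanced a a′ i j)
  at-0 : 1 * q ≤ K * 1
  at-0 rewrite *-identityˡ q | *-identityʳ K = q≤K
... | i , j , eq , X-small , Y-small = i , j , s , eq , s≤s z≤n , integral X-small , integral Y-small , s-small
  where
  n = a + a′ + c
  q = Q₀ ^ n
  instance
    q≢0 : NonZero q
    q≢0 = m^n≢0 Q₀ n
  K = suc n * (2 * suc n * T₀ ^ n)
  s = suc (K / q)
  K≤sq : K ≤ s * q
  K≤sq = begin
    K                       ≡⟨ m≡m%n+[m/n]*n K q ⟩
    _ + K / q * q           ≤⟨ +-monoˡ-≤ (K / q * q) (<⇒≤ (m%n<n K q)) ⟩
    s * q                   ∎
  integral : ∀ {u b} → u * q ≤ K * b → u ≤ s * b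
  integral {u} {b} le = *-cancelʳ-≤ u (s * b) q (begin
    u * q        ≤⟨ le ⟩
    K * b        ≤⟨ *-monoˡ-≤ b K≤sq ⟩
    s * q * b    ≡⟨ r s q b ⟩
    s * b * q    ∎)
    where
    r : ∀ s q b → s * q * b ≡ s * b * q
    r = solve-∀
  s-small : s * q ≤ 3 * (suc n * suc n) * T₀ ^ n
  s-small = begin
    q + K / q * q                              ≤⟨ +-mono-≤ (^-monoˡ-≤ n (≤ᵇ⇒≤ Q₀ T₀ tt)) (m/n*n≤m K q) ⟩
    T₀ ^ n + K                                 ≤⟨ +-monoˡ-≤ K (m≤n*m (T₀ ^ n) (suc n * suc n)) ⟩
    suc n * suc n * T₀ ^ n + K                 ≡⟨ r (suc n) (T₀ ^ n) ⟩
    3 * (suc n * suc n) * T₀ ^ n               ∎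
    where
    r : ∀ n t → n * n * t + n * (2 * n * t) ≡ 3 * (n * n) * t
    r = solve-∀

-- Conditional expectations

∑ : ∀ {A : Set} → List A → (A → ℕ) → ℕ
∑ xs f = sum (map f xs)

∑-cong : ∀ {A : Set} (xs : List A) {f g : A → ℕ} → (∀ x → f x ≡ g x) → ∑ xs f ≡ ∑ xs g
∑-cong []       eq = refl
∑-cong (x ∷ xs) eq = cong₂ _+_ (eq x) (∑-cong xs eq)

∑-mono : ∀ {A : Set} (xs : List A) {f g : A → ℕ} → (∀ x → f x ≤ g x) → ∑ xs f ≤ ∑ xs g
∑-mono []       le = z≤n
∑-mono (x ∷ xs) le = +-mono-≤ (le x) (∑-mono xs le)

∑-+ : ∀ {A : Set} (xs : List A) (f g : A → ℕ) → ∑ xs (λ x → f x + g x) ≡ ∑ xs f + ∑ xs g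
∑-+ []       f g = refl
∑-+ (x ∷ xs) f g rewrite ∑-+ xs f g = interchange (f x) (g x) (∑ xs f) (∑ xs g)
  where
  interchange : ∀ a b c d → a + b + (c + d) ≡ a + c + (b + d)
  interchange = solve-∀

∑-*ˡ : ∀ {A : Set} (xs : List A) k (f : A → ℕ) → ∑ xs (λ x → k * f x) ≡ k * ∑ xs f
∑-*ˡ []       k f = sym (*-zeroʳ k)
∑-*ˡ (x ∷ xs) k f rewrite ∑-*ˡ xs k f = sym (*-distribˡ-+ k (f x) (∑ xs f))

∑-*ʳ : ∀ {A : Set} (xs : List A) k (f : A → ℕ) → ∑ xs (λ x → f x * k) ≡ ∑ xs f * k
∑-*ʳ xs k f = trans (∑-cong xs (λ x → *-comm (f x) k)) (trans (∑-*ˡ xs k f) (*-comm k _))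

∑-const : ∀ {A : Set} (xs : List A) k → ∑ xs (λ _ → k) ≡ length xs * k
∑-const []       k = refl
∑-const (x ∷ xs) k = cong (k +_) (∑-const xs k)

∑-zero : ∀ {A : Set} (xs : List A) → ∑ xs (λ _ → 0) ≡ 0
∑-zero xs = trans (∑-const xs 0) (*-zeroʳ (length xs))

∑-swap : ∀ {A C : Set} (xs : List A) (ys : List C) (f : A → C → ℕ) →
         ∑ xs (λ x → ∑ ys (f x)) ≡ ∑ ys (λ y → ∑ xs (λ x → f x y))
∑-swap []       ys f = sym (∑-zero ys)
∑-swap (x ∷ xs) ys f rewrite ∑-swap xs ys f = sym (∑-+ ys (f x) _)

∑-member : ∀ {A : Set} {xs : List A} (f : A → ℕ) {x} → x ∈ xs → f x ≤ ∑ xs f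
∑-member f (here refl)         = m≤m+n _ _
∑-member f {x} (there {y} x∈xs) = ≤-trans (∑-member f x∈xs) (m≤n+m _ (f y))

∑-bounded : ∀ {A : Set} (xs : List A) (f : A → ℕ) k v → (∀ {x} → x ∈ xs → k * f x < v) →
            0 < length xs → k * ∑ xs f < length xs * v
∑-bounded (x ∷ []) f k v small _ =
  subst₂ _<_ (cong (k *_) (sym (+-identityʳ (f x)))) (sym (+-identityʳ v)) (small (here refl))
∑-bounded (x ∷ y ∷ ys) f k v small _ =
  subst (_< length (x ∷ y ∷ ys) * v) (sym (*-distribˡ-+ k (f x) (∑ (y ∷ ys) f)))
    (+-mono-< (small (here refl)) (∑-bounded (y ∷ ys) f k v (small ∘ there) z<s))

below-average : ∀ {A : Set} (xs : List A) (f : A → ℕ) → 0 < length xs → ∃[ x ] f x * length xs ≤ ∑ xs f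
below-average (x ∷ []) f _ = x , ≤-reflexive (trans (*-identityʳ (f x)) (sym (+-identityʳ (f x))))
below-average (x ∷ xs@(_ ∷ _)) f _ with below-average xs f z<s
... | y , le with f x ≤? f y
...   | yes fx≤fy = x , ≤-trans (≤-reflexive (*-suc (f x) (length xs))) (+-monoʳ-≤ (f x) (≤-trans (*-monoˡ-≤ (length xs) fx≤fy) le))
...   | no  fx≰fy = y , ≤-trans (≤-reflexive (*-suc (f y) (length xs))) (+-mono-≤ (<⇒≤ (≰⇒> fx≰fy)) le)

module ConditionalExpectations {A I : Set} (Ω : List A) (nonempty : 0 < length Ω) (J : List I) (f : I → A → ℕ) where

  -- The right side is the sum over all sequences of `N` draws, since independence turns the sum of
  -- products into `∑ Ω (f t) ^ N`. Each draw is fixed to one that is not above average, and its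
  -- factor `f t x` moves into the weight, which restores the form of the claim.
  draws : ∀ N (w : I → ℕ) → ∃[ xs ] ∑ J (λ t → w t * product (map (f t) xs)) * length Ω ^ N ≤ ∑ J (λ t → w t * ∑ Ω (f t) ^ N)
  draws zero    w = [] , ≤-reflexive (*-identityʳ _)
  draws (suc N) w with below-average Ω (λ x → ∑ J (λ t → w t * f t x * ∑ Ω (f t) ^ N)) nonempty
  ... | x , small with draws N (λ t → w t * f t x)
  ...   | xs , le = x ∷ xs , (begin
    ∑ J (λ t → w t * (f t x * product (map (f t) xs))) * (Ω# * Ω# ^ N)
      ≡⟨ cong (_* (Ω# * Ω# ^ N)) (∑-cong J (λ t → sym (*-assoc (w t) (f t x) _))) ⟩
    ∑ J (λ t → w t * f t x * product (map (f t) xs)) * (Ω# * Ω# ^ N)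
      ≡⟨ r (∑ J (λ t → w t * f t x * product (map (f t) xs))) Ω# _ ⟩
    ∑ J (λ t → w t * f t x * product (map (f t) xs)) * Ω# ^ N * Ω#
      ≤⟨ *-monoˡ-≤ Ω# le ⟩
    ∑ J (λ t → w t * f t x * ∑ Ω (f t) ^ N) * Ω#
      ≤⟨ small ⟩
    ∑ Ω (λ x → ∑ J (λ t → w t * f t x * ∑ Ω (f t) ^ N))
      ≡⟨ ∑-swap Ω J _ ⟩
    ∑ J (λ t → ∑ Ω (λ x → w t * f t x * ∑ Ω (f t) ^ N))
      ≡⟨ ∑-cong J (λ t → trans (∑-*ʳ Ω (∑ Ω (f t) ^ N) (λ x → w t * f t x)) (trans (cong (_* ∑ Ω (f t) ^ N) (∑-*ˡ Ω (w t) (f t))) (*-assoc (w t) _ _))) ⟩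
    ∑ J (λ t → w t * (∑ Ω (f t) * ∑ Ω (f t) ^ N)) ∎)
    where
    Ω# = length Ω
    r : ∀ s o p → s * (o * p) ≡ s * p * o
    r = solve-∀

  -- A union bound: each test contributes less than `V / length J` on average, so the sum over all
  -- tests falls below `V`, and with it every single term.
  derandomize : ∀ N V (w : I → ℕ) → (∀ {t} → t ∈ J → length J * (w t * ∑ Ω (f t) ^ N) < V * length Ω ^ N) →
                ∃[ xs ] (∀ {t} → t ∈ J → w t * product (map (f t) xs) < V)
  derandomize N V w small with draws N w
  ... | xs , le = xs , λ {t} t∈J → *-cancelʳ-< (length Ω ^ N) (w t * product (map (f t) xs)) V (begin-strict
    w t * product (map (f t) xs) * length Ω ^ N
      ≤⟨ *-monoˡ-≤ (length Ω ^ N) (∑-member (λ t → w t * product (map (f t) xs)) t∈J) ⟩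
    ∑ J (λ t → w t * product (map (f t) xs)) * length Ω ^ N
      ≤⟨ le ⟩
    ∑ J (λ t → w t * ∑ Ω (f t) ^ N)
      <⟨ *-cancelˡ-< (length J) _ _ (∑-bounded J _ (length J) (V * length Ω ^ N) small (positive t∈J)) ⟩
    V * length Ω ^ N ∎)
    where
    positive : ∀ {t} → t ∈ J → 0 < length J
    positive (here _)  = z<s
    positive (there _) = z<s

-- Bernoulli's inequality and exponential bounds

bernoulli : ∀ r g m → r ^ suc m + suc m * g * r ^ m ≤ (r + g) ^ suc m
bernoulli r g zero = ≤-reflexive (e r g)
  where
  e : ∀ r g → r * 1 + 1 * g * 1 ≡ (r + g) * 1
  e = solve-∀
bernoulli r g (suc m) = begin
  r ^ suc (suc m) + suc (suc m) * g * r ^ suc m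
    ≤⟨ m≤m+n _ (suc m * g * g * r ^ m) ⟩
  r ^ suc (suc m) + suc (suc m) * g * r ^ suc m + suc m * g * g * r ^ m
    ≡⟨ e m r g (r ^ m) ⟩
  (r + g) * (r ^ suc m + suc m * g * r ^ m)
    ≤⟨ *-monoʳ-≤ (r + g) (bernoulli r g m) ⟩
  (r + g) ^ suc (suc m) ∎
  where
  e : ∀ m r g p → r * (r * p) + (2 + m) * g * (r * p) + (1 + m) * g * g * p ≡ (r + g) * (r * p + (1 + m) * g * p)
  e = solve-∀

-- If `g` of `r + g` equally likely outcomes are successes and `suc m` draws give at least one
-- success on average, they all fail with probability at most 1 / 2.
halving : ∀ m r g → r + g ≤ suc m * g → 2 * r ^ suc m ≤ (r + g) ^ suc m
halving m r g le = begin
  r ^ suc m + (r * r ^ m + 0)      ≡⟨ cong (r ^ suc m +_) (+-identityʳ _) ⟩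
  r ^ suc m + r * r ^ m            ≤⟨ +-monoʳ-≤ (r ^ suc m) (*-monoˡ-≤ (r ^ m) (≤-trans (m≤m+n r g) le)) ⟩
  r ^ suc m + suc m * g * r ^ m    ≤⟨ bernoulli r g m ⟩
  (r + g) ^ suc m                  ∎

-- This is `(1 + 1 / h) ^ r ≤ 1 / (1 - r / h)` for `h = r + t`. The induction trades `r` for `t` at
-- fixed `h`, using `(1 + 1 / h) * t ≤ t + 1` for `t ≤ h`.
bernoulli-inverse : ∀ r t → suc (r + t) ^ r * t ≤ (r + t) ^ suc r
bernoulli-inverse r t = go r t refl
  where
  h = r + t
  go : ∀ r t → r + t ≡ h → suc h ^ r * t ≤ h ^ suc r
  go zero    t refl = ≤-reflexive (*-comm 1 _)
  go (suc r) t eq   = begin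
    suc h * suc h ^ r * t          ≡⟨ e₁ h (suc h ^ r) t ⟩
    suc h ^ r * (h * t + t)        ≤⟨ *-monoʳ-≤ (suc h ^ r) (+-monoʳ-≤ (h * t) (subst (t ≤_) eq (m≤n+m t (suc r)))) ⟩
    suc h ^ r * (h * t + h)        ≡⟨ e₂ (suc h ^ r) h t ⟩
    h * (suc h ^ r * suc t)        ≤⟨ *-monoʳ-≤ h (go r (suc t) (trans (+-suc r t) eq)) ⟩
    h ^ suc (suc r)                ∎
    where
    e₁ : ∀ h p t → (1 + h) * p * t ≡ p * (h * t + t)
    e₁ = solve-∀
    e₂ : ∀ p h t → p * (h * t + h) ≡ h * (p * (1 + t))
    e₂ = solve-∀

^-crossˡ : ∀ x {k l} → k ≤ l → suc x ^ k * x ^ l ≤ suc x ^ l * x ^ k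
^-crossˡ x {k} {l} k≤l = begin
  suc x ^ k * x ^ l                        ≡⟨ cong (λ n → suc x ^ k * x ^ n) (m+[n∸m]≡n k≤l) ⟨
  suc x ^ k * x ^ (k + (l ∸ k))            ≡⟨ cong (suc x ^ k *_) (^-distribˡ-+-* x k (l ∸ k)) ⟩
  suc x ^ k * (x ^ k * x ^ (l ∸ k))        ≤⟨ *-monoʳ-≤ (suc x ^ k) (*-monoʳ-≤ (x ^ k) (^-monoˡ-≤ (l ∸ k) (n≤1+n x))) ⟩
  suc x ^ k * (x ^ k * suc x ^ (l ∸ k))    ≡⟨ e (suc x ^ k) (x ^ k) _ ⟩
  suc x ^ k * suc x ^ (l ∸ k) * x ^ k      ≡⟨ cong (_* x ^ k) (^-distribˡ-+-* (suc x) k (l ∸ k)) ⟨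
  suc x ^ (k + (l ∸ k)) * x ^ k            ≡⟨ cong (λ n → suc x ^ n * x ^ k) (m+[n∸m]≡n k≤l) ⟩
  suc x ^ l * x ^ k                        ∎
  where
  e : ∀ a b c → a * (b * c) ≡ a * c * b
  e = solve-∀

-- (1 + p / s) ^ N ≤ 4 ^ R whenever N * p ≤ R * s.  Bernoulli's inequality
-- replaces 1 + p / s by (1 + 1 / 2s) ^ 2p, and (1 + 1 / 2s) ^ s ≤ 2.
exponential-bound : ∀ N p s R .{{_ : NonZero s}} → N * p ≤ R * s → (s + p) ^ N ≤ 4 ^ R * s ^ N
exponential-bound N zero s R _ = begin
  (s + 0) ^ N       ≡⟨ cong (_^ N) (+-identityʳ s) ⟩
  s ^ N             ≤⟨ m≤n*m (s ^ N) (4 ^ R) {{m^n≢0 4 R}} ⟩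
  4 ^ R * s ^ N     ∎
exponential-bound N p@(suc p-1) s R Np≤Rs = *-cancelˡ-≤ (h ^ k) {{m^n≢0 h k}} (begin
  h ^ k * (s + p) ^ N                  ≡⟨ cong (_* (s + p) ^ N) (^-*-assoc h (2 * p) N) ⟨
  (h ^ (2 * p)) ^ N * (s + p) ^ N      ≡⟨ ^-distribʳ-* N (h ^ (2 * p)) (s + p) ⟨
  (h ^ (2 * p) * (s + p)) ^ N          ≤⟨ ^-monoˡ-≤ N refine ⟩
  (suc h ^ (2 * p) * s) ^ N            ≡⟨ ^-distribʳ-* N (suc h ^ (2 * p)) s ⟩
  (suc h ^ (2 * p)) ^ N * s ^ N        ≡⟨ cong (_* s ^ N) (^-*-assoc (suc h) (2 * p) N) ⟩
  suc h ^ k * s ^ N                    ≤⟨ *-monoˡ-≤ (s ^ N) bound ⟩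
  4 ^ R * h ^ k * s ^ N                ≡⟨ e (4 ^ R) (h ^ k) (s ^ N) ⟩
  h ^ k * (4 ^ R * s ^ N)              ∎)
  where
  h = 2 * s
  k = 2 * p * N
  l = s * (2 * R)
  instance
    h≢0 : NonZero h
    h≢0 = m*n≢0 2 s
  e : ∀ x y z → x * y * z ≡ y * (x * z)
  e = solve-∀
  k≤l : k ≤ l
  k≤l = subst₂ _≤_ (e₁ N p) (e₂ R s) (*-monoʳ-≤ 2 Np≤Rs)
    where
    e₁ : ∀ N p → 2 * (N * p) ≡ 2 * p * N
    e₁ = solve-∀
    e₂ : ∀ R s → 2 * (R * s) ≡ s * (2 * R)
    e₂ = solve-∀
  2p-1 = p-1 + suc (p-1 + 0)
  refine : h ^ (2 * p) * (s + p) ≤ suc h ^ (2 * p) * s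
  refine = *-cancelˡ-≤ 2 (begin
    2 * (h ^ (2 * p) * (s + p))                    ≡⟨ e₁ s p (h ^ 2p-1) ⟩
    h * (h ^ (2 * p) + 2 * p * 1 * h ^ 2p-1)       ≤⟨ *-monoʳ-≤ h (bernoulli h 1 2p-1) ⟩
    h * (h + 1) ^ (2 * p)                          ≡⟨ cong (λ x → h * x ^ (2 * p)) (+-comm h 1) ⟩
    h * suc h ^ (2 * p)                            ≡⟨ e₂ s (suc h ^ (2 * p)) ⟩
    2 * (suc h ^ (2 * p) * s)                      ∎)
    where
    e₁ : ∀ s p x → 2 * (2 * s * x * (s + p)) ≡ 2 * s * (2 * s * x + 2 * p * 1 * x)
    e₁ = solve-∀
    e₂ : ∀ s y → 2 * s * y ≡ 2 * (y * s)
    e₂ = solve-∀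
  doubling : suc h ^ s ≤ 2 * h ^ s
  doubling = *-cancelʳ-≤ _ _ s (begin
    suc h ^ s * s             ≡⟨ cong (λ x → suc x ^ s * s) (cong (s +_) (+-identityʳ s)) ⟩
    suc (s + s) ^ s * s       ≤⟨ bernoulli-inverse s s ⟩
    (s + s) ^ suc s           ≡⟨ cong (λ x → x ^ suc s) (cong (s +_) (+-identityʳ s)) ⟨
    h * h ^ s                 ≡⟨ e₁ s (h ^ s) ⟩
    2 * h ^ s * s             ∎)
    where
    e₁ : ∀ s x → 2 * s * x ≡ 2 * x * s
    e₁ = solve-∀
  bound : suc h ^ k ≤ 4 ^ R * h ^ k
  bound = *-cancelʳ-≤ _ _ (h ^ l) {{m^n≢0 h l}} (begin
    suc h ^ k * h ^ l                     ≤⟨ ^-crossˡ h k≤l ⟩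
    suc h ^ l * h ^ k                     ≡⟨ cong (_* h ^ k) (^-*-assoc (suc h) s (2 * R)) ⟨
    (suc h ^ s) ^ (2 * R) * h ^ k         ≤⟨ *-monoˡ-≤ (h ^ k) (^-monoˡ-≤ (2 * R) doubling) ⟩
    (2 * h ^ s) ^ (2 * R) * h ^ k         ≡⟨ cong (_* h ^ k) (^-distribʳ-* (2 * R) 2 (h ^ s)) ⟩
    2 ^ (2 * R) * (h ^ s) ^ (2 * R) * h ^ k  ≡⟨ cong₂ (λ x y → x * y * h ^ k) (sym (^-*-assoc 2 2 R)) (^-*-assoc h s (2 * R)) ⟩
    4 ^ R * h ^ l * h ^ k                 ≡⟨ e₁ (4 ^ R) (h ^ l) (h ^ k) ⟩
    4 ^ R * h ^ k * h ^ l                 ∎)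
    where
    e₁ : ∀ x y z → x * y * z ≡ x * z * y
    e₁ = solve-∀

-- Separating families

∑-++ : ∀ {A : Set} (xs ys : List A) f → ∑ (xs ++ ys) f ≡ ∑ xs f + ∑ ys f
∑-++ xs ys f = trans (cong sum (map-++ f xs ys)) (sum-++ (map f xs) (map f ys))

∑-map : ∀ {A C : Set} (g : A → C) (xs : List A) f → ∑ (map g xs) f ≡ ∑ xs (f ∘ g)
∑-map g xs f = cong sum (sym (map-∘ xs))

𝟙 : Bool → ℕ
𝟙 true  = 1
𝟙 false = 0

inside outside : ∀ {n} → Vec Bool n → Vec Bool n → Bool
inside [] [] = true
inside (true  ∷ x) (s ∷ S) = s ∧ inside x S
inside (false ∷ x) (s ∷ S) = inside x S
outside [] [] = true
outside (true  ∷ y) (s ∷ S) = not s ∧ outside y S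
outside (false ∷ y) (s ∷ S) = outside y S

separates : ∀ {n} → Vec Bool n → Vec Bool n → Vec Bool n → Bool
separates x y S = inside x S ∧ outside y S

∣_∣ : ∀ {n} → Vec Bool n → ℕ
∣ [] ∣ = 0
∣ true  ∷ x ∣ = suc ∣ x ∣
∣ false ∷ x ∣ = ∣ x ∣

-- a and a′ are the sizes of x and y, and c counts the coordinates in neither.
data Typed : ∀ {n} → Vec Bool n → Vec Bool n → ℕ → ℕ → ℕ → Set where
  []    : Typed [] [] 0 0 0
  left  : ∀ {n a a′ c} {x y : Vec Bool n} → Typed x y a a′ c → Typed (true ∷ x) (false ∷ y) (suc a) a′ c
  right : ∀ {n a a′ c} {x y : Vec Bool n} → Typed x y a a′ c → Typed (false ∷ x) (true ∷ y) a (suc a′) c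
  free  : ∀ {n a a′ c} {x y : Vec Bool n} → Typed x y a a′ c → Typed (false ∷ x) (false ∷ y) a a′ (suc c)

Typed-size : ∀ {n a a′ c} {x y : Vec Bool n} → Typed x y a a′ c → a + a′ + c ≡ n
Typed-size [] = refl
Typed-size (left t) = cong suc (Typed-size t)
Typed-size (right {a = a} {a′} {c} t) = trans (cong (_+ c) (+-suc a a′)) (cong suc (Typed-size t))
Typed-size (free {a = a} {a′} {c} t) = trans (+-suc (a + a′) c) (cong suc (Typed-size t))

-- A single set is treated as a pair with the empty set, so that the counts behind both degrees
-- become instances of `count-separating`.
Typed-emptyʳ : ∀ {n} (x : Vec Bool n) → ∃[ c ] Typed x (replicate n false) ∣ x ∣ 0 c
Typed-emptyʳ [] = 0 , []
Typed-emptyʳ (true  ∷ x) = let c , t = Typed-emptyʳ x in c , left t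
Typed-emptyʳ (false ∷ x) = let c , t = Typed-emptyʳ x in suc c , free t

Typed-emptyˡ : ∀ {n} (y : Vec Bool n) → ∃[ c ] Typed (replicate n false) y 0 ∣ y ∣ c
Typed-emptyˡ [] = 0 , []
Typed-emptyˡ (true  ∷ y) = let c , t = Typed-emptyˡ y in c , right t
Typed-emptyˡ (false ∷ y) = let c , t = Typed-emptyˡ y in suc c , free t

inside-empty : ∀ {n} (S : Vec Bool n) → inside (replicate n false) S ≡ true
inside-empty [] = refl
inside-empty (s ∷ S) = inside-empty S

outside-empty : ∀ {n} (S : Vec Bool n) → outside (replicate n false) S ≡ true
outside-empty [] = refl
outside-empty (s ∷ S) = outside-empty S

layer : ∀ n → ℕ → List (Vec Bool n)
layer zero    zero    = [] ∷ []
layer zero    (suc s) = []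
layer (suc n) zero    = map (false ∷_) (layer n zero)
layer (suc n) (suc s) = map (false ∷_) (layer n (suc s)) ++ map (true ∷_) (layer n s)

vectors : ∀ n → List (Vec Bool n)
vectors zero    = [] ∷ []
vectors (suc n) = map (false ∷_) (vectors n) ++ map (true ∷_) (vectors n)

∈-vectors : ∀ {n} (x : Vec Bool n) → x ∈ vectors n
∈-vectors [] = here refl
∈-vectors (false ∷ x) = ∈-++⁺ˡ (∈-map⁺ (false ∷_) (∈-vectors x))
∈-vectors (true  ∷ x) = ∈-++⁺ʳ (map (false ∷_) (vectors _)) (∈-map⁺ (true ∷_) (∈-vectors x))

length-vectors : ∀ n → length (vectors n) ≡ 2 ^ n
length-vectors zero = refl
length-vectors (suc n) = trans (length-++ (map (false ∷_) (vectors n)))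
  (cong₂ _+_ (trans (length-map (false ∷_) (vectors n)) (length-vectors n))
             (trans (length-map (true ∷_) (vectors n)) (trans (length-vectors n) (sym (+-identityʳ _)))))

C-zeroʳ : ∀ n → n binom 0 ≡ 1
C-zeroʳ n = trans (nCk≡nC[n∸k] {n = n} z≤n) (nCn≡1 n)

B≡C : ∀ i j → B i j ≡ (i + j) binom i
B≡C zero    j    = sym (C-zeroʳ j)
B≡C (suc i) zero = sym (trans (cong (_binom suc i) (+-identityʳ (suc i))) (nCn≡1 (suc i)))
B≡C (suc i) (suc j) = begin-equality
  B i (suc j) + B (suc i) j                    ≡⟨ cong₂ _+_ (B≡C i (suc j)) (B≡C (suc i) j) ⟩
  (i + suc j) binom i + (suc i + j) binom suc i        ≡⟨ cong (λ n → (i + suc j) binom i + n binom suc i) (+-suc i j) ⟨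
  (i + suc j) binom i + (i + suc j) binom suc i        ≡⟨ nCk+nC[k+1]≡[n+1]C[k+1] (i + suc j) i ⟩
  suc (i + suc j) binom suc i                      ∎

-- The binomial coefficient `c` over `s - a`, and 0 for `s < a`. Recursion on `a` avoids truncated
-- subtraction, which would give 1 there.
ways : ℕ → ℕ → ℕ → ℕ
ways zero    c s       = c binom s
ways (suc a) c zero    = 0
ways (suc a) c (suc s) = ways a c s

ways-zero : ∀ a c → ways a c 0 ≡ ways a (suc c) 0
ways-zero zero    c = trans (C-zeroʳ c) (sym (C-zeroʳ (suc c)))
ways-zero (suc a) c = refl

ways-pascal : ∀ a c s → ways a c (suc s) + ways a c s ≡ ways a (suc c) (suc s)
ways-pascal zero    c s       = trans (+-comm (c binom suc s) (c binom s)) (nCk+nC[k+1]≡[n+1]C[k+1] c s)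
ways-pascal (suc a) c zero    = trans (+-identityʳ _) (ways-zero a c)
ways-pascal (suc a) c (suc s) = ways-pascal a c s

ways-shift : ∀ a c i → ways a c (a + i) ≡ c binom i
ways-shift zero    c i = refl
ways-shift (suc a) c i = ways-shift a c i

∑-layer : ∀ n s (f : Vec Bool (suc n) → ℕ) →
          ∑ (layer (suc n) (suc s)) f ≡ ∑ (layer n (suc s)) (f ∘ (false ∷_)) + ∑ (layer n s) (f ∘ (true ∷_))
∑-layer n s f = trans (∑-++ (map (false ∷_) (layer n (suc s))) _ f)
                      (cong₂ _+_ (∑-map (false ∷_) (layer n (suc s)) f) (∑-map (true ∷_) (layer n s) f))

-- A coordinate of `x` must be taken and one of `y` must be left out; at a free coordinate both
-- branches survive and add up by Pascal's rule.
count-separating : ∀ {n a a′ c} {x y : Vec Bool n} → Typed x y a a′ c → ∀ s →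
                   ∑ (layer n s) (λ S → 𝟙 (separates x y S)) ≡ ways a c s
count-separating [] zero    = refl
count-separating [] (suc s) = refl
count-separating (left {n} t) zero = trans (∑-map (false ∷_) (layer n 0) _) (∑-zero (layer n 0))
count-separating (left {n} t) (suc s) =
  trans (∑-layer n s _) (cong₂ _+_ (∑-zero (layer n (suc s))) (count-separating t s))
count-separating (right {n} t) zero = trans (∑-map (false ∷_) (layer n 0) _) (count-separating t 0)
count-separating (right {n} {a} {a′} {c} {x} t) (suc s) =
  trans (∑-layer n s _) (trans (cong₂ _+_ (count-separating t (suc s))
    (trans (∑-cong (layer n s) (λ S → cong 𝟙 (∧-zeroʳ (inside x S)))) (∑-zero (layer n s)))) (+-identityʳ _))
count-separating (free {n} {a} {a′} {c} t) zero =
  trans (∑-map (false ∷_) (layer n 0) _) (trans (count-separating t 0) (ways-zero a c))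
count-separating (free {n} {a} {a′} {c} t) (suc s) =
  trans (∑-layer n s _) (trans (cong₂ _+_ (count-separating t (suc s)) (count-separating t s)) (ways-pascal a c s))

count-inside : ∀ {n} (x : Vec Bool n) {a} i j → ∣ x ∣ ≡ a → a + (i + j) ≡ n →
               ∑ (layer n (a + i)) (λ S → 𝟙 (inside x S)) ≡ B i j
count-inside {n} x i j refl eq with Typed-emptyʳ x
... | c , t = begin-equality
  ∑ (layer n (∣ x ∣ + i)) (λ S → 𝟙 (inside x S))
    ≡⟨ ∑-cong (layer n (∣ x ∣ + i)) (λ S → cong 𝟙 (sym (trans (cong (inside x S ∧_) (outside-empty S)) (∧-identityʳ _)))) ⟩
  ∑ (layer n (∣ x ∣ + i)) (λ S → 𝟙 (separates x (replicate n false) S))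
    ≡⟨ count-separating t (∣ x ∣ + i) ⟩
  ways ∣ x ∣ c (∣ x ∣ + i)
    ≡⟨ ways-shift ∣ x ∣ c i ⟩
  c binom i
    ≡⟨ cong (_binom i) (+-cancelˡ-≡ (∣ x ∣ + 0) c (i + j) (trans (Typed-size t) (trans (sym eq) (cong (_+ (i + j)) (sym (+-identityʳ ∣ x ∣)))))) ⟩
  (i + j) binom i
    ≡⟨ B≡C i j ⟨
  B i j ∎

count-outside : ∀ {n} (y : Vec Bool n) {a′} i j → ∣ y ∣ ≡ a′ → a′ + (i + j) ≡ n →
                ∑ (layer n i) (λ S → 𝟙 (outside y S)) ≡ B i j
count-outside {n} y i j refl eq with Typed-emptyˡ y
... | c , t = begin-equality
  ∑ (layer n i) (λ S → 𝟙 (outside y S))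
    ≡⟨ ∑-cong (layer n i) (λ S → cong (λ b → 𝟙 (b ∧ outside y S)) (sym (inside-empty S))) ⟩
  ∑ (layer n i) (λ S → 𝟙 (separates (replicate n false) y S))
    ≡⟨ count-separating t i ⟩
  c binom i
    ≡⟨ cong (_binom i) (+-cancelˡ-≡ ∣ y ∣ c (i + j) (trans (Typed-size t) (sym eq))) ⟩
  (i + j) binom i
    ≡⟨ B≡C i j ⟨
  B i j ∎

-- The conditions to be met at once: every pair of the type is separated, and no
-- vector lies in many sets.
data Test (n : ℕ) : Set where
  covered     : Vec Bool n × Vec Bool n → Test n
  fewˡ fewʳ   : Vec Bool n → Test n

tests : ∀ n → List (Test n)
tests n = map covered (cartesianProduct (vectors n) (vectors n)) ++ map fewˡ (vectors n) ++ map fewʳ (vectors n)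

length-cartesianProduct : ∀ {A C : Set} (xs : List A) (ys : List C) → length (cartesianProduct xs ys) ≡ length xs * length ys
length-cartesianProduct []       ys = refl
length-cartesianProduct (x ∷ xs) ys = trans (length-++ (map (x ,_) ys))
  (cong₂ _+_ (length-map (x ,_) ys) (length-cartesianProduct xs ys))

length-tests : ∀ n → length (tests n) < 4 * 4 ^ n
length-tests n = begin-strict
  length (tests n)                       ≡⟨ eq ⟩
  2 ^ n * 2 ^ n + (2 ^ n + 2 ^ n)        <⟨ +-monoʳ-< (2 ^ n * 2 ^ n) (m<m+n _ (m^n>0 2 n)) ⟩
  2 ^ n * 2 ^ n + (2 ^ n + 2 ^ n + 2 ^ n)  ≤⟨ +-monoʳ-≤ (2 ^ n * 2 ^ n) (+-mono-≤ (+-mono-≤ sq sq) sq) ⟩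
  2 ^ n * 2 ^ n + (2 ^ n * 2 ^ n + 2 ^ n * 2 ^ n + 2 ^ n * 2 ^ n) ≡⟨ r (2 ^ n) ⟩
  4 * (2 ^ n * 2 ^ n)                    ≡⟨ cong (4 *_) (^-distribʳ-* n 2 2) ⟨
  4 * 4 ^ n                              ∎
  where
  sq : 2 ^ n ≤ 2 ^ n * 2 ^ n
  sq = m≤m*n (2 ^ n) (2 ^ n) {{m^n≢0 2 n}}
  r : ∀ x → x * x + (x * x + x * x + x * x) ≡ 4 * (x * x)
  r = solve-∀
  eq : length (tests n) ≡ 2 ^ n * 2 ^ n + (2 ^ n + 2 ^ n)
  eq = trans (length-++ (map covered (cartesianProduct (vectors n) (vectors n))))
    (cong₂ _+_ (trans (length-map covered (cartesianProduct (vectors n) (vectors n))) (trans (length-cartesianProduct (vectors n) (vectors n))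
                                                    (cong₂ _*_ (length-vectors n) (length-vectors n))))
      (trans (length-++ (map fewˡ (vectors n)))
        (cong₂ _+_ (trans (length-map fewˡ (vectors n)) (length-vectors n)) (trans (length-map fewʳ (vectors n)) (length-vectors n)))))

∈-covered : ∀ {n} (x y : Vec Bool n) → covered (x , y) ∈ tests n
∈-covered x y = ∈-++⁺ˡ (∈-map⁺ covered (∈-cartesianProduct⁺ (∈-vectors x) (∈-vectors y)))

∈-fewˡ : ∀ {n} (x : Vec Bool n) → fewˡ x ∈ tests n
∈-fewˡ {n} x = ∈-++⁺ʳ (map covered (cartesianProduct (vectors n) (vectors n))) (∈-++⁺ˡ (∈-map⁺ fewˡ (∈-vectors x)))

∈-fewʳ : ∀ {n} (y : Vec Bool n) → fewʳ y ∈ tests n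
∈-fewʳ {n} y = ∈-++⁺ʳ (map covered (cartesianProduct (vectors n) (vectors n))) (∈-++⁺ʳ (map fewˡ (vectors n)) (∈-map⁺ fewʳ (∈-vectors y)))

typed? : ∀ {n} (x y : Vec Bool n) a a′ c → Dec (Typed x y a a′ c)
typed? [] [] zero    zero     zero    = yes []
typed? [] [] zero    zero     (suc c) = no λ ()
typed? [] [] zero    (suc a′) c       = no λ ()
typed? [] [] (suc a) a′       c       = no λ ()
typed? (true ∷ x)  (true ∷ y)  a       a′       c       = no λ ()
typed? (true ∷ x)  (false ∷ y) zero    a′       c       = no λ ()
typed? (true ∷ x)  (false ∷ y) (suc a) a′       c       = map′ left (λ { (left t) → t }) (typed? x y a a′ c)
typed? (false ∷ x) (true ∷ y)  a       zero     c       = no λ ()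
typed? (false ∷ x) (true ∷ y)  a       (suc a′) c       = map′ right (λ { (right t) → t }) (typed? x y a a′ c)
typed? (false ∷ x) (false ∷ y) a       a′       zero    = no λ ()
typed? (false ∷ x) (false ∷ y) a       a′       (suc c) = map′ free (λ { (free t) → t }) (typed? x y a a′ c)

product-𝟙-not : ∀ {A : Set} (p : A → Bool) xs → product (map (𝟙 ∘ not ∘ p) xs) ≡ 0 → ∃[ x ] x ∈ xs × p x ≡ true
product-𝟙-not p (x ∷ xs) eq with p x in px
... | true  = x , here refl , px
... | false with product-𝟙-not p xs (trans (sym (+-identityʳ _)) eq)
...   | y , y∈xs , py = y , there y∈xs , py

-- This makes a degree condition multiplicative over the draws: a product below `2 ^ E` means a
-- degree below `E`.
product-doubling : ∀ {A : Set} (p : A → Bool) xs → product (map (suc ∘ 𝟙 ∘ p) xs) ≡ 2 ^ ∑ xs (𝟙 ∘ p)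
product-doubling p [] = refl
product-doubling p (x ∷ xs) with p x
... | true  = cong (2 *_) (product-doubling p xs)
... | false = trans (+-identityʳ _) (product-doubling p xs)

∑-𝟙-not : ∀ {A : Set} (p : A → Bool) xs → ∑ xs (𝟙 ∘ not ∘ p) + ∑ xs (𝟙 ∘ p) ≡ length xs
∑-𝟙-not p xs = trans (sym (∑-+ xs _ _)) (trans (∑-cong xs (λ x → one (p x))) (trans (∑-const xs 1) (*-identityʳ _)))
  where
  one : ∀ b → 𝟙 (not b) + 𝟙 b ≡ 1
  one true  = refl
  one false = refl

∑-suc : ∀ {A : Set} (f : A → ℕ) xs → ∑ xs (suc ∘ f) ≡ length xs + ∑ xs f
∑-suc f xs = trans (∑-+ xs (λ _ → 1) f) (cong (_+ ∑ xs f) (trans (∑-const xs 1) (*-identityʳ _)))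

scale-< : ∀ {k m} x {y} → k < m → m * x ≤ y → 0 < y → k * x < y
scale-< {k} zero    k<m le 0<y rewrite *-zeroʳ k = 0<y
scale-< (suc x) k<m le 0<y = <-≤-trans (*-monoˡ-< (suc x) k<m) le

record Family n a a′ (D : ℕ) : Set where
  field
    sets      : List (Vec Bool n)
    separated : ∀ {x y c} → Typed x y a a′ c → ∃[ S ] S ∈ sets × separates x y S ≡ true
    degreeˡ   : ∀ x → ∣ x ∣ ≡ a → ∑ sets (λ S → 𝟙 (inside x S)) ≤ D
    degreeʳ   : ∀ y → ∣ y ∣ ≡ a′ → ∑ sets (λ S → 𝟙 (outside y S)) ≤ D

-- The share of one test in the union bound: `w` is its weight, `x` the sum over the layer of its
-- factor for one draw, and `2 ^ E` the threshold that no test may reach.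
Affordable : (n s N E w x : ℕ) → Set
Affordable n s N E w x = length (tests n) * (w * x ^ N) < 2 ^ E * length (layer n s) ^ N

module FromBounds (a a′ i j N E : ℕ)
  (missed : ∀ r → r + B i j ≡ length (layer (a + a′ + (i + j)) (a + i)) → Affordable (a + a′ + (i + j)) (a + i) N E (2 ^ E) r)
  (crowdedˡ : Affordable (a + a′ + (i + j)) (a + i) N E 1 (length (layer (a + a′ + (i + j)) (a + i)) + B i (j + a′)))
  (crowdedʳ : Affordable (a + a′ + (i + j)) (a + i) N E 1 (length (layer (a + a′ + (i + j)) (a + i)) + B (i + a) j))
  (nonempty : 0 < length (layer (a + a′ + (i + j)) (a + i))) where
  private
    c = i + j
    n = a + a′ + c
    Ω = layer n (a + i)
    K = length (tests n)

    f : Test n → Vec Bool n → ℕ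
    f (covered (x , y)) S = 𝟙 (not (separates x y S))
    f (fewˡ x)          S = suc (𝟙 (inside x S))
    f (fewʳ y)          S = suc (𝟙 (outside y S))

    choose : ∀ {P : Set} → Dec P → ℕ → ℕ
    choose (yes _) k = k
    choose (no  _) k = 0

    -- An unseparated pair has product 1, so the weight `2 ^ E` lets it reach the threshold alone;
    -- for a degree test, with product `2 ^ degree`, weight 1 is right. Weight 0 switches off pairs
    -- and vectors of other sizes.
    w : Test n → ℕ
    w (covered (x , y)) = choose (typed? x y a a′ c) (2 ^ E)
    w (fewˡ x)          = choose (∣ x ∣ ≟ a) 1
    w (fewʳ y)          = choose (∣ y ∣ ≟ a′) 1

    nothing : K * 0 < 2 ^ E * length Ω ^ N
    nothing rewrite *-zeroʳ K = *-mono-≤ (m^n>0 2 E) (m^n>0 (length Ω) {{>-nonZero nonempty}} N)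

    only-if : ∀ {P : Set} (p? : Dec P) k x → (P → K * (k * x) < 2 ^ E * length Ω ^ N) →
              K * (choose p? k * x) < 2 ^ E * length Ω ^ N
    only-if (yes p) k x small = small p
    only-if (no  _) k x small = nothing

    chosen : ∀ {P : Set} (p? : Dec P) {k x v} → P → choose p? k * x < v → k * x < v
    chosen (yes _) p lt = lt
    chosen (no ¬p) p lt = contradiction p ¬p

    expected : ∀ {t} → t ∈ tests n → K * (w t * ∑ Ω (f t) ^ N) < 2 ^ E * length Ω ^ N
    expected {covered (x , y)} _ = only-if (typed? x y a a′ c) (2 ^ E) _ λ t →
      missed _ (trans (cong (∑ Ω (f (covered (x , y))) +_) (sym (trans (count-separating t (a + i)) (trans (ways-shift a c i) (sym (B≡C i j))))))
                      (∑-𝟙-not (separates x y) Ω))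
    expected {fewˡ x} _ = only-if (∣ x ∣ ≟ a) 1 _ λ eq →
      subst (Affordable n (a + i) N E 1)
        (sym (trans (∑-suc (λ S → 𝟙 (inside x S)) Ω) (cong (length Ω +_) (count-inside x i (j + a′) eq (e a a′ i j))))) crowdedˡ
      where
      e : ∀ a a′ i j → a + (i + (j + a′)) ≡ a + a′ + (i + j)
      e = solve-∀
    expected {fewʳ y} _ = only-if (∣ y ∣ ≟ a′) 1 _ λ eq →
      subst (Affordable n (a + i) N E 1)
        (sym (trans (∑-suc (λ S → 𝟙 (outside y S)) Ω)
          (cong (length Ω +_) (trans (count-outside y (a + i) j eq (e a a′ i j)) (cong (λ k → B k j) (+-comm a i)))))) crowdedʳ
      where
      e : ∀ a a′ i j → a′ + (a + i + j) ≡ a + a′ + (i + j)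
      e = solve-∀

  family : Family n a a′ E
  family with ConditionalExpectations.derandomize Ω nonempty (tests n) f N (2 ^ E) w expected
  ... | F , met = record { sets = F ; separated = sep ; degreeˡ = degˡ ; degreeʳ = degʳ }
    where
    degree : ∀ (p : Vec Bool n → Bool) → 1 * product (map (suc ∘ 𝟙 ∘ p) F) < 2 ^ E → ∑ F (𝟙 ∘ p) ≤ E
    degree p lt with ∑ F (𝟙 ∘ p) ≤? E
    ... | yes le = le
    ... | no ¬le = contradiction (^-monoʳ-≤ 2 (<⇒≤ (≰⇒> ¬le)))
            (<⇒≱ (subst (_< 2 ^ E) (trans (*-identityˡ _) (product-doubling p F)) lt))
    sep : ∀ {x y c′} → Typed x y a a′ c′ → ∃[ S ] S ∈ F × separates x y S ≡ true
    sep {x} {y} {c′} t = product-𝟙-not (separates x y) F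
      (n<1⇒n≡0 (*-cancelˡ-< (2 ^ E) _ 1 (subst (2 ^ E * product (map (𝟙 ∘ not ∘ separates x y) F) <_) (sym (*-identityʳ (2 ^ E)))
        (chosen (typed? x y a a′ c) (subst (Typed x y a a′) (+-cancelˡ-≡ (a + a′) c′ c (Typed-size t)) t) (met (∈-covered x y))))))
    degˡ : ∀ x → ∣ x ∣ ≡ a → ∑ F (λ S → 𝟙 (inside x S)) ≤ E
    degˡ x eq = degree (inside x) (chosen (∣ x ∣ ≟ a) eq (met (∈-fewˡ x)))
    degʳ : ∀ y → ∣ y ∣ ≡ a′ → ∑ F (λ S → 𝟙 (outside y S)) ≤ E
    degʳ y eq = degree (outside y) (chosen (∣ y ∣ ≟ a′) eq (met (∈-fewʳ y)))

module _ (a a′ i j s : ℕ) (X-small : B i (j + a′) ≤ s * B i j) (Y-small : B (i + a) j ≤ s * B i j) where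
  private
    c = i + j
    n = a + a′ + c
    Ω = layer n (a + i)
    g = B i j
    instance
      g≢0 : NonZero g
      g≢0 = >-nonZero (B>0 i j)
    -- A draw separates a given pair with probability `g / length Ω`, so `suc m` draws fail with
    -- probability at most 1 / 2, and `2 * suc n` such rounds with at most `1 / 4 ^ suc n`, which
    -- beats the number of tests. The mean degree is at most `N * s * g / length Ω`, hence at most
    -- `R`.
    m = length Ω / g
    N = suc m * (2 * suc n)
    R = 4 * suc n * s
    V = 4 * 4 ^ n * 4 ^ R

    count≤Ω : ∀ {x y} → Typed x y a a′ c → ∑ Ω (λ S → 𝟙 (separates x y S)) ≡ g
    count≤Ω t = trans (count-separating t (a + i)) (trans (ways-shift a c i) (sym (B≡C i j)))

    some-typed : ∀ a a′ c → ∃[ x ] ∃[ y ] Typed {a + a′ + c} x y a a′ c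
    some-typed zero    zero     zero    = [] , [] , []
    some-typed zero    zero     (suc c) = let x , y , t = some-typed 0 0 c in _ , _ , free t
    some-typed zero    (suc a′) c       = let x , y , t = some-typed 0 a′ c in _ , _ , right t
    some-typed (suc a) a′       c       = let x , y , t = some-typed a a′ c in _ , _ , left t

    -- `g` counts the sets of the layer that separate any one pair of this type, so the existence of
    -- one such pair suffices.
    g≤Ω : g ≤ length Ω
    g≤Ω = let x , y , t = some-typed a a′ c in
      subst₂ _≤_ (count≤Ω t) (∑-𝟙-not (separates x y) Ω) (m≤n+m _ _)

    instance
      Ω≢0 : NonZero (length Ω)
      Ω≢0 = >-nonZero (≤-trans (B>0 i j) g≤Ω)

    Ω≤mg : length Ω ≤ suc m * g
    Ω≤mg = begin
      length Ω           ≡⟨ m≡m%n+[m/n]*n (length Ω) g ⟩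
      _ + m * g          ≤⟨ +-monoˡ-≤ (m * g) (<⇒≤ (m%n<n (length Ω) g)) ⟩
      g + m * g          ∎

    mg≤2Ω : suc m * g ≤ 2 * length Ω
    mg≤2Ω = begin
      g + m * g                   ≤⟨ +-mono-≤ g≤Ω (m/n*n≤m (length Ω) g) ⟩
      length Ω + length Ω         ≡⟨ cong (length Ω +_) (+-identityʳ _) ⟨
      2 * length Ω                ∎

    V>0 : 0 < V
    V>0 = *-mono-≤ (*-mono-≤ {1} {4} (s≤s z≤n) (m^n>0 4 n)) (m^n>0 4 R)

    missed : ∀ r → r + g ≡ length Ω → length (tests n) * (V * r ^ N) < V * length Ω ^ N
    missed r r+g = subst (_< V * length Ω ^ N) (e V (length (tests n)) (r ^ N))
        (*-monoʳ-< V {{>-nonZero V>0}} (scale-< (r ^ N) (length-tests n) halved (m^n>0 (length Ω) N)))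
      where
      e : ∀ v k x → v * (k * x) ≡ k * (v * x)
      e = solve-∀
      halved : 4 * 4 ^ n * r ^ N ≤ length Ω ^ N
      halved = begin
        4 ^ suc n * r ^ N                               ≡⟨ cong₂ _*_ (sym (^-*-assoc 2 2 (suc n))) (^-*-assoc r (suc m) (2 * suc n)) ⟨
        2 ^ (2 * suc n) * (r ^ suc m) ^ (2 * suc n)     ≡⟨ ^-distribʳ-* (2 * suc n) 2 (r ^ suc m) ⟨
        (2 * r ^ suc m) ^ (2 * suc n)                   ≤⟨ ^-monoˡ-≤ (2 * suc n) (halving m r g (subst (_≤ suc m * g) (sym r+g) Ω≤mg)) ⟩
        ((r + g) ^ suc m) ^ (2 * suc n)                 ≡⟨ ^-*-assoc (r + g) (suc m) (2 * suc n) ⟩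
        (r + g) ^ N                                     ≡⟨ cong (_^ N) r+g ⟩
        length Ω ^ N                                    ∎

    crowded : ∀ p → p ≤ s * g → length (tests n) * (1 * (length Ω + p) ^ N) < V * length Ω ^ N
    crowded p p≤sg = begin-strict
      length (tests n) * (1 * (length Ω + p) ^ N)      ≡⟨ cong (length (tests n) *_) (*-identityˡ _) ⟩
      length (tests n) * (length Ω + p) ^ N            ≤⟨ *-monoʳ-≤ (length (tests n)) (exponential-bound N p (length Ω) R Np) ⟩
      length (tests n) * (4 ^ R * length Ω ^ N)        <⟨ *-monoˡ-< _ {{m*n≢0 _ _ {{m^n≢0 4 R}} {{m^n≢0 (length Ω) N}}}} (length-tests n) ⟩
      4 * 4 ^ n * (4 ^ R * length Ω ^ N)               ≡⟨ *-assoc (4 * 4 ^ n) (4 ^ R) _ ⟨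
      V * length Ω ^ N                                 ∎
      where
      e₁ : ∀ m n s g → m * (2 * n) * (s * g) ≡ 2 * n * s * (m * g)
      e₁ = solve-∀
      e₂ : ∀ n s o → 2 * n * s * (2 * o) ≡ 4 * n * s * o
      e₂ = solve-∀
      Np : N * p ≤ R * length Ω
      Np = begin
        N * p                             ≤⟨ *-monoʳ-≤ N p≤sg ⟩
        N * (s * g)                       ≡⟨ e₁ (suc m) (suc n) s g ⟩
        2 * suc n * s * (suc m * g)       ≤⟨ *-monoʳ-≤ (2 * suc n * s) mg≤2Ω ⟩
        2 * suc n * s * (2 * length Ω)    ≡⟨ e₂ (suc n) s (length Ω) ⟩
        R * length Ω                      ∎

    E = 2 * (suc n + R)
    V≡ : V ≡ 2 ^ E
    V≡ = trans (sym (^-distribˡ-+-* 4 (suc n) R)) (^-*-assoc 2 2 (suc n + R))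

  separating-family : Family n a a′ (2 * (suc n + 4 * suc n * s))
  separating-family = FromBounds.family a a′ i j N E
    (λ r eq → subst (λ v → length (tests n) * (v * r ^ N) < v * length Ω ^ N) V≡ (missed r eq))
    (subst (λ v → length (tests n) * (1 * (length Ω + B i (j + a′)) ^ N) < v * length Ω ^ N) V≡ (crowded _ X-small))
    (subst (λ v → length (tests n) * (1 * (length Ω + B (i + a) j) ^ N) < v * length Ω ^ N) V≡ (crowded _ Y-small))
    (>-nonZero⁻¹ _)

-- The covering of a block by rectangles

Family-mono : ∀ {n a a′ D D′} → D ≤ D′ → Family n a a′ D → Family n a a′ D′
Family-mono le F = record
  { sets = sets ; separated = separated
  ; degreeˡ = λ x eq → ≤-trans (degreeˡ x eq) le
  ; degreeʳ = λ y eq → ≤-trans (degreeʳ y eq) le }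
  where open Family F

degree-arithmetic : ∀ m s q t → 1 ≤ s → s * q ≤ 3 * (m * m) * t → 2 * (m + 4 * m * s) * q ≤ 30 * m ^ 3 * t
degree-arithmetic m s q t 1≤s s-small = begin
  2 * (m + 4 * m * s) * q             ≤⟨ *-monoˡ-≤ q (*-monoʳ-≤ 2 (+-monoˡ-≤ (4 * m * s) (m≤m*n m s {{>-nonZero 1≤s}}))) ⟩
  2 * (m * s + 4 * m * s) * q         ≡⟨ e₁ m s q ⟩
  10 * m * (s * q)                    ≤⟨ *-monoʳ-≤ (10 * m) s-small ⟩
  10 * m * (3 * (m * m) * t)          ≡⟨ e₂ m t ⟩
  30 * m ^ 3 * t                      ∎
  where
  e₁ : ∀ m s q → 2 * (m * s + 4 * m * s) * q ≡ 10 * m * (s * q)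
  e₁ = solve-∀
  e₂ : ∀ m t → 10 * m * (3 * (m * m) * t) ≡ 30 * (m * (m * (m * 1))) * t
  e₂ = solve-∀

small-family : ∀ a a′ c → let n = a + a′ + c in
               ∃[ D ] Family n a a′ D × D * Q₀ ^ n ≤ 30 * suc n ^ 3 * T₀ ^ n
small-family a a′ c =
  let i , j , s , eq , 1≤s , X-small , Y-small , s-small = ratio-bound a a′ c
      n = a + a′ + c
      n≡ = cong (a + a′ +_) eq
      m = suc (a + a′ + (i + j))
  in 2 * (m + 4 * m * s) , subst (λ k → Family k a a′ (2 * (m + 4 * m * s))) n≡ (separating-family a a′ i j s X-small Y-small)
   , subst (λ k → 2 * (suc k + 4 * suc k * s) * Q₀ ^ n ≤ 30 * suc n ^ 3 * T₀ ^ n) (sym n≡) (degree-arithmetic (suc n) s (Q₀ ^ n) (T₀ ^ n) 1≤s s-small)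

abstract
  -- The largest degree compatible with the bound of `small-family`. It depends on the block size
  -- only, so one number serves all types.
  maxDegree : ℕ → ℕ
  maxDegree n = _/_ (30 * suc n ^ 3 * T₀ ^ n) (Q₀ ^ n) {{m^n≢0 Q₀ n}}

  maxDegree-upper : ∀ n D → D * Q₀ ^ n ≤ 30 * suc n ^ 3 * T₀ ^ n → D ≤ maxDegree n
  maxDegree-upper n D small = begin
    D                                             ≡⟨ m*n/n≡m D (Q₀ ^ n) {{m^n≢0 Q₀ n}} ⟨
    _/_ (D * Q₀ ^ n) (Q₀ ^ n) {{m^n≢0 Q₀ n}}      ≤⟨ /-monoˡ-≤ (Q₀ ^ n) {{m^n≢0 Q₀ n}} small ⟩
    maxDegree n                                   ∎

  maxDegree-small : ∀ n → maxDegree n * Q₀ ^ n ≤ 30 * suc n ^ 3 * T₀ ^ n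
  maxDegree-small n = m/n*n≤m _ (Q₀ ^ n) {{m^n≢0 Q₀ n}}

  -- For `a + a′ > n` no pair has this type and the empty family will do; thus `a` and `a′` may
  -- range over a full square.
  any-family : ∀ n a a′ → Family n a a′ (maxDegree n)
  any-family n a a′ with a + a′ ≤? n
  ... | no ¬le = record
    { sets = []
    ; separated = λ t → contradiction (subst (a + a′ ≤_) (Typed-size t) (m≤m+n (a + a′) _)) ¬le
    ; degreeˡ = λ _ _ → z≤n ; degreeʳ = λ _ _ → z≤n }
  ... | yes le = subst (λ n → Family n a a′ (maxDegree n)) (m+[n∸m]≡n le)
    (let D , F , small = small-family a a′ (n ∸ (a + a′)) in Family-mono (maxDegree-upper (a + a′ + (n ∸ (a + a′))) D small) F)

Disjoint : ∀ {n} → Vec Bool n → Vec Bool n → Set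
Disjoint = Pointwise (λ p q → p ∧ q ≡ false)

Disjoint⇒Typed : ∀ {n} {x y : Vec Bool n} → Disjoint x y → ∃[ c ] Typed x y ∣ x ∣ ∣ y ∣ c
Disjoint⇒Typed [] = 0 , []
Disjoint⇒Typed {x = true  ∷ x} {false ∷ y} (_ ∷ d) = let c , t = Disjoint⇒Typed d in c , left t
Disjoint⇒Typed {x = false ∷ x} {true  ∷ y} (_ ∷ d) = let c , t = Disjoint⇒Typed d in c , right t
Disjoint⇒Typed {x = false ∷ x} {false ∷ y} (_ ∷ d) = let c , t = Disjoint⇒Typed d in suc c , free t

separated⇒Disjoint : ∀ {n} (x y S : Vec Bool n) → inside x S ≡ true → outside y S ≡ true → Disjoint x y
separated⇒Disjoint [] [] [] _ _ = []
separated⇒Disjoint (true  ∷ x) (false ∷ y) (true ∷ S) p q = refl ∷ separated⇒Disjoint x y S p q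
separated⇒Disjoint (true  ∷ x) (true  ∷ y) (true ∷ S) p ()
separated⇒Disjoint (true  ∷ x) (_     ∷ y) (false ∷ S) () q
separated⇒Disjoint (false ∷ x) (true  ∷ y) (false ∷ S) p q = refl ∷ separated⇒Disjoint x y S p q
separated⇒Disjoint (false ∷ x) (true  ∷ y) (true ∷ S) p ()
separated⇒Disjoint (false ∷ x) (false ∷ y) (s ∷ S) p q = refl ∷ separated⇒Disjoint x y S p q

∧-true : ∀ {p q} → p ∧ q ≡ true → p ≡ true × q ≡ true
∧-true {true} {true} _ = refl , refl

≡ᵇ-refl : ∀ m → (m ≡ᵇ m) ≡ true
≡ᵇ-refl zero    = refl
≡ᵇ-refl (suc m) = ≡ᵇ-refl m

-- A key is the position of an accepted rectangle in the list, counted from `k`, so that the program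
-- can handle it as a number.
keys : ∀ {R : Set} → (R → Bool) → List R → ℕ → List ℕ
keys p []       k = []
keys p (r ∷ rs) k = Bool.if p r then k ∷ keys p rs (suc k) else keys p rs (suc k)

keys-length : ∀ {R : Set} (p : R → Bool) rs k → length (keys p rs k) ≡ ∑ rs (𝟙 ∘ p)
keys-length p []       k = refl
keys-length p (r ∷ rs) k with p r
... | true  = cong suc (keys-length p rs (suc k))
... | false = keys-length p rs (suc k)

keys-range : ∀ {R : Set} (p : R → Bool) rs k → All (λ i → k ≤ i × i < k + length rs) (keys p rs k)
keys-range p []       k = []
keys-range p (r ∷ rs) k with p r | All.map (λ { {i} (k< , <k+) → <⇒≤ k< , subst (i <_) (sym (+-suc k (length rs))) <k+ })
                                         (keys-range p rs (suc k))
... | true  | rest = (≤-refl , m<m+n k z<s) ∷ rest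
... | false | rest = rest

keys-meet : ∀ {R : Set} (p q : R → Bool) rs k {i} → i ∈ keys p rs k → i ∈ keys q rs k → ∃[ r ] p r ≡ true × q r ≡ true
keys-meet p q (r ∷ rs) k i∈p i∈q with p r in pr | q r in qr
keys-meet p q (r ∷ rs) k _           _           | true  | true  = r , pr , qr
keys-meet p q (r ∷ rs) k (here refl) i∈q         | true  | false =
  contradiction (proj₁ (All.lookup (keys-range q rs (suc k)) i∈q)) 1+n≰n
keys-meet p q (r ∷ rs) k (there i∈p) i∈q         | true  | false = keys-meet p q rs (suc k) i∈p i∈q
keys-meet p q (r ∷ rs) k i∈p         (here refl) | false | true  =
  contradiction (proj₁ (All.lookup (keys-range p rs (suc k)) i∈p)) 1+n≰n
keys-meet p q (r ∷ rs) k i∈p         (there i∈q) | false | true  = keys-meet p q rs (suc k) i∈p i∈q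
keys-meet p q (r ∷ rs) k i∈p         i∈q         | false | false = keys-meet p q rs (suc k) i∈p i∈q

keys-common : ∀ {R : Set} (p q : R → Bool) {rs} k {r} → r ∈ rs → p r ≡ true → q r ≡ true →
              ∃[ i ] i ∈ keys p rs k × i ∈ keys q rs k
keys-common p q {r ∷ rs} k (here refl) pr qr rewrite pr | qr = k , here refl , here refl
keys-common p q {r ∷ rs} k (there r∈rs) pr qr with p r | q r | keys-common p q (suc k) r∈rs pr qr
... | true  | true  | i , i∈p , i∈q = i , there i∈p , there i∈q
... | true  | false | i , i∈p , i∈q = i , there i∈p , i∈q
... | false | true  | i , i∈p , i∈q = i , i∈p , there i∈q
... | false | false | i , i∈p , i∈q = i , i∈p , i∈q

-- All that the algorithm needs from the combinatorics: disjointness of two blocks becomes a common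
-- key. `L` bounds the number of keys of a block, and `N` their values, since they serve as digits
-- in base `N`.
record Gadget : Set where
  field
    b N L     : ℕ
    b>0       : 0 < b
    N>0       : 0 < N
    A A′      : Vec Bool b → List ℕ
    A<N       : ∀ x → All (_< N) (A x)
    A′<N      : ∀ y → All (_< N) (A′ y)
    few       : ∀ x → length (A x) ≤ L
    few′      : ∀ y → length (A′ y) ≤ L
    sound     : ∀ {x y k} → k ∈ A x → k ∈ A′ y → Disjoint x y
    complete  : ∀ {x y} → Disjoint x y → ∃[ k ] k ∈ A x × k ∈ A′ y
    L-small   : L * 1000 ^ b ≤ 1155 ^ b

module Rectangles (n : ℕ) where
  -- It stands for the product of all `x ⊆ S` of size `a` with all `y` of size `a′` that avoid `S`.
  -- Every pair in it is disjoint, and together the rectangles cover all disjoint pairs.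
  Rectangle : Set
  Rectangle = (ℕ × ℕ) × Vec Bool n

  types : List (ℕ × ℕ)
  types = cartesianProduct (upTo (suc n)) (upTo (suc n))

  rectanglesOf : ℕ × ℕ → List Rectangle
  rectanglesOf (a , a′) = map ((a , a′) ,_) (Family.sets (any-family n a a′))

  rectangles : List Rectangle
  rectangles = concatMap rectanglesOf types

  acceptsˡ acceptsʳ : Vec Bool n → Rectangle → Bool
  acceptsˡ x ((a , a′) , S) = (∣ x ∣ ≡ᵇ a) ∧ inside x S
  acceptsʳ y ((a , a′) , S) = (∣ y ∣ ≡ᵇ a′) ∧ outside y S

  ∑-concatMap : ∀ {A C : Set} (g : A → List C) xs f → ∑ (concatMap g xs) f ≡ ∑ xs (λ x → ∑ (g x) f)
  ∑-concatMap g []       f = refl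
  ∑-concatMap g (x ∷ xs) f = trans (∑-++ (g x) (concatMap g xs) f) (cong (∑ (g x) f +_) (∑-concatMap g xs f))

  ∈-concatMap : ∀ {A C : Set} (g : A → List C) {xs x y} → x ∈ xs → y ∈ g x → y ∈ concatMap g xs
  ∈-concatMap g (here refl) y∈ = ∈-++⁺ˡ y∈
  ∈-concatMap g (there {x} x∈) y∈ = ∈-++⁺ʳ (g x) (∈-concatMap g x∈ y∈)

  length-types : length types ≡ suc n * suc n
  length-types = trans (length-cartesianProduct (upTo (suc n)) (upTo (suc n))) (cong₂ _*_ (length-upTo (suc n)) (length-upTo (suc n)))

  -- Summing over all types is generous, as a vector is accepted only under its own size. The factor
  -- `suc n * suc n` merely raises the degree of the polynomial from 3 to 5.
  degree-bound : (p : Rectangle → Bool) → (∀ t → ∑ (Family.sets (any-family n (proj₁ t) (proj₂ t))) (λ S → 𝟙 (p (t , S))) ≤ maxDegree n) →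
                 ∑ rectangles (𝟙 ∘ p) ≤ suc n * suc n * maxDegree n
  degree-bound p small = begin
    ∑ rectangles (𝟙 ∘ p)                            ≡⟨ ∑-concatMap rectanglesOf types (𝟙 ∘ p) ⟩
    ∑ types (λ t → ∑ (rectanglesOf t) (𝟙 ∘ p))      ≤⟨ ∑-mono types (λ t → ≤-trans (≤-reflexive (∑-map (t ,_) (Family.sets (any-family n (proj₁ t) (proj₂ t))) (𝟙 ∘ p))) (small t)) ⟩
    ∑ types (λ _ → maxDegree n)                     ≡⟨ ∑-const types (maxDegree n) ⟩
    length types * maxDegree n                      ≡⟨ cong (_* maxDegree n) length-types ⟩
    suc n * suc n * maxDegree n                     ∎

  guarded : ∀ m a (F : List (Vec Bool n)) (p : Vec Bool n → Bool) D → (m ≡ a → ∑ F (𝟙 ∘ p) ≤ D) →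
            ∑ F (λ S → 𝟙 ((m ≡ᵇ a) ∧ p S)) ≤ D
  guarded m a F p D small with m ≡ᵇ a in eq
  ... | true  = small (≡ᵇ⇒≡ m a (subst T (sym eq) tt))
  ... | false = subst (_≤ D) (sym (∑-zero F)) z≤n

  degreeˡ : ∀ x → ∑ rectangles (𝟙 ∘ acceptsˡ x) ≤ suc n * suc n * maxDegree n
  degreeˡ x = degree-bound (acceptsˡ x) λ { (a , a′) →
    guarded ∣ x ∣ a (Family.sets (any-family n a a′)) (inside x) (maxDegree n) (Family.degreeˡ (any-family n a a′) x) }

  degreeʳ : ∀ y → ∑ rectangles (𝟙 ∘ acceptsʳ y) ≤ suc n * suc n * maxDegree n
  degreeʳ y = degree-bound (acceptsʳ y) λ { (a , a′) →
    guarded ∣ y ∣ a′ (Family.sets (any-family n a a′)) (outside y) (maxDegree n) (Family.degreeʳ (any-family n a a′) y) }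

  accepted⇒Disjoint : ∀ {x y} r → acceptsˡ x r ≡ true → acceptsʳ y r ≡ true → Disjoint x y
  accepted⇒Disjoint {x} {y} (_ , S) p q = separated⇒Disjoint x y S (proj₂ (∧-true p)) (proj₂ (∧-true q))

  Disjoint⇒accepted : ∀ {x y} → Disjoint x y → ∃[ r ] r ∈ rectangles × acceptsˡ x r ≡ true × acceptsʳ y r ≡ true
  Disjoint⇒accepted {x} {y} d with Disjoint⇒Typed d
  ... | c , t with Family.separated (any-family n ∣ x ∣ ∣ y ∣) t
  ...   | S , S∈ , sep = ((∣ x ∣ , ∣ y ∣) , S)
          , ∈-concatMap rectanglesOf
              (∈-cartesianProduct⁺ (∈-upTo⁺ (s≤s (subst (∣ x ∣ ≤_) (Typed-size t) (≤-trans (m≤m+n ∣ x ∣ ∣ y ∣) (m≤m+n _ c)))))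
                                   (∈-upTo⁺ (s≤s (subst (∣ y ∣ ≤_) (Typed-size t) (≤-trans (m≤n+m ∣ y ∣ ∣ x ∣) (m≤m+n _ c))))))
              (∈-map⁺ ((∣ x ∣ , ∣ y ∣) ,_) S∈)
          , cong₂ _∧_ (≡ᵇ-refl ∣ x ∣) (proj₁ (∧-true sep))
          , cong₂ _∧_ (≡ᵇ-refl ∣ y ∣) (proj₂ (∧-true {inside x S} sep))

abstract
  -- As `(1 + 1 / q) ^ suc q ≥ 2`, the exponent `b = suc q * j` gives at least `2 ^ j`, which beats
  -- a polynomial in `b` for large `j`. For `q = T₀` the number `suc q` is 100 * 1155; hence the
  -- choice of `T₀`. Only the existence of `b` is exported, as powers with such exponents must stay
  -- symbolic.
  growth : ∀ q j .{{_ : NonZero j}} → 30 * suc (suc q * j) ^ 5 ≤ 2 ^ j → ∃[ b ] 0 < b × 30 * suc b ^ 5 * q ^ b ≤ suc q ^ b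
  growth q j large = suc q * j , >-nonZero⁻¹ _ {{m*n≢0 (suc q) j}} , (begin
    30 * suc (suc q * j) ^ 5 * q ^ (suc q * j)    ≤⟨ *-monoˡ-≤ (q ^ (suc q * j)) large ⟩
    2 ^ j * q ^ (suc q * j)               ≡⟨ cong (2 ^ j *_) (^-*-assoc q (suc q) j) ⟨
    2 ^ j * (q ^ suc q) ^ j               ≡⟨ ^-distribʳ-* j 2 (q ^ suc q) ⟨
    (2 * q ^ suc q) ^ j                   ≤⟨ ^-monoˡ-≤ j (halving q q 1 (≤-reflexive (trans (+-comm q 1) (sym (*-identityʳ (suc q)))))) ⟩
    ((q + 1) ^ suc q) ^ j                 ≡⟨ cong (λ x → (x ^ suc q) ^ j) (+-comm q 1) ⟩
    (suc q ^ suc q) ^ j                   ≡⟨ ^-*-assoc (suc q) (suc q) j ⟩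
    suc q ^ (suc q * j)                   ∎)

gadget-arithmetic : ∀ b m d → d * Q₀ ^ b ≤ 30 * m ^ 3 * T₀ ^ b → 30 * m ^ 5 * T₀ ^ b ≤ (100 * 1155) ^ b →
                    m * m * d * 1000 ^ b ≤ 1155 ^ b
gadget-arithmetic b m d small large = *-cancelˡ-≤ (100 ^ b) {{m^n≢0 100 b}} (begin
  100 ^ b * (m * m * d * 1000 ^ b)      ≡⟨ e₁ (100 ^ b) m d (1000 ^ b) ⟩
  m * m * (d * (100 ^ b * 1000 ^ b))    ≡⟨ cong (λ q → m * m * (d * q)) (^-distribʳ-* b 100 1000) ⟨
  m * m * (d * Q₀ ^ b)                  ≤⟨ *-monoʳ-≤ (m * m) small ⟩
  m * m * (30 * m ^ 3 * T₀ ^ b)         ≡⟨ e₂ m (T₀ ^ b) ⟩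
  30 * m ^ 5 * T₀ ^ b                   ≤⟨ large ⟩
  (100 * 1155) ^ b                      ≡⟨ ^-distribʳ-* b 100 1155 ⟩
  100 ^ b * 1155 ^ b                    ∎)
  where
  e₁ : ∀ h m d t → h * (m * m * d * t) ≡ m * m * (d * (h * t))
  e₁ = solve-∀
  e₂ : ∀ m t → m * m * (30 * (m * (m * (m * 1))) * t) ≡ 30 * (m * (m * (m * (m * (m * 1))))) * t
  e₂ = solve-∀

gadget-of-size : ∀ b → 0 < b → 30 * suc b ^ 5 * T₀ ^ b ≤ (100 * 1155) ^ b → Gadget
gadget-of-size b b>0 large = record
  { b = b ; N = suc (length rectangles) ; L = suc b * suc b * maxDegree b
  ; b>0 = b>0 ; N>0 = z<s
  ; A = λ x → keys (acceptsˡ x) rectangles 0 ; A′ = λ y → keys (acceptsʳ y) rectangles 0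
  ; A<N = λ x → All.map (λ { (_ , lt) → m≤n⇒m≤1+n lt }) (keys-range (acceptsˡ x) rectangles 0)
  ; A′<N = λ y → All.map (λ { (_ , lt) → m≤n⇒m≤1+n lt }) (keys-range (acceptsʳ y) rectangles 0)
  ; few = λ x → subst (_≤ suc b * suc b * maxDegree b) (sym (keys-length (acceptsˡ x) rectangles 0)) (degreeˡ x)
  ; few′ = λ y → subst (_≤ suc b * suc b * maxDegree b) (sym (keys-length (acceptsʳ y) rectangles 0)) (degreeʳ y)
  ; sound = λ {x} {y} k∈ k∈′ → let r , p , q = keys-meet (acceptsˡ x) (acceptsʳ y) rectangles 0 k∈ k∈′ in accepted⇒Disjoint r p q
  ; complete = λ {x} {y} d → let r , r∈ , p , q = Disjoint⇒accepted d in keys-common (acceptsˡ x) (acceptsʳ y) 0 r∈ p q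
  ; L-small = gadget-arithmetic b (suc b) (maxDegree b) (maxDegree-small b) large
  }
  where
  open Rectangles b

gadget : Gadget
-- The block size is 115500 * 128, so the polynomial is about `2 ^ 124`.
gadget = from (growth T₀ 128 (≤ᵇ⇒≤ (30 * suc (suc T₀ * 128) ^ 5) (2 ^ 128) tt))
  where
  from : ∃[ b ] 0 < b × 30 * suc b ^ 5 * T₀ ^ b ≤ (100 * 1155) ^ b → Gadget
  from (b , b>0 , large) = gadget-of-size b b>0 large

-- Timed execution

open import Data.Integer.Base as ℤ using (ℤ; +_; -[1+_]; 0ℤ; 1ℤ)
import Data.Integer.Properties as ℤₚ

-- If stored values and literals are below `2 ^ β`, the value of `e` has at most `β * size e` binary
-- digits, and evaluating it costs at most `weight e` times the square of `β + 1`. A `mem` has size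
-- 1 because the cell it reads is bounded again.
size weight : Expr → ℕ
size (lit x) = 1
size (reg r) = 1
size (mem e) = 1
size (e ⊕ f) = size e + size f
size (e ⊖ f) = size e + size f
size (e ⊗ f) = size e + size f
weight (lit x) = 1
weight (reg r) = 1
weight (mem e) = weight e + size e + 1
weight (e ⊕ f) = weight e + weight f + (size e + size f)
weight (e ⊖ f) = weight e + weight f + (size e + size f)
weight (e ⊗ f) = weight e + weight f + size e * size f

size>0 : ∀ e → 0 < size e
size>0 (lit x) = z<s
size>0 (reg r) = z<s
size>0 (mem e) = z<s
size>0 (e ⊕ f) = ≤-trans (size>0 e) (m≤m+n _ _)
size>0 (e ⊖ f) = ≤-trans (size>0 e) (m≤m+n _ _)
size>0 (e ⊗ f) = ≤-trans (size>0 e) (m≤m+n _ _)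

module Timed (β : ℕ) (β>0 : 0 < β) where

  Small : ℤ → Set
  Small x = ℤ.∣ x ∣ < 2 ^ β

  record Bounded (σ : Store) : Set where
    constructor bounds
    field
      regs-small   : ∀ r → Small (regs σ r)
      memory-small : ∀ a → Small (memory σ a)
  open Bounded public

  SmallLits : Expr → Set
  SmallLits (lit x) = Small x
  SmallLits (reg r) = ⊤
  SmallLits (mem e) = SmallLits e
  SmallLits (e ⊕ f) = SmallLits e × SmallLits f
  SmallLits (e ⊖ f) = SmallLits e × SmallLits f
  SmallLits (e ⊗ f) = SmallLits e × SmallLits f

  bounded-setReg : ∀ {σ} r {x} → Bounded σ → Small x → Bounded (setReg r x σ)
  bounded-setReg {σ} r {x} B small = bounds small′ (memory-small B)
    where
    small′ : ∀ s → Small (regs (setReg r x σ) s)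
    small′ s with s ≟ r
    ... | yes _ = small
    ... | no  _ = regs-small B s

  bounded-setMem : ∀ {σ} a {x} → Bounded σ → Small x → Bounded (setMem a x σ)
  bounded-setMem {σ} a {x} B small = bounds (regs-small B) small′
    where
    small′ : ∀ b → Small (memory (setMem a x σ) b)
    small′ b with b ℤₚ.≟ a
    ... | yes _ = small
    ... | no  _ = memory-small B b

  private
    γ : ℕ
    γ = suc β

  +-<-2^ : ∀ {x y} i j → 0 < i → 0 < j → x < 2 ^ i → y < 2 ^ j → x + y < 2 ^ (i + j)
  +-<-2^ {x} {y} (suc i) (suc j) _ _ x< y< = begin-strict
    x + y                              <⟨ +-mono-< x< y< ⟩
    2 ^ suc i + 2 ^ suc j              ≤⟨ +-mono-≤ (m≤m*n (2 ^ suc i) (2 ^ j) {{m^n≢0 2 j}}) (m≤n*m (2 ^ suc j) (2 ^ i) {{m^n≢0 2 i}}) ⟩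
    2 ^ suc i * 2 ^ j + 2 ^ i * 2 ^ suc j  ≡⟨ e (2 ^ i) (2 ^ j) ⟩
    2 ^ suc i * 2 ^ suc j              ≡⟨ ^-distribˡ-+-* 2 (suc i) (suc j) ⟨
    2 ^ (suc i + suc j)                ∎
    where
    e : ∀ p q → 2 * p * q + p * (2 * q) ≡ 2 * p * (2 * q)
    e = solve-∀

  β*size>0 : ∀ e → 0 < β * size e
  β*size>0 e = *-mono-≤ β>0 (size>0 e)

  value-bound : ∀ {σ} → Bounded σ → ∀ e → SmallLits e → ℤ.∣ ⟦ e ⟧ σ ∣ < 2 ^ (β * size e)
  value-bound B (lit x) s rewrite *-identityʳ β = s
  value-bound B (reg r) s rewrite *-identityʳ β = regs-small B r
  value-bound B (mem e) s rewrite *-identityʳ β = memory-small B _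
  value-bound {σ} B (e ⊕ f) (s , t) rewrite *-distribˡ-+ β (size e) (size f) =
    ≤-<-trans (ℤₚ.∣i+j∣≤∣i∣+∣j∣ (⟦ e ⟧ σ) (⟦ f ⟧ σ))
      (+-<-2^ _ _ (β*size>0 e) (β*size>0 f) (value-bound B e s) (value-bound B f t))
  value-bound {σ} B (e ⊖ f) (s , t) rewrite *-distribˡ-+ β (size e) (size f) =
    ≤-<-trans (ℤₚ.∣i-j∣≤∣i∣+∣j∣ (⟦ e ⟧ σ) (⟦ f ⟧ σ))
      (+-<-2^ _ _ (β*size>0 e) (β*size>0 f) (value-bound B e s) (value-bound B f t))
  value-bound {σ} B (e ⊗ f) (s , t)
    rewrite *-distribˡ-+ β (size e) (size f) | ^-distribˡ-+-* 2 (β * size e) (β * size f)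
          | ℤₚ.abs-* (⟦ e ⟧ σ) (⟦ f ⟧ σ) = *-mono-< (value-bound B e s) (value-bound B f t)

  bits-bound : ∀ {σ} → Bounded σ → ∀ e → SmallLits e → bits (⟦ e ⟧ σ) ≤ size e * γ
  bits-bound {σ} B e s = begin
    suc ⌊log₂ ℤ.∣ ⟦ e ⟧ σ ∣ ⌋           ≤⟨ s≤s (⌊log₂⌋-mono-≤ (<⇒≤ (value-bound B e s))) ⟩
    suc ⌊log₂ (2 ^ (β * size e)) ⌋      ≡⟨ cong suc (⌊log₂[2^n]⌋≡n (β * size e)) ⟩
    1 + β * size e                      ≤⟨ +-monoˡ-≤ (β * size e) (size>0 e) ⟩
    size e + β * size e                 ≡⟨ e₁ (size e) β ⟩
    size e * γ                          ∎
    where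
    e₁ : ∀ s b → s + b * s ≡ s * (1 + b)
    e₁ = solve-∀

  γ≤γ² : γ ≤ γ * γ
  γ≤γ² = m≤m*n γ γ

  sum-cost : ∀ {c c′ x x′} w w′ s s′ → c ≤ w * (γ * γ) → c′ ≤ w′ * (γ * γ) → x ≤ s * γ → x′ ≤ s′ * γ →
             c + c′ + (x + x′) ≤ (w + w′ + (s + s′)) * (γ * γ)
  sum-cost {c} {c′} {x} {x′} w w′ s s′ c≤ c′≤ x≤ x′≤ = begin
    c + c′ + (x + x′)
      ≤⟨ +-mono-≤ (+-mono-≤ c≤ c′≤) (+-mono-≤ (≤-trans x≤ (*-monoʳ-≤ s γ≤γ²)) (≤-trans x′≤ (*-monoʳ-≤ s′ γ≤γ²))) ⟩
    w * (γ * γ) + w′ * (γ * γ) + (s * (γ * γ) + s′ * (γ * γ))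
      ≡⟨ e₁ w w′ s s′ (γ * γ) ⟩
    (w + w′ + (s + s′)) * (γ * γ) ∎
    where
    e₁ : ∀ w v s t g → w * g + v * g + (s * g + t * g) ≡ (w + v + (s + t)) * g
    e₁ = solve-∀

  cost-bound : ∀ {σ} → Bounded σ → ∀ e → SmallLits e → cost e σ ≤ weight e * (γ * γ)
  cost-bound {σ} B (lit x) s = ≤-trans (bits-bound {σ} B (lit x) s) (*-monoʳ-≤ 1 γ≤γ²)
  cost-bound B (reg r) s = ≤-trans (bits-bound B (reg r) s) (*-monoʳ-≤ 1 γ≤γ²)
  cost-bound {σ} B (mem e) s = begin
    cost e σ + bits (⟦ e ⟧ σ) + bits (⟦ mem e ⟧ σ)
      ≡⟨ +-assoc (cost e σ) _ _ ⟩
    cost e σ + (bits (⟦ e ⟧ σ) + bits (⟦ mem e ⟧ σ))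
      ≤⟨ subst (_≤ (weight e + 0 + (size e + 1)) * (γ * γ)) (cong (λ c → c + (bits (⟦ e ⟧ σ) + bits (⟦ mem e ⟧ σ))) (+-identityʳ (cost e σ)))
           (sum-cost (weight e) 0 (size e) 1 (cost-bound B e s) z≤n (bits-bound B e s) (bits-bound B (mem e) s)) ⟩
    (weight e + 0 + (size e + 1)) * (γ * γ)
      ≡⟨ cong (_* (γ * γ)) (e₁ (weight e) (size e)) ⟩
    (weight e + size e + 1) * (γ * γ) ∎
    where
    e₁ : ∀ w s → w + 0 + (s + 1) ≡ w + s + 1
    e₁ = solve-∀
  cost-bound B (e ⊕ f) (s , t) = sum-cost (weight e) (weight f) (size e) (size f)
    (cost-bound B e s) (cost-bound B f t) (bits-bound B e s) (bits-bound B f t)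
  cost-bound B (e ⊖ f) (s , t) = sum-cost (weight e) (weight f) (size e) (size f)
    (cost-bound B e s) (cost-bound B f t) (bits-bound B e s) (bits-bound B f t)
  cost-bound {σ} B (e ⊗ f) (s , t) = begin
    cost e σ + cost f σ + bits (⟦ e ⟧ σ) * bits (⟦ f ⟧ σ)
      ≤⟨ +-mono-≤ (+-mono-≤ (cost-bound B e s) (cost-bound B f t)) (*-mono-≤ (bits-bound B e s) (bits-bound B f t)) ⟩
    weight e * (γ * γ) + weight f * (γ * γ) + size e * γ * (size f * γ)
      ≡⟨ e₁ (weight e) (weight f) (size e) (size f) γ ⟩
    (weight e + weight f + size e * size f) * (γ * γ) ∎
    where
    e₁ : ∀ w v s t g → w * (g * g) + v * (g * g) + s * g * (t * g) ≡ (w + v + s * t) * (g * g)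
    e₁ = solve-∀

  -- All expressions of the program below have weight less than 50.
  κ : ℕ
  κ = 50 * (γ * γ)

  -- Time is counted in units of `κ`, an upper bound for one assignment or test, so that running
  -- times add up as plain step counts.
  record Run (P : Cmd) (σ : Store) (s : ℕ) (τ : Store) : Set where
    constructor run
    field
      {time}  : ℕ
      halts   : P ⊢ σ ⇓[ time ] τ
      in-time : time ≤ s * κ

  small-cost : ∀ {c} w → suc w ≤ 50 → c ≤ w * (γ * γ) → suc c ≤ κ
  small-cost {c} w w≤ c≤ = begin
    1 + c                            ≤⟨ +-mono-≤ {1} {γ * γ} (s≤s z≤n) c≤ ⟩
    γ * γ + w * (γ * γ)              ≤⟨ *-monoˡ-≤ (γ * γ) w≤ ⟩
    κ                                ∎

  one : ∀ {c} → c ≤ κ → c ≤ 1 * κ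
  one {c} le = subst (c ≤_) (sym (*-identityˡ κ)) le

  1≤κ : 1 ≤ κ
  1≤κ = small-cost {0} 0 (s≤s z≤n) z≤n

  weaken : ∀ {P σ s s′ τ} → s ≤ s′ → Run P σ s τ → Run P σ s′ τ
  weaken le (run p t≤) = run p (≤-trans t≤ (*-monoˡ-≤ κ le))

  run-skip : ∀ {σ} → Run skip σ 1 σ
  run-skip = run ⇓-skip (one 1≤κ)

  run-reg : ∀ {σ} → Bounded σ → ∀ r e → SmallLits e → suc (weight e) ≤ 50 → Run (reg[ r ]≔ e) σ 1 (setReg r (⟦ e ⟧ σ) σ)
  run-reg B r e s w≤ = run ⇓-reg (one (small-cost (weight e) w≤ (cost-bound B e s)))

  run-mem : ∀ {σ} → Bounded σ → ∀ a e → SmallLits a → SmallLits e → suc (weight a + size a + weight e) ≤ 50 →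
            Run (mem[ a ]≔ e) σ 1 (setMem (⟦ a ⟧ σ) (⟦ e ⟧ σ) σ)
  run-mem {σ} B a e s t w≤ = run ⇓-mem (one (small-cost (weight a + size a + weight e) w≤ (begin
      cost a σ + bits (⟦ a ⟧ σ) + cost e σ
        ≤⟨ +-mono-≤ (+-mono-≤ (cost-bound B a s) (≤-trans (bits-bound B a s) (*-monoʳ-≤ (size a) γ≤γ²))) (cost-bound B e t) ⟩
      weight a * (γ * γ) + size a * (γ * γ) + weight e * (γ * γ)
        ≡⟨ e₁ (weight a) (size a) (weight e) (γ * γ) ⟩
      (weight a + size a + weight e) * (γ * γ) ∎)))
    where
    e₁ : ∀ w s v g → w * g + s * g + v * g ≡ (w + s + v) * g
    e₁ = solve-∀

  infixr 3 _⟫_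
  _⟫_ : ∀ {P Q σ τ υ s t} → Run P σ s τ → Run Q τ t υ → Run (P ⨾ Q) σ (suc (s + t)) υ
  _⟫_ {s = s} {t} (run {x} p x≤) (run {y} q y≤) = run (⇓-seq p q) (begin
    suc (x + y)                ≤⟨ +-mono-≤ 1≤κ (+-mono-≤ x≤ y≤) ⟩
    κ + (s * κ + t * κ)        ≡⟨ cong (λ k → κ + k) (*-distribʳ-+ κ s t) ⟨
    suc (s + t) * κ            ∎)

  run-then : ∀ {e P Q σ τ s} → Bounded σ → SmallLits e → suc (weight e) ≤ 50 → 0ℤ ℤ.< ⟦ e ⟧ σ →
             Run P σ s τ → Run (if e then P else Q) σ (suc s) τ
  run-then {e} B s w≤ pos (run p t≤) = run (⇓-then pos p) (+-mono-≤ (small-cost (weight e) w≤ (cost-bound B e s)) t≤)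

  run-else : ∀ {e P Q σ τ s} → Bounded σ → SmallLits e → suc (weight e) ≤ 50 → ¬ (0ℤ ℤ.< ⟦ e ⟧ σ) →
             Run Q σ s τ → Run (if e then P else Q) σ (suc s) τ
  run-else {e} B s w≤ pos (run p t≤) = run (⇓-else pos p) (+-mono-≤ (small-cost (weight e) w≤ (cost-bound B e s)) t≤)

  run-loop : ∀ {e P σ τ υ s t} → Bounded σ → SmallLits e → suc (weight e) ≤ 50 → 0ℤ ℤ.< ⟦ e ⟧ σ →
             Run P σ s τ → Run (while e loop P) τ t υ → Run (while e loop P) σ (suc (s + t)) υ
  run-loop {e} {s = s} {t} B l w≤ pos (run {x} p x≤) (run {y} q y≤) = run (⇓-loop pos p q) (begin
    suc (cost e _ + x + y)        ≡⟨ cong suc (+-assoc (cost e _) x y) ⟩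
    suc (cost e _) + (x + y)      ≤⟨ +-mono-≤ (small-cost (weight e) w≤ (cost-bound B e l)) (+-mono-≤ x≤ y≤) ⟩
    κ + (s * κ + t * κ)           ≡⟨ cong (λ k → κ + k) (*-distribʳ-+ κ s t) ⟨
    suc (s + t) * κ               ∎)

  run-exit : ∀ {e P σ} → Bounded σ → SmallLits e → suc (weight e) ≤ 50 → ¬ (0ℤ ℤ.< ⟦ e ⟧ σ) → Run (while e loop P) σ 1 σ
  run-exit {e} B l w≤ neg = run (⇓-exit neg) (one (small-cost (weight e) w≤ (cost-bound B e l)))

-- The program

-- Register 2 is the address of the next coordinate to read, 3 counts vectors,
-- 4 counts coordinates left in the current vector, 5, 6 and 7 are the head, the
-- tail and an inner bound of a queue of keys, 8 is the current key, and 9 is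
-- the answer.  The queue and the table of marks are interleaved on the negative
-- addresses.
queueCell markCell : ℕ → ℤ
queueCell h = -[1+ h + h ]
markCell  k = -[1+ suc (k + k) ]

queueAt markAt : ℕ → Expr
queueAt r = lit -[1+ 0 ] ⊖ (reg r ⊕ reg r)
markAt  r = lit -[1+ 1 ] ⊖ (reg r ⊕ reg r)

-- With `end` 7 the loop stops after the keys that were present when the level began, although `cmd`
-- pushes new ones behind them. With `end` 6 it runs to the tail of the queue.
forQueue : ℕ → Cmd → Cmd
forQueue end cmd = while (reg end ⊖ reg 5) loop
  ((reg[ 8 ]≔ mem (queueAt 5)) ⨾ cmd ⨾ (reg[ 5 ]≔ reg 5 ⊕ lit 1ℤ))

module Program (b N : ℕ) where

  -- Each `a` is appended as a last digit in base `N` to the key in register 8. The list is part of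
  -- the program, so the loop over it is unrolled.
  pushes : List ℕ → Cmd
  pushes []       = skip
  pushes (a ∷ as) = (mem[ queueAt 6 ]≔ reg 8 ⊗ lit (+ N) ⊕ lit (+ a)) ⨾ (reg[ 6 ]≔ reg 6 ⊕ lit 1ℤ) ⨾ pushes as

  -- The factor reg 4 ⊖ lit (+ i) makes coordinates beyond the end of the vector
  -- read as 0.
  caseBits : ∀ m → ℕ → (Vec Bool m → Cmd) → Cmd
  caseBits zero    i f = f []
  caseBits (suc m) i f = if (reg 4 ⊖ lit (+ i)) ⊗ mem (reg 2 ⊕ lit (+ i))
    then caseBits m (suc i) (λ x → f (true ∷ x))
    else caseBits m (suc i) (λ x → f (false ∷ x))

  block : (Vec Bool b → List ℕ) → Cmd
  block A = (reg[ 7 ]≔ reg 6) ⨾ caseBits b 0 (λ x → forQueue 7 (pushes (A x)))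
          ⨾ (reg[ 2 ]≔ reg 2 ⊕ lit (+ b)) ⨾ (reg[ 4 ]≔ reg 4 ⊖ lit (+ b))

  enumerate : (Vec Bool b → List ℕ) → Cmd
  enumerate A = (reg[ 5 ]≔ lit 0ℤ) ⨾ (reg[ 6 ]≔ lit 1ℤ) ⨾ (mem[ lit -[1+ 0 ] ]≔ lit 0ℤ) ⨾ (reg[ 4 ]≔ reg 1)
              -- Afterwards register 4 is zero, or negative by as much as the last block overshot
              -- the vector. Adding it to the address leads to the start of the next vector.
              ⨾ (while reg 4 loop block A) ⨾ (reg[ 2 ]≔ reg 2 ⊕ reg 4)

  phase : (Vec Bool b → List ℕ) → Cmd → Cmd
  phase A cmd = (reg[ 3 ]≔ reg 0) ⨾ (while reg 3 loop
    (enumerate A ⨾ forQueue 6 cmd ⨾ (reg[ 3 ]≔ reg 3 ⊖ lit 1ℤ)))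

  markKey testKey : Cmd
  markKey = mem[ markAt 8 ]≔ lit 1ℤ
  testKey = if mem (markAt 8) then (reg[ 9 ]≔ lit 1ℤ) else skip

  program : (A A′ : Vec Bool b → List ℕ) → Cmd
  -- Register 2 is not reset between the phases: after the last vector of `u` it points to the first
  -- of `v`.
  program A A′ = phase A markKey ⨾ (phase A′ testKey ⨾ (reg[ 0 ]≔ reg 9))

-- Simulation of the program on lists of keys

memory-hit : ∀ a x σ {c} → c ≡ a → memory (setMem a x σ) c ≡ x
memory-hit a x σ {c} eq with c ℤₚ.≟ a
... | yes _  = refl
... | no neq = contradiction eq neq

memory-miss : ∀ a x σ {c} → c ≢ a → memory (setMem a x σ) c ≡ memory σ c
memory-miss a x σ {c} neq with c ℤₚ.≟ a
... | yes eq = contradiction eq neq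
... | no _   = refl

double-injective : ∀ {m n} → m + m ≡ n + n → m ≡ n
double-injective {m} {n} eq = *-cancelˡ-≡ m n 2 (trans (cong (λ x → m + x) (+-identityʳ m)) (trans eq (cong (λ x → n + x) (sym (+-identityʳ n)))))

m+m≢1+n+n : ∀ m n → m + m ≢ suc (n + n)
m+m≢1+n+n (suc m) n eq = m+m≢1+n+n n m (sym (suc-injective (trans (cong suc (sym (+-suc m m))) eq)))

queueCell-injective : ∀ {g h} → queueCell g ≡ queueCell h → g ≡ h
queueCell-injective = double-injective ∘ ℤₚ.-[1+-injective

markCell-injective : ∀ {k l} → markCell k ≡ markCell l → k ≡ l
markCell-injective = double-injective ∘ suc-injective ∘ ℤₚ.-[1+-injective

queue≢mark : ∀ h k → queueCell h ≢ markCell k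
queue≢mark h k = m+m≢1+n+n h k ∘ ℤₚ.-[1+-injective

queueAt-value : ∀ r σ {h} → regs σ r ≡ + h → ⟦ queueAt r ⟧ σ ≡ queueCell h
queueAt-value r σ {zero}  eq rewrite eq = refl
queueAt-value r σ {suc h} eq rewrite eq = refl

markAt-value : ∀ r σ {k} → regs σ r ≡ + k → ⟦ markAt r ⟧ σ ≡ markCell k
markAt-value r σ {zero}  eq rewrite eq = refl
markAt-value r σ {suc k} eq rewrite eq = refl

0<m-n : ∀ {m n} → n < m → 0ℤ ℤ.< + m ℤ.- + n
0<m-n {m} {n} n<m rewrite ℤₚ.m-n≡m⊖n m n | ℤₚ.⊖-≥ (<⇒≤ n<m) = ℤ.+<+ (m<n⇒0<n∸m n<m)

0≮m-n : ∀ {m n} → m ≤ n → ¬ (0ℤ ℤ.< + m ℤ.- + n)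
0≮m-n {m} {n} m≤n rewrite ℤₚ.m-n≡m⊖n m n | ℤₚ.⊖-≤ m≤n = nonpositive (n ∸ m)
  where
  nonpositive : ∀ k → ¬ (0ℤ ℤ.< ℤ.- + k)
  nonpositive zero    (ℤ.+<+ ())
  nonpositive (suc k) ()

Holds : (ℤ → ℤ) → ℕ → List ℕ → Set
Holds m h []       = ⊤
Holds m h (k ∷ ks) = m (queueCell h) ≡ + k × Holds m (suc h) ks

Holds-resp : ∀ {m m′} h ks → (∀ i → m′ (queueCell i) ≡ m (queueCell i)) → Holds m h ks → Holds m′ h ks
Holds-resp h []       eq _        = tt
Holds-resp h (k ∷ ks) eq (q , qs) = trans (eq h) q , Holds-resp (suc h) ks eq qs

Holds-push : ∀ σ h ks v → Holds (memory σ) h ks → Holds (memory (setMem (queueCell (h + length ks)) (+ v) σ)) h (ks ++ v ∷ [])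
Holds-push σ h []       v _ rewrite +-identityʳ h = memory-hit (queueCell h) (+ v) σ refl , tt
Holds-push σ h (k ∷ ks) v (q , qs) rewrite +-suc h (length ks) =
  trans (memory-miss _ (+ v) σ (λ eq → m≢1+m+n h (queueCell-injective eq))) q , Holds-push σ (suc h) ks v qs

-- The marked keys and the answer so far, as pure data. Every run is related to a fold over this,
-- and correctness is then proved of the fold alone.
Progress : Set
Progress = (ℕ → Bool) × Bool

setMark test : ℕ → Progress → Progress
setMark k (M , f) = (λ j → (j ≡ᵇ k) ∨ M j) , f
test    k (M , f) = M , M k ∨ f

module Execution (b N L : ℕ) (b>0 : 0 < b) (N>0 : 0 < N) (L>0 : 0 < L)
  (n d : ℕ) (inp : ℕ → Bool) (β : ℕ) (β≥2 : 2 ≤ β) (b< : b < 2 ^ β) (N< : N < 2 ^ β) (d< : d < 2 ^ β) where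

  open Timed β (≤-trans (s≤s z≤n) β≥2)
  open Program b N

  4≤2^β : 4 ≤ 2 ^ β
  4≤2^β = ^-monoʳ-≤ 2 β≥2

  small-2 : 2 < 2 ^ β
  small-2 = ≤-trans (s≤s (s≤s (s≤s z≤n))) 4≤2^β

  small-1 : 1 < 2 ^ β
  small-1 = ≤-trans (s≤s (s≤s z≤n)) 4≤2^β

  small-0 : 0 < 2 ^ β
  small-0 = ≤-trans (s≤s z≤n) 4≤2^β

  -- The arguments are the contents of registers 2, 3, 4, 5, 7 and 8 in this order, then the queue
  -- and the progress after `k`. `rem` is an integer because the last block may overshoot. Cells in
  -- front of the head are left unspecified, while the table of marks is described completely.
  record Rep (p cnt : ℕ) (rem : ℤ) (h e k : ℕ) (q : List ℕ) (D : Progress) (σ : Store) : Set where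
    field
      r0 : regs σ 0 ≡ + n
      r1 : regs σ 1 ≡ + d
      r2 : regs σ 2 ≡ + p
      r3 : regs σ 3 ≡ + cnt
      r4 : regs σ 4 ≡ rem
      r5 : regs σ 5 ≡ + h
      r6 : regs σ 6 ≡ + (h + length q)
      r7 : regs σ 7 ≡ + e
      r8 : regs σ 8 ≡ + k
      r9 : regs σ 9 ≡ + 𝟙 (proj₂ D)
      bounded : Bounded σ
      inputs : ∀ a → memory σ (+ a) ≡ + 𝟙 (inp a)
      marks  : ∀ k → memory σ (markCell k) ≡ + 𝟙 (proj₁ D k)
      queued : Holds (memory σ) h q
  open Rep

  small-≡ : ∀ {x m} → x ≡ + m → m < 2 ^ β → Small x
  small-≡ refl lt = lt

  extend : ℕ → List ℕ → List ℕ
  extend k as = map (λ a → k * N + a) as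

  push-run : ∀ {p cnt rem h e k q D σ} a → Rep p cnt rem h e k q D σ → a < 2 ^ β → k * N + a < 2 ^ β → h + suc (length q) < 2 ^ β →
             ∃[ τ ] ∃[ τ′ ] Run (mem[ queueAt 6 ]≔ reg 8 ⊗ lit (+ N) ⊕ lit (+ a)) σ 1 τ × Run (reg[ 6 ]≔ reg 6 ⊕ lit 1ℤ) τ 1 τ′
             × Rep p cnt rem h e k (q ++ (k * N + a) ∷ []) D τ′
  push-run {h = h} {k = k} {q} {D} {σ} a R a< v< t< = τ , _
    , run-mem (bounded R) (queueAt 6) (reg 8 ⊗ lit (+ N) ⊕ lit (+ a)) (small-1 , _ , _) ((_ , N<) , a<) (≤ᵇ⇒≤ _ _ tt)
    , run-reg Bτ 6 (reg 6 ⊕ lit 1ℤ) (_ , small-1) (≤ᵇ⇒≤ _ _ tt)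
    , record
      { r0 = r0 R ; r1 = r1 R ; r2 = r2 R ; r3 = r3 R ; r4 = r4 R ; r5 = r5 R ; r7 = r7 R ; r8 = r8 R ; r9 = r9 R
      ; r6 = tail ; bounded = bounded-setReg 6 Bτ (small-≡ tail (subst (λ l → h + l < 2 ^ β) (sym len) t<))
      ; inputs = λ a → trans (memory-miss cell val σ (λ eq → case-impossible {h = h + length q} (trans eq cell≡))) (inputs R a)
      ; marks = λ j → trans (memory-miss cell val σ (λ eq → queue≢mark (h + length q) j (trans (sym cell≡) (sym eq)))) (marks R j)
      ; queued = subst₂ (λ c v → Holds (memory (setMem c v σ)) h (q ++ (k * N + a) ∷ [])) (sym cell≡) (sym val≡)
                   (Holds-push σ h q (k * N + a) (queued R)) }
    where
    cell = ⟦ queueAt 6 ⟧ σ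
    val  = ⟦ reg 8 ⊗ lit (+ N) ⊕ lit (+ a) ⟧ σ
    τ = setMem cell val σ
    cell≡ : cell ≡ queueCell (h + length q)
    cell≡ = queueAt-value 6 σ (r6 R)
    val≡ : val ≡ + (k * N + a)
    val≡ = trans (cong (λ x → x ℤ.* + N ℤ.+ + a) (r8 R)) (cong (λ x → x ℤ.+ + a) (sym (ℤₚ.pos-* k N)))
    Bτ : Bounded τ
    Bτ = bounded-setMem cell (bounded R) (small-≡ val≡ v<)
    len : length (q ++ (k * N + a) ∷ []) ≡ suc (length q)
    len = trans (length-++ q) (+-comm (length q) 1)
    tail : regs σ 6 ℤ.+ 1ℤ ≡ + (h + length (q ++ (k * N + a) ∷ []))
    tail = trans (cong (λ x → x ℤ.+ 1ℤ) (r6 R)) (cong +_ (trans (+-assoc h _ 1) (cong (λ l → h + l) (trans (+-comm (length q) 1) (sym len)))))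
    case-impossible : ∀ {a h} → + a ≢ queueCell h
    case-impossible ()

  pushes-run : ∀ as {p cnt rem h e k q D σ} → Rep p cnt rem h e k q D σ → All (_< 2 ^ β) as → All (λ a → k * N + a < 2 ^ β) as →
               h + length q + length as < 2 ^ β →
               ∃[ τ ] Run (pushes as) σ (4 * length as + 1) τ × Rep p cnt rem h e k (q ++ extend k as) D τ
  pushes-run [] {p} {cnt} {rem} {h} {e} {k} {q} {D} {σ} R _ _ _ = σ , run-skip , subst (λ q → Rep p cnt rem h e k q D σ) (sym (++-identityʳ q)) R
  pushes-run (a ∷ as) {p} {cnt} {rem} {h} {e} {k} {q} {D} {σ} R (a< ∷ as<) (v< ∷ vs<) t< =
    let τ , τ′ , run₁ , run₂ , R′ = push-run a R a< v< (≤-<-trans (≤-trans (≤-reflexive (+-suc h _)) (≤-trans (s≤s (m≤m+n _ (length as))) (≤-reflexive (sym (+-suc _ (length as)))))) t<)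
        τ″ , run₃ , R″ = pushes-run as R′ as< vs< (subst (_< 2 ^ β) (len h q) t<)
    in τ″ , weaken (≤-reflexive (steps (length as))) (run₁ ⟫ run₂ ⟫ run₃)
     , subst (λ q → Rep p cnt rem h e k q D τ″) (++-assoc q (k * N + a ∷ []) (extend k as)) R″
    where
    steps : ∀ l → suc (1 + suc (1 + (4 * l + 1))) ≡ 4 * (1 + l) + 1
    steps = solve-∀
    len : ∀ h q → h + length q + suc (length as) ≡ h + length (q ++ (k * N + a) ∷ []) + length as
    len h q = trans (+-suc (h + length q) (length as)) (cong (λ x → x + length as)
      (trans (sym (+-suc h (length q))) (cong (λ x → h + x) (trans (+-comm 1 (length q)) (sym (length-++ q))))))

  load-run : ∀ {p cnt rem h e k k₀ q D σ} → Rep p cnt rem h e k (k₀ ∷ q) D σ →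
             ∃[ τ ] Run (reg[ 8 ]≔ mem (queueAt 5)) σ 1 τ × Rep p cnt rem h e k₀ (k₀ ∷ q) D τ
  load-run {h = h} {σ = σ} R = _ , run-reg (bounded R) 8 (mem (queueAt 5)) (small-1 , _ , _) (≤ᵇ⇒≤ _ _ tt) , record
    { r0 = r0 R ; r1 = r1 R ; r2 = r2 R ; r3 = r3 R ; r4 = r4 R ; r5 = r5 R ; r6 = r6 R ; r7 = r7 R ; r9 = r9 R
    ; r8 = trans (cong (memory σ) (queueAt-value 5 σ (r5 R))) (proj₁ (queued R))
    ; bounded = bounded-setReg 8 (bounded R) (memory-small (bounded R) _)
    ; inputs = inputs R ; marks = marks R ; queued = queued R }

  tail-small : ∀ {p cnt rem h e k q D σ} → Rep p cnt rem h e k q D σ → h + length q < 2 ^ β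
  tail-small R = subst (λ x → ℤ.∣ x ∣ < 2 ^ β) (r6 R) (regs-small (bounded R) 6)

  pop-run : ∀ {p cnt rem h e k k₀ q D σ} → Rep p cnt rem h e k (k₀ ∷ q) D σ →
            ∃[ τ ] Run (reg[ 5 ]≔ reg 5 ⊕ lit 1ℤ) σ 1 τ × Rep p cnt rem (suc h) e k q D τ
  pop-run {h = h} {q = q} {σ = σ} R = _ , run-reg (bounded R) 5 (reg 5 ⊕ lit 1ℤ) (_ , small-1) (≤ᵇ⇒≤ _ _ tt) , record
    { r0 = r0 R ; r1 = r1 R ; r2 = r2 R ; r3 = r3 R ; r4 = r4 R ; r7 = r7 R ; r8 = r8 R ; r9 = r9 R
    ; r5 = head ; r6 = trans (r6 R) (cong +_ (+-suc h (length q)))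
    ; bounded = bounded-setReg 5 (bounded R) (small-≡ head (≤-<-trans (≤-trans (s≤s (m≤m+n h (length q))) (≤-reflexive (sym (+-suc h (length q))))) (tail-small R)))
    ; inputs = inputs R ; marks = marks R ; queued = proj₂ (queued R) }
    where
    head : regs σ 5 ℤ.+ 1ℤ ≡ + suc h
    head = trans (cong (λ x → x ℤ.+ 1ℤ) (r5 R)) (cong +_ (+-comm h 1))

  expandLevel : List ℕ → List ℕ → List ℕ
  expandLevel as = concatMap (λ k → extend k as)

  -- `ks` is the rest of the current level and `out` the part of the next level already pushed. The
  -- last bound reserves `L` queue cells for each key still to be expanded, and `K` bounds the keys
  -- of the level so that appending a digit stays below `K * N`.
  expand-loop : ∀ as ks {out p cnt rem h e k D σ K} → Rep p cnt rem h e k (ks ++ out) D σ → h + length ks ≡ e →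
                All (_< N) as → length as ≤ L → All (_< K) ks → K * N ≤ 2 ^ β → h + length (ks ++ out) + length ks * L < 2 ^ β →
                ∃[ τ ] ∃[ k′ ] Run (forQueue 7 (pushes as)) σ (length ks * (4 * L + 6) + 1) τ
                × Rep p cnt rem e e k′ (out ++ expandLevel as ks) D τ
  expand-loop as [] {out} {p} {cnt} {rem} {h} {e} {k} {D} {σ} R eq as< few ks< K≤ fits =
    σ , k , run-exit (bounded R) (_ , _) (≤ᵇ⇒≤ _ _ tt)
      (subst (λ x → ¬ (0ℤ ℤ.< x)) (sym (cong₂ ℤ._-_ (r7 R) (r5 R))) (0≮m-n (≤-reflexive (sym h≡e))))
    , subst₂ (λ h q → Rep p cnt rem h e k q D σ) h≡e (sym (++-identityʳ out)) R
    where
    h≡e : h ≡ e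
    h≡e = trans (sym (+-identityʳ h)) eq
  expand-loop as (k₀ ∷ ks) {out} {p} {cnt} {rem} {h} {e} {k} {D} {σ} {K} R eq as< few (k₀< ∷ ks<) K≤ fits =
    let τ₁ , run₁ , R₁ = load-run R
        τ₂ , run₂ , R₂ = pushes-run as R₁ (All.map (λ a< → <-trans a< N<) as<) (All.map key-small as<) (≤-<-trans (+-monoʳ-≤ (h + length (k₀ ∷ ks ++ out)) (≤-trans few (m≤m+n L _))) fits)
        τ₃ , run₃ , R₃ = pop-run R₂
        τ₄ , k′ , run₄ , R₄ = expand-loop as ks {out ++ extend k₀ as}
                                (subst (λ q → Rep p cnt rem (suc h) e k₀ q D τ₃) (++-assoc ks out (extend k₀ as)) R₃)
                                (trans (sym (+-suc h (length ks))) eq) as< few ks< K≤ fits′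
    in τ₄ , k′ , weaken steps (run-loop (bounded R) (_ , _) (≤ᵇ⇒≤ _ _ tt) positive (run₁ ⟫ run₂ ⟫ run₃) run₄)
     , subst (λ q → Rep p cnt rem e e k′ q D τ₄) (++-assoc out (extend k₀ as) (expandLevel as ks)) R₄
    where
    key-small : ∀ {a} → a < N → k₀ * N + a < 2 ^ β
    key-small {a} a< = begin-strict
      k₀ * N + a        <⟨ +-monoʳ-< (k₀ * N) a< ⟩
      k₀ * N + N        ≡⟨ +-comm (k₀ * N) N ⟩
      suc k₀ * N        ≤⟨ *-monoˡ-≤ N k₀< ⟩
      K * N             ≤⟨ K≤ ⟩
      2 ^ β             ∎
    positive : 0ℤ ℤ.< regs σ 7 ℤ.- regs σ 5
    positive = subst (0ℤ ℤ.<_) (sym (cong₂ ℤ._-_ (r7 R) (r5 R))) (0<m-n (subst (h <_) eq (m<m+n h z<s)))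
    steps : suc (suc (1 + suc (4 * length as + 1 + 1)) + (length ks * (4 * L + 6) + 1)) ≤ suc (length ks) * (4 * L + 6) + 1
    steps = begin
      suc (suc (1 + suc (4 * length as + 1 + 1)) + (length ks * (4 * L + 6) + 1))
        ≡⟨ e₁ (4 * length as) (length ks * (4 * L + 6)) ⟩
      4 * length as + 6 + length ks * (4 * L + 6) + 1
        ≤⟨ +-monoˡ-≤ 1 (+-monoˡ-≤ (length ks * (4 * L + 6)) (+-monoˡ-≤ 6 (*-monoʳ-≤ 4 few))) ⟩
      suc (length ks) * (4 * L + 6) + 1 ∎
      where
      e₁ : ∀ x y → 1 + ((1 + (1 + (1 + (x + 1 + 1)))) + (y + 1)) ≡ x + 6 + y + 1
      e₁ = solve-∀
    fits′ : suc h + length (ks ++ out ++ extend k₀ as) + length ks * L < 2 ^ β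
    fits′ = ≤-<-trans (begin
      suc h + length (ks ++ out ++ extend k₀ as) + length ks * L
        ≡⟨ cong (λ l → suc h + l + length ks * L) (trans (cong length (sym (++-assoc ks out (extend k₀ as))))
             (trans (length-++ (ks ++ out)) (cong (λ l → length (ks ++ out) + l) (length-map (λ a → k₀ * N + a) as)))) ⟩
      suc h + (length (ks ++ out) + length as) + length ks * L
        ≤⟨ +-monoˡ-≤ (length ks * L) (+-monoʳ-≤ (suc h) (+-monoʳ-≤ (length (ks ++ out)) few)) ⟩
      suc h + (length (ks ++ out) + L) + length ks * L
        ≡⟨ e₁ h (length (ks ++ out)) L (length ks * L) ⟩
      h + length (k₀ ∷ ks ++ out) + length (k₀ ∷ ks) * L ∎) fits
      where
      e₁ : ∀ h l L x → 1 + h + (l + L) + x ≡ h + (1 + l) + (L + x)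
      e₁ = solve-∀

  Performs : Cmd → (ℕ → Progress → Progress) → Set
  Performs cmd step = ∀ {p cnt rem h e k q D σ} → Rep p cnt rem h e k q D σ →
                      ∃[ τ ] Run cmd σ 2 τ × Rep p cnt rem h e k q (step k D) τ

  visit-loop : ∀ {cmd step} → Performs cmd step → ∀ q {p cnt rem h e k D σ} → Rep p cnt rem h e k q D σ →
               ∃[ τ ] ∃[ h′ ] ∃[ k′ ] Run (forQueue 6 cmd) σ (length q * 7 + 1) τ
               × Rep p cnt rem h′ e k′ [] (foldl (λ D k → step k D) D q) τ
  visit-loop performs [] {h = h} {k = k} {σ = σ} R = σ , h , k , run-exit (bounded R) (_ , _) (≤ᵇ⇒≤ _ _ tt)
      (subst (λ x → ¬ (0ℤ ℤ.< x)) (sym (cong₂ ℤ._-_ (r6 R) (r5 R))) (0≮m-n (≤-reflexive (+-identityʳ h)))) , R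
  visit-loop performs (k₀ ∷ q) {h = h} {σ = σ} R =
    let τ₁ , run₁ , R₁ = load-run R
        τ₂ , run₂ , R₂ = performs R₁
        τ₃ , run₃ , R₃ = pop-run R₂
        τ₄ , h′ , k′ , run₄ , R₄ = visit-loop performs q R₃
    in τ₄ , h′ , k′ , run-loop (bounded R) (_ , _) (≤ᵇ⇒≤ _ _ tt)
         (subst (0ℤ ℤ.<_) (sym (cong₂ ℤ._-_ (r6 R) (r5 R))) (0<m-n (m<m+n h z<s))) (run₁ ⟫ run₂ ⟫ run₃) run₄ , R₄

  mark-performs : Performs markKey setMark
  mark-performs {k = k} {q = q} {D = M , f} {σ = σ} R = _
    , weaken (s≤s z≤n) (run-mem (bounded R) (markAt 8) (lit 1ℤ) (small-2 , _ , _) small-1 (≤ᵇ⇒≤ _ _ tt))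
    , record
      { r0 = r0 R ; r1 = r1 R ; r2 = r2 R ; r3 = r3 R ; r4 = r4 R ; r5 = r5 R ; r6 = r6 R ; r7 = r7 R ; r8 = r8 R ; r9 = r9 R
      ; bounded = bounded-setMem cell (bounded R) small-1
      ; inputs = λ a → trans (memory-miss cell 1ℤ σ (λ eq → positive (trans eq cell≡))) (inputs R a)
      ; marks = marks′
      ; queued = Holds-resp _ q (λ i → memory-miss cell 1ℤ σ (λ eq → queue≢mark i k (trans eq cell≡))) (queued R) }
    where
    cell = ⟦ markAt 8 ⟧ σ
    cell≡ : cell ≡ markCell k
    cell≡ = markAt-value 8 σ (r8 R)
    positive : ∀ {a} → + a ≢ markCell k
    positive ()
    marks′ : ∀ j → memory (setMem cell 1ℤ σ) (markCell j) ≡ + 𝟙 ((j ≡ᵇ k) ∨ M j)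
    marks′ j with j ≡ᵇ k in eq
    ... | true  = memory-hit cell 1ℤ σ (trans (cong markCell (≡ᵇ⇒≡ j k (subst T (sym eq) tt))) (sym cell≡))
    ... | false = trans (memory-miss cell 1ℤ σ (λ eq′ → subst T eq (≡⇒≡ᵇ j k (markCell-injective (trans eq′ cell≡))))) (marks R j)

  test-performs : Performs testKey test
  test-performs {k = k} {D = M , f} {σ = σ} R with M k | trans (cong (memory σ) (markAt-value 8 σ (r8 R))) (marks R k)
  ... | true  | eq = _ , run-then (bounded R) (small-2 , _ , _) (≤ᵇ⇒≤ _ _ tt) (subst (0ℤ ℤ.<_) (sym eq) (ℤ.+<+ z<s))
                           (run-reg (bounded R) 9 (lit 1ℤ) small-1 (≤ᵇ⇒≤ _ _ tt))
    , record
      { r0 = r0 R ; r1 = r1 R ; r2 = r2 R ; r3 = r3 R ; r4 = r4 R ; r5 = r5 R ; r6 = r6 R ; r7 = r7 R ; r8 = r8 R ; r9 = refl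
      ; bounded = bounded-setReg 9 (bounded R) small-1 ; inputs = inputs R ; marks = marks R ; queued = queued R }
  ... | false | eq = σ , run-else (bounded R) (small-2 , _ , _) (≤ᵇ⇒≤ _ _ tt) (subst (λ x → ¬ (0ℤ ℤ.< x)) (sym eq) λ { (ℤ.+<+ ()) }) run-skip
    , record
      { r0 = r0 R ; r1 = r1 R ; r2 = r2 R ; r3 = r3 R ; r4 = r4 R ; r5 = r5 R ; r6 = r6 R ; r7 = r7 R ; r8 = r8 R ; r9 = r9 R
      ; bounded = bounded R ; inputs = inputs R ; marks = marks R ; queued = queued R }

  bitAt : (r p i : ℕ) → Bool
  bitAt r p i = (i <ᵇ r) ∧ inp (p + i)

  readBlock : ∀ m (i r p : ℕ) → Vec Bool m
  readBlock zero    i r p = []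
  readBlock (suc m) i r p = bitAt r p i ∷ readBlock m (suc i) r p

  bit-test : ∀ r i c → ((i <ᵇ r) ∧ c ≡ true → 0ℤ ℤ.< (+ r ℤ.- + i) ℤ.* + 𝟙 c)
                     × ((i <ᵇ r) ∧ c ≡ false → ¬ (0ℤ ℤ.< (+ r ℤ.- + i) ℤ.* + 𝟙 c))
  bit-test r i false rewrite ℤₚ.*-zeroʳ (+ r ℤ.- + i) = (λ eq → contradiction (trans (sym eq) (∧-zeroʳ (i <ᵇ r))) λ ()) , λ _ → λ { (ℤ.+<+ ()) }
  bit-test r i true rewrite ℤₚ.*-identityʳ (+ r ℤ.- + i) with i <ᵇ r in eq
  ... | true  = (λ _ → 0<m-n {r} {i} (<ᵇ⇒< i r (subst T (sym eq) tt))) , λ ()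
  ... | false = (λ ()) , λ _ → 0≮m-n {r} {i} (≮⇒≥ λ lt → subst T eq (<⇒<ᵇ lt))

  -- The tests leave the store unchanged, so only the leaf that belongs to the actual block is run;
  -- `f` is the continuation that has collected the bits read so far.
  caseBits-run : ∀ m i f {p cnt r h e k q D σ τ s} → i + m ≡ b → Rep p cnt (+ r) h e k q D σ →
                 Run (f (readBlock m i r p)) σ s τ → Run (caseBits m i f) σ (m + s) τ
  caseBits-run zero    i f eq R f-run = f-run
  caseBits-run (suc m) i f {p} {cnt} {r} {σ = σ} {τ} {s} eq R f-run = decide (bitAt r p i) refl
    where
    i< : i < 2 ^ β
    i< = ≤-<-trans (subst (i ≤_) eq (m≤m+n i (suc m))) b<
    value : ⟦ (reg 4 ⊖ lit (+ i)) ⊗ mem (reg 2 ⊕ lit (+ i)) ⟧ σ ≡ (+ r ℤ.- + i) ℤ.* + 𝟙 (inp (p + i))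
    value = cong₂ ℤ._*_ (cong (λ x → x ℤ.- + i) (r4 R)) (trans (cong (λ x → memory σ (x ℤ.+ + i)) (r2 R)) (inputs R (p + i)))
    rest : ∀ c → bitAt r p i ≡ c → Run (caseBits m (suc i) (λ x → f (c ∷ x))) σ (m + s) τ
    rest c eq′ = caseBits-run m (suc i) (λ x → f (c ∷ x)) (trans (sym (+-suc i m)) eq) R
      (subst (λ c → Run (f (c ∷ readBlock m (suc i) r p)) σ s τ) eq′ f-run)
    decide : ∀ c → bitAt r p i ≡ c → Run (caseBits (suc m) i f) σ (suc m + s) τ
    decide true  eq′ = run-then (bounded R) ((_ , i<) , (_ , i<)) (≤ᵇ⇒≤ _ _ tt)
      (subst (0ℤ ℤ.<_) (sym value) (proj₁ (bit-test r i (inp (p + i))) eq′)) (rest true eq′)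
    decide false eq′ = run-else (bounded R) ((_ , i<) , (_ , i<)) (≤ᵇ⇒≤ _ _ tt)
      (subst (λ x → ¬ (0ℤ ℤ.< x)) (sym value) (proj₂ (bit-test r i (inp (p + i))) eq′)) (rest false eq′)

  -- The first argument only makes the recursion structural. Since `b` is positive, the remaining
  -- length drops with every block, and `d` is enough.
  blocks : ℕ → ℤ → ℕ → List (Vec Bool b)
  blocks (suc fuel) (+ suc r) p = readBlock b 0 (suc r) p ∷ blocks fuel (+ suc r ℤ.- + b) (p + b)
  blocks (suc fuel) (+ zero)  p = []
  blocks (suc fuel) -[1+ r ]  p = []
  blocks zero       z         p = []

  blockCount : ℕ
  blockCount = length (blocks d (+ d) 0)

  expand : (Vec Bool b → List ℕ) → List (Vec Bool b) → List ℕ → List ℕ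
  expand A []       q = q
  expand A (x ∷ xs) q = expand A xs (expandLevel (A x) q)

  length-expandLevel : ∀ as q → length (expandLevel as q) ≡ length q * length as
  length-expandLevel as []      = refl
  length-expandLevel as (k ∷ q) = trans (length-++ (extend k as)) (cong₂ _+_ (length-map _ as) (length-expandLevel as q))

  expandLevel-bounded : ∀ {as q K} → All (_< N) as → All (_< K) q → All (_< K * N) (expandLevel as q)
  expandLevel-bounded as< [] = []
  expandLevel-bounded {as} {k ∷ q} {K} as< (k< ∷ q<) = Allₚ.++⁺
    (Allₚ.map⁺ (All.map (λ a< → <-≤-trans (+-monoʳ-< (k * N) a<) (≤-trans (≤-reflexive (+-comm (k * N) N)) (*-monoˡ-≤ N k<))) as<))
    (expandLevel-bounded as< q<)

  small-- : ∀ {m n} → m < 2 ^ β → n < 2 ^ β → Small (+ m ℤ.- + n)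
  small-- {m} {n} m< n< rewrite ℤₚ.m-n≡m⊖n m n = ≤-<-trans (ℤₚ.∣m⊝n∣≤m⊔n m n) (⊔-pres-<m m< n<)

  record Marked (A : Vec Bool b → List ℕ) : Set where
    field
      range : ∀ x → All (_< N) (A x)
      few   : ∀ x → length (A x) ≤ L

  module Enumeration (A : Vec Bool b → List ℕ) (marked : Marked A) where
    open Marked marked

    block-run : ∀ {p cnt r h e k q D σ K} → Rep p cnt (+ suc r) h e k q D σ → All (_< K) q → K * N ≤ 2 ^ β →
                h + length q + length q * L < 2 ^ β → p + b < 2 ^ β →
                ∃[ τ ] ∃[ e′ ] ∃[ k′ ] Run (block A) σ (length q * (4 * L + 6) + (b + 7)) τ
                × Rep (p + b) cnt (+ suc r ℤ.- + b) (h + length q) e′ k′ (expandLevel (A (readBlock b 0 (suc r) p)) q) D τ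
    block-run {p} {cnt} {r} {h} {e} {k} {q} {D} {σ} {K} R q< K≤ fits p< =
      let τ₂ , k′ , run₂ , R₂ = expand-loop (A x) q {out = []} R₁ refl (range x) (few x) q< K≤
                                  (subst (λ l → h + length l + length q * L < 2 ^ β) (sym (++-identityʳ q)) fits)
          r2′ : regs τ₂ 2 ℤ.+ + b ≡ + (p + b)
          r2′ = cong (λ x → x ℤ.+ + b) (r2 R₂)
          r4′ : regs τ₂ 4 ℤ.- + b ≡ + suc r ℤ.- + b
          r4′ = cong (λ x → x ℤ.- + b) (r4 R₂)
          B₃ = bounded-setReg 2 (bounded R₂) (small-≡ r2′ p<)
          r<  = subst (λ x → ℤ.∣ x ∣ < 2 ^ β) (r4 R) (regs-small (bounded R) 4)
      in _ , e₁ , k′ , weaken (≤-reflexive (steps b (length q * (4 * L + 6))))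
           (run₁ ⟫ caseBits-run b 0 (λ x → forQueue 7 (pushes (A x))) refl R₁ run₂
             ⟫ run-reg (bounded R₂) 2 (reg 2 ⊕ lit (+ b)) (_ , b<) (≤ᵇ⇒≤ _ _ tt)
             ⟫ run-reg B₃ 4 (reg 4 ⊖ lit (+ b)) (_ , b<) (≤ᵇ⇒≤ _ _ tt))
       , record
         { r0 = r0 R₂ ; r1 = r1 R₂ ; r2 = r2′ ; r3 = r3 R₂ ; r4 = r4′ ; r5 = r5 R₂ ; r6 = r6 R₂ ; r7 = r7 R₂ ; r8 = r8 R₂ ; r9 = r9 R₂
         ; bounded = bounded-setReg 4 B₃ (subst Small (sym r4′) (small-- r< b<))
         ; inputs = inputs R₂ ; marks = marks R₂ ; queued = queued R₂ }
      where
      x = readBlock b 0 (suc r) p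
      e₁ = h + length q
      run₁ : Run (reg[ 7 ]≔ reg 6) σ 1 (setReg 7 (regs σ 6) σ)
      run₁ = run-reg (bounded R) 7 (reg 6) _ (≤ᵇ⇒≤ _ _ tt)
      R₁ : Rep p cnt (+ suc r) h e₁ k (q ++ []) D (setReg 7 (regs σ 6) σ)
      R₁ = subst (λ q → Rep p cnt (+ suc r) h e₁ k q D (setReg 7 (regs σ 6) σ)) (sym (++-identityʳ q)) (record
        { r0 = r0 R ; r1 = r1 R ; r2 = r2 R ; r3 = r3 R ; r4 = r4 R ; r5 = r5 R ; r6 = r6 R ; r7 = r6 R ; r8 = r8 R ; r9 = r9 R
        ; bounded = bounded-setReg 7 (bounded R) (regs-small (bounded R) 6)
        ; inputs = inputs R ; marks = marks R ; queued = queued R })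
      steps : ∀ b x → suc (1 + suc (b + (x + 1) + suc (1 + 1))) ≡ x + (b + 7)
      steps = solve-∀

    -- The bounds look ahead over all `m` remaining levels: each level multiplies the range of the
    -- keys by `N` and the tail of the queue by at most `suc L`, and none that is expanded has more
    -- than `E` keys. The sum of address and remaining length is invariant, which undoes the
    -- overshoot later.
    blocks-run : ∀ fuel z {p cnt h e k q D σ K E} → z ℤ.≤ + fuel → Rep p cnt z h e k q D σ →
                 let m = length (blocks fuel z p) in
                 All (_< K) q → K * N ^ m ≤ 2 ^ β → (h + length q) * suc L ^ m < 2 ^ β → p + m * b < 2 ^ β → length q * L ^ m ≤ E →
                 ∃[ τ ] ∃[ p′ ] ∃[ z′ ] ∃[ h′ ] ∃[ e′ ] ∃[ k′ ] Run (while reg 4 loop block A) σ (m * (E * (4 * L + 6) + (b + 9)) + 1) τ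
                 × Rep p′ cnt z′ h′ e′ k′ (expand A (blocks fuel z p) q) D τ × + p′ ℤ.+ z′ ≡ + p ℤ.+ z
    blocks-run zero (+ zero) z≤ R q< K≤ fits p< E≤ =
      _ , _ , _ , _ , _ , _ , run-exit (bounded R) _ (≤ᵇ⇒≤ _ _ tt) (subst (λ x → ¬ (0ℤ ℤ.< x)) (sym (r4 R)) λ { (ℤ.+<+ ()) }) , R , refl
    blocks-run zero (+ suc r) (ℤ.+≤+ ()) R q< K≤ fits p< E≤
    blocks-run zero -[1+ r ] z≤ R q< K≤ fits p< E≤ =
      _ , _ , _ , _ , _ , _ , run-exit (bounded R) _ (≤ᵇ⇒≤ _ _ tt) (subst (λ x → ¬ (0ℤ ℤ.< x)) (sym (r4 R)) λ ()) , R , refl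
    blocks-run (suc fuel) (+ zero) z≤ R q< K≤ fits p< E≤ =
      _ , _ , _ , _ , _ , _ , run-exit (bounded R) _ (≤ᵇ⇒≤ _ _ tt) (subst (λ x → ¬ (0ℤ ℤ.< x)) (sym (r4 R)) λ { (ℤ.+<+ ()) }) , R , refl
    blocks-run (suc fuel) -[1+ r ] z≤ R q< K≤ fits p< E≤ =
      _ , _ , _ , _ , _ , _ , run-exit (bounded R) _ (≤ᵇ⇒≤ _ _ tt) (subst (λ x → ¬ (0ℤ ℤ.< x)) (sym (r4 R)) λ ()) , R , refl
    blocks-run (suc fuel) (+ suc r) {p} {cnt} {h} {e} {k} {q} {D} {σ} {K} {E} (ℤ.+≤+ (s≤s r≤)) R q< K≤ fits p< E≤ =
      let τ₁ , e₁ , k₁ , run₁ , R₁ = block-run R q< K≤′ (≤-<-trans level fits₁) p<′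
          τ₂ , p₂ , z₂ , h₂ , e₂ , k₂ , run₂ , R₂ , eq = blocks-run fuel z′ {E = E} z′≤ R₁ (expandLevel-bounded (range x) q<)
             (subst (_≤ 2 ^ β) (sym (*-assoc K N (N ^ m))) K≤)
             fits′ (subst (_< 2 ^ β) (sym (+-assoc p b (m * b))) p<) E≤′
      in τ₂ , p₂ , z₂ , h₂ , e₂ , k₂
       , weaken (steps (length q * (4 * L + 6)) (E * (4 * L + 6)) (m * (E * (4 * L + 6) + (b + 9))) b (*-monoˡ-≤ (4 * L + 6) q≤E))
           (run-loop (bounded R) _ (≤ᵇ⇒≤ _ _ tt) (subst (0ℤ ℤ.<_) (sym (r4 R)) (ℤ.+<+ z<s)) run₁ run₂)
       , R₂ , trans eq position
      where
      x = readBlock b 0 (suc r) p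
      z′ = + suc r ℤ.- + b
      m = length (blocks fuel z′ (p + b))
      instance
        Lm≢0 : NonZero (L ^ m)
        Lm≢0 = m^n≢0 L m {{>-nonZero L>0}}
      K≤′ : K * N ≤ 2 ^ β
      K≤′ = ≤-trans (*-monoʳ-≤ K (m≤m*n N (N ^ m) {{m^n≢0 N m {{>-nonZero N>0}}}})) K≤
      level : h + length q + length q * L ≤ (h + length q) * suc L
      level = begin
        h + length q + length q * L             ≤⟨ +-monoʳ-≤ (h + length q) (*-monoˡ-≤ L (m≤n+m (length q) h)) ⟩
        h + length q + (h + length q) * L       ≡⟨ *-suc (h + length q) L ⟨
        (h + length q) * suc L                  ∎
      fits₁ : (h + length q) * suc L < 2 ^ β
      fits₁ = ≤-<-trans (*-monoʳ-≤ (h + length q) (m≤m*n (suc L) (suc L ^ m) {{m^n≢0 (suc L) m}})) fits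
      fits′ : (h + length q + length (expandLevel (A x) q)) * suc L ^ m < 2 ^ β
      fits′ = ≤-<-trans (begin
        (h + length q + length (expandLevel (A x) q)) * suc L ^ m
          ≡⟨ cong (λ l → (h + length q + l) * suc L ^ m) (length-expandLevel (A x) q) ⟩
        (h + length q + length q * length (A x)) * suc L ^ m
          ≤⟨ *-monoˡ-≤ (suc L ^ m) (+-monoʳ-≤ (h + length q) (*-monoʳ-≤ (length q) (few x))) ⟩
        (h + length q + length q * L) * suc L ^ m
          ≤⟨ *-monoˡ-≤ (suc L ^ m) level ⟩
        (h + length q) * suc L * suc L ^ m
          ≡⟨ *-assoc (h + length q) (suc L) _ ⟩
        (h + length q) * (suc L * suc L ^ m) ∎) fits
      p<′ : p + b < 2 ^ β
      p<′ = ≤-<-trans (+-monoʳ-≤ p (m≤m+n b (m * b))) p<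
      E≤′ : length (expandLevel (A x) q) * L ^ m ≤ E
      E≤′ = begin
        length (expandLevel (A x) q) * L ^ m    ≡⟨ cong (_* L ^ m) (length-expandLevel (A x) q) ⟩
        length q * length (A x) * L ^ m         ≤⟨ *-monoˡ-≤ (L ^ m) (*-monoʳ-≤ (length q) (few x)) ⟩
        length q * L * L ^ m                    ≡⟨ *-assoc (length q) L _ ⟩
        length q * (L * L ^ m)                  ≤⟨ E≤ ⟩
        E                                       ∎
      q≤E : length q ≤ E
      q≤E = ≤-trans (m≤m*n (length q) (L * L ^ m) {{m*n≢0 L (L ^ m) {{>-nonZero L>0}}}}) E≤
      z′≤ : z′ ℤ.≤ + fuel
      z′≤ = ℤₚ.≤-trans (decrease b b>0) (ℤ.+≤+ r≤)
        where
        decrease : ∀ c → 0 < c → + suc r ℤ.- + c ℤ.≤ + r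
        decrease (suc c) _ = subst (ℤ._≤ + r) (sym (ℤₚ.[1+m]⊖[1+n]≡m⊖n r c)) (ℤₚ.m⊖n≤m r c)
      position : + (p + b) ℤ.+ z′ ≡ + p ℤ.+ + suc r
      position = trans (ℤₚ.+-assoc (+ p) (+ b) z′) (cong (λ x → + p ℤ.+ x)
        (trans (ℤₚ.+-comm (+ b) z′) (trans (ℤₚ.+-assoc (+ suc r) (ℤ.- + b) (+ b)) (trans (cong (λ x → + suc r ℤ.+ x) (ℤₚ.+-inverseˡ (+ b))) (ℤₚ.+-identityʳ (+ suc r))))))
      steps : ∀ x y w b → x ≤ y → suc (x + (b + 7) + (w + 1)) ≤ (y + (b + 9)) + w + 1
      steps x y w b x≤y = begin
        suc (x + (b + 7) + (w + 1))      ≤⟨ +-monoʳ-≤ 1 (+-monoˡ-≤ (w + 1) (+-monoˡ-≤ (b + 7) x≤y)) ⟩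
        suc (y + (b + 7) + (w + 1))      ≤⟨ n≤1+n _ ⟩
        suc (suc (y + (b + 7) + (w + 1)))  ≡⟨ e₁ y b w ⟩
        (y + (b + 9)) + w + 1            ∎
        where
        e₁ : ∀ y b w → 2 + (y + (b + 7) + (w + 1)) ≡ (y + (b + 9)) + w + 1
        e₁ = solve-∀

    keysAt : ℕ → List ℕ
    keysAt p = expand A (blocks d (+ d) p) (0 ∷ [])

    phaseData : (ℕ → Progress → Progress) → ℕ → ℕ → Progress → Progress
    phaseData step zero      p D = D
    phaseData step (suc cnt) p D = phaseData step cnt (p + d) (foldl (λ D k → step k D) D (keysAt p))

    length-blocks : ∀ fuel z p p′ → length (blocks fuel z p) ≡ length (blocks fuel z p′)
    length-blocks zero       z         p p′ = refl
    length-blocks (suc fuel) (+ zero)  p p′ = refl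
    length-blocks (suc fuel) (+ suc r) p p′ = cong suc (length-blocks fuel (+ suc r ℤ.- + b) (p + b) (p′ + b))
    length-blocks (suc fuel) -[1+ r ]  p p′ = refl

    length-expand : ∀ xs q → length (expand A xs q) ≤ length q * L ^ length xs
    length-expand []       q = ≤-reflexive (sym (*-identityʳ (length q)))
    length-expand (x ∷ xs) q = begin
      length (expand A xs (expandLevel (A x) q))           ≤⟨ length-expand xs (expandLevel (A x) q) ⟩
      length (expandLevel (A x) q) * L ^ length xs         ≡⟨ cong (_* L ^ length xs) (length-expandLevel (A x) q) ⟩
      length q * length (A x) * L ^ length xs              ≤⟨ *-monoˡ-≤ (L ^ length xs) (*-monoʳ-≤ (length q) (few x)) ⟩
      length q * L * L ^ length xs                         ≡⟨ *-assoc (length q) L _ ⟩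
      length q * (L * L ^ length xs)                       ∎

    module Phases (keys-fit : N ^ blockCount ≤ 2 ^ β) (tail-fits : suc L ^ blockCount < 2 ^ β)
                  (P : ℕ) (P-fits : P + blockCount * b < 2 ^ β) (P< : P < 2 ^ β) where

      private
        m : ℕ
        m = blockCount

      enumerate-steps vector-steps : ℕ
      enumerate-steps = m * (L ^ m * (4 * L + 6) + (b + 9)) + 11
      vector-steps = enumerate-steps + L ^ m * 7 + 5

      enumerate-run : ∀ {p cnt rem h e k q D σ} → Rep p cnt rem h e k q D σ → p + d ≤ P →
                      ∃[ τ ] ∃[ rem′ ] ∃[ h′ ] ∃[ e′ ] ∃[ k′ ] Run (enumerate A) σ enumerate-steps τ
                      × Rep (p + d) cnt rem′ h′ e′ k′ (keysAt p) D τ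
      enumerate-run {p} {cnt} {rem} {h} {e} {k} {q} {D} {σ} R p≤ =
        let τ , p′ , z′ , h′ , e′ , k′ , looped , R′ , eq = blocks-run d (+ d) {K = 1} {E = L ^ m} ℤₚ.≤-refl R₄ (z<s ∷ [])
              (subst (λ m → 1 * N ^ m ≤ 2 ^ β) m≡ (subst (_≤ 2 ^ β) (sym (*-identityˡ _)) keys-fit))
              (subst (λ m → 1 * suc L ^ m < 2 ^ β) m≡ (subst (_< 2 ^ β) (sym (*-identityˡ _)) tail-fits))
              (subst (λ m → p + m * b < 2 ^ β) m≡ (≤-<-trans (+-monoˡ-≤ (m * b) (≤-trans (m≤m+n p d) p≤)) P-fits))
              (subst (λ m → 1 * L ^ m ≤ L ^ blockCount) m≡ (≤-reflexive (*-identityˡ _)))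
            r2′ : regs τ 2 ℤ.+ regs τ 4 ≡ + (p + d)
            r2′ = trans (cong₂ ℤ._+_ (r2 R′) (r4 R′)) eq
        in _ , z′ , h′ , e′ , k′
         , weaken (≤-reflexive (trans (steps _) (cong (λ m′ → m′ * (L ^ m * (4 * L + 6) + (b + 9)) + 11) (sym m≡))))
             (run-reg (bounded R) 5 (lit 0ℤ) small-0 (≤ᵇ⇒≤ _ _ tt)
             ⟫ run-reg B₁ 6 (lit 1ℤ) small-1 (≤ᵇ⇒≤ _ _ tt)
             ⟫ run-mem B₂ (lit -[1+ 0 ]) (lit 0ℤ) small-1 small-0 (≤ᵇ⇒≤ _ _ tt)
             ⟫ run-reg B₃ 4 (reg 1) _ (≤ᵇ⇒≤ _ _ tt)
             ⟫ looped
             ⟫ run-reg (bounded R′) 2 (reg 2 ⊕ reg 4) _ (≤ᵇ⇒≤ _ _ tt))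
         , record
           { r0 = r0 R′ ; r1 = r1 R′ ; r2 = r2′ ; r3 = r3 R′ ; r4 = r4 R′ ; r5 = r5 R′ ; r6 = r6 R′ ; r7 = r7 R′ ; r8 = r8 R′ ; r9 = r9 R′
           ; bounded = bounded-setReg 2 (bounded R′) (small-≡ r2′ (≤-<-trans p≤ P<))
           ; inputs = inputs R′ ; marks = marks R′ ; queued = queued R′ }
        where
        m≡ : m ≡ length (blocks d (+ d) p)
        m≡ = length-blocks d (+ d) 0 p
        σ₂ = setReg 6 1ℤ (setReg 5 0ℤ σ)
        σ₃ = setMem -[1+ 0 ] 0ℤ σ₂
        σ₄ = setReg 4 (regs σ 1) σ₃
        B₁ = bounded-setReg 5 (bounded R) small-0
        B₂ = bounded-setReg 6 B₁ small-1
        B₃ = bounded-setMem -[1+ 0 ] B₂ small-0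
        R₄ : Rep p cnt (+ d) 0 e k (0 ∷ []) D σ₄
        R₄ = record
          { r0 = r0 R ; r1 = r1 R ; r2 = r2 R ; r3 = r3 R ; r4 = r1 R ; r5 = refl ; r6 = refl ; r7 = r7 R ; r8 = r8 R ; r9 = r9 R
          ; bounded = bounded-setReg 4 B₃ (regs-small (bounded R) 1)
          ; inputs = λ a → trans (memory-miss -[1+ 0 ] 0ℤ σ₂ (λ ())) (inputs R a)
          ; marks = λ k → trans (memory-miss -[1+ 0 ] 0ℤ σ₂ (λ eq → queue≢mark 0 k (sym eq))) (marks R k)
          ; queued = memory-hit -[1+ 0 ] 0ℤ σ₂ refl , tt }
        steps : ∀ x → suc (1 + suc (1 + suc (1 + suc (1 + suc (x + 1 + 1))))) ≡ x + 11
        steps = solve-∀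

      module _ {cmd step} (performs : Performs cmd step) where

        vectors-run : ∀ cnt {p rem h e k q D σ} → Rep p cnt rem h e k q D σ → p + cnt * d ≤ P →
                      ∃[ τ ] ∃[ rem′ ] ∃[ h′ ] ∃[ e′ ] ∃[ k′ ] ∃[ q′ ]
                      Run (while reg 3 loop (enumerate A ⨾ forQueue 6 cmd ⨾ (reg[ 3 ]≔ reg 3 ⊖ lit 1ℤ))) σ (cnt * vector-steps + 1) τ
                      × Rep (p + cnt * d) 0 rem′ h′ e′ k′ q′ (phaseData step cnt p D) τ
        vectors-run zero {p} {D = D} R p≤ =
          _ , _ , _ , _ , _ , _ , run-exit (bounded R) _ (≤ᵇ⇒≤ _ _ tt) (subst (λ x → ¬ (0ℤ ℤ.< x)) (sym (r3 R)) λ { (ℤ.+<+ ()) })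
          , subst (λ p → Rep p 0 _ _ _ _ _ D _) (sym (+-identityʳ p)) R
        vectors-run (suc cnt) {p} {D = D} R p≤ =
          let τ₁ , rem₁ , h₁ , e₁ , k₁ , run₁ , R₁ = enumerate-run R (≤-trans (+-monoʳ-≤ p (m≤m+n d (cnt * d))) p≤)
              τ₂ , h₂ , k₂ , run₂ , R₂ = visit-loop performs (keysAt p) R₁
              r3′ : regs τ₂ 3 ℤ.- 1ℤ ≡ + cnt
              r3′ = cong (λ x → x ℤ.- 1ℤ) (r3 R₂)
              R₃ = record
                { r0 = r0 R₂ ; r1 = r1 R₂ ; r2 = r2 R₂ ; r3 = r3′ ; r4 = r4 R₂ ; r5 = r5 R₂ ; r6 = r6 R₂ ; r7 = r7 R₂ ; r8 = r8 R₂ ; r9 = r9 R₂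
                ; bounded = bounded-setReg 3 (bounded R₂) (small-≡ r3′ (<-trans (n<1+n cnt) (subst (λ x → ℤ.∣ x ∣ < 2 ^ β) (r3 R₂) (regs-small (bounded R₂) 3))))
                ; inputs = inputs R₂ ; marks = marks R₂ ; queued = queued R₂ }
              τ₄ , rem₄ , h₄ , e₄ , k₄ , q₄ , run₄ , R₄ = vectors-run cnt R₃ (subst (_≤ P) (sym (+-assoc p d (cnt * d))) p≤)
          in τ₄ , rem₄ , h₄ , e₄ , k₄ , q₄
           , weaken (steps (length (keysAt p)) (cnt * vector-steps) (≤-trans (length-expand (blocks d (+ d) p) (0 ∷ []))
                       (≤-reflexive (trans (*-identityˡ _) (cong (L ^_) (length-blocks d (+ d) p 0))))))
               (run-loop (bounded R) _ (≤ᵇ⇒≤ _ _ tt) (subst (0ℤ ℤ.<_) (sym (r3 R)) (ℤ.+<+ z<s))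
                 (run₁ ⟫ run₂ ⟫ run-reg (bounded R₂) 3 (reg 3 ⊖ lit 1ℤ) (_ , small-1) (≤ᵇ⇒≤ _ _ tt)) run₄)
           , subst (λ p′ → Rep p′ 0 rem₄ h₄ e₄ k₄ q₄ (phaseData step (suc cnt) p D) τ₄) (+-assoc p d (cnt * d)) R₄
          where
          steps : ∀ l w → l ≤ L ^ m → suc (suc (enumerate-steps + suc (l * 7 + 1 + 1)) + (w + 1)) ≤ vector-steps + w + 1
          steps l w l≤ = begin
            suc (suc (enumerate-steps + suc (l * 7 + 1 + 1)) + (w + 1))        ≡⟨ e₁ enumerate-steps (l * 7) w ⟩
            enumerate-steps + l * 7 + 5 + w + 1                                ≤⟨ +-monoˡ-≤ 1 (+-monoˡ-≤ w (+-monoˡ-≤ 5 (+-monoʳ-≤ enumerate-steps (*-monoˡ-≤ 7 l≤)))) ⟩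
            vector-steps + w + 1                                               ∎
            where
            e₁ : ∀ s l w → 1 + ((1 + (s + (1 + (l + 1 + 1)))) + (w + 1)) ≡ s + l + 5 + w + 1
            e₁ = solve-∀

        phase-run : ∀ {p cnt rem h e k q D σ} → Rep p cnt rem h e k q D σ → p + n * d ≤ P →
                    ∃[ τ ] ∃[ rem′ ] ∃[ h′ ] ∃[ e′ ] ∃[ k′ ] ∃[ q′ ] Run (phase A cmd) σ (n * vector-steps + 3) τ
                    × Rep (p + n * d) 0 rem′ h′ e′ k′ q′ (phaseData step n p D) τ
        phase-run {p} {cnt} {rem} {h} {e} {k} {q} {D} {σ} R p≤ =
          let τ , rem′ , h′ , e′ , k′ , q′ , run₂ , R′ = vectors-run n R₁ p≤
          in τ , rem′ , h′ , e′ , k′ , q′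
           , weaken (≤-reflexive (steps (n * vector-steps))) (run-reg (bounded R) 3 (reg 0) _ (≤ᵇ⇒≤ _ _ tt) ⟫ run₂) , R′
          where
          R₁ : Rep p n rem h e k q D (setReg 3 (regs σ 0) σ)
          R₁ = record
            { r0 = r0 R ; r1 = r1 R ; r2 = r2 R ; r3 = r0 R ; r4 = r4 R ; r5 = r5 R ; r6 = r6 R ; r7 = r7 R ; r8 = r8 R ; r9 = r9 R
            ; bounded = bounded-setReg 3 (bounded R) (regs-small (bounded R) 0)
            ; inputs = inputs R ; marks = marks R ; queued = queued R }
          steps : ∀ x → suc (1 + (x + 1)) ≡ x + 3
          steps = solve-∀

-- Correctness

digits-unique : ∀ N .{{_ : NonZero N}} k k′ {a a′} → a < N → a′ < N → k * N + a ≡ k′ * N + a′ → k ≡ k′ × a ≡ a′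
digits-unique N k k′ {a} {a′} a< a′< eq = *-cancelʳ-≡ k k′ N (+-cancelʳ-≡ a (k * N) (k′ * N) (trans eq (cong (λ x → k′ * N + x) (sym a≡)))) , a≡
  where
  last-digit : ∀ k a → a < N → (k * N + a) % N ≡ a
  last-digit k a a< = trans (cong (_% N) (+-comm (k * N) a)) (trans ([m+kn]%n≡m%n a k N) (m<n⇒m%n≡m a<))
  a≡ : a ≡ a′
  a≡ = trans (sym (last-digit k a a<)) (trans (cong (_% N) eq) (last-digit k′ a′ a′<))

+-<-minus : ∀ j s c → c + j < s → + j ℤ.< + s ℤ.- + c
+-<-minus j s c lt rewrite ℤₚ.m-n≡m⊖n s c | ℤₚ.⊖-≥ {s} {c} (≤-trans (m≤m+n c j) (<⇒≤ lt)) =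
  ℤ.+<+ (subst (_< s ∸ c) (m+n∸m≡n c j) (∸-monoˡ-< lt (m≤m+n c j)))

+-<-minus⁻ : ∀ j s c → + j ℤ.< + s ℤ.- + c → c + j < s
+-<-minus⁻ j s c lt with c ≤? s
... | yes c≤s rewrite ℤₚ.m-n≡m⊖n s c | ℤₚ.⊖-≥ {s} {c} c≤s =
  subst (c + j <_) (m+[n∸m]≡n c≤s) (+-monoʳ-< c (ℤₚ.drop‿+<+ lt))
... | no  c≰s rewrite ℤₚ.m-n≡m⊖n s c | ℤₚ.⊖-≤ (<⇒≤ (≰⇒> c≰s)) =
  contradiction (ℤₚ.<-≤-trans lt (ℤₚ.neg-≤-pos {c ∸ s} {0})) λ { (ℤ.+<+ ()) }

remaining-≤ : ∀ {c r s} → 0 < c → r ≤ s → + suc r ℤ.- + c ℤ.≤ + s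
remaining-≤ {suc c} {r} _ r≤s = ℤₚ.≤-trans (subst (ℤ._≤ + r) (sym (ℤₚ.[1+m]⊖[1+n]≡m⊖n r c)) (ℤₚ.m⊖n≤m r c)) (ℤ.+≤+ r≤s)

module Correctness (b N L : ℕ) (b>0 : 0 < b) (N>0 : 0 < N) (L>0 : 0 < L)
  (n d : ℕ) (inp : ℕ → Bool) (β : ℕ) (β≥2 : 2 ≤ β) (b< : b < 2 ^ β) (N< : N < 2 ^ β) (d< : d < 2 ^ β) where

  open Execution b N L b>0 N>0 L>0 n d inp β β≥2 b< N< d<

  private instance
    N≢0 : NonZero N
    N≢0 = >-nonZero N>0

  -- `z` is the number of coordinates left; it is negative after an overshooting last block, and
  -- then the condition is vacuous.
  DisjointBelow : ℤ → ℕ → ℕ → Set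
  DisjointBelow z p p′ = ∀ j → + j ℤ.< z → inp (p + j) ∧ inp (p′ + j) ≡ false

  readBlock-disjoint : ∀ {r p p′} → (∀ j → j < r → inp (p + j) ∧ inp (p′ + j) ≡ false) →
                       ∀ m i → Disjoint (readBlock m i r p) (readBlock m i r p′)
  readBlock-disjoint         dis zero    i = []
  readBlock-disjoint {r} {p} {p′} dis (suc m) i = bit ∷ readBlock-disjoint {r} {p} {p′} dis m (suc i)
    where
    bit : bitAt r p i ∧ bitAt r p′ i ≡ false
    bit with i <ᵇ r in eq
    ... | true  = dis i (<ᵇ⇒< i r (subst T (sym eq) tt))
    ... | false = refl

  readBlock-disjoint⁻ : ∀ {r p p′} m i → Disjoint (readBlock m i r p) (readBlock m i r p′) →
                        ∀ j → i ≤ j → j < i + m → j < r → inp (p + j) ∧ inp (p′ + j) ≡ false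
  readBlock-disjoint⁻ zero i dis j i≤j j< _ = contradiction (subst (j <_) (+-identityʳ i) j<) (≤⇒≯ i≤j)
  readBlock-disjoint⁻ {r} {p} {p′} (suc m) i (bit ∷ dis) j i≤j j< j<r with i ≟ j
  ... | yes refl with i <ᵇ r in eq
  ...   | true  = bit
  ...   | false = contradiction (<⇒<ᵇ j<r) (subst T eq)
  readBlock-disjoint⁻ {r} {p} {p′} (suc m) i (bit ∷ dis) j i≤j j< j<r | no i≢j =
    readBlock-disjoint⁻ {r} {p} {p′} m (suc i) dis j (≤∧≢⇒< i≤j i≢j) (subst (j <_) (+-suc i m) j<) j<r

  blocks-disjoint : ∀ fuel z p p′ → DisjointBelow z p p′ → Listwise Disjoint (blocks fuel z p) (blocks fuel z p′)
  blocks-disjoint zero       z         p p′ dis = []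
  blocks-disjoint (suc fuel) (+ zero)  p p′ dis = []
  blocks-disjoint (suc fuel) -[1+ r ]  p p′ dis = []
  blocks-disjoint (suc fuel) (+ suc r) p p′ dis =
      readBlock-disjoint {suc r} {p} {p′} (λ j j< → dis j (ℤ.+<+ j<)) b 0
    ∷ blocks-disjoint fuel (+ suc r ℤ.- + b) (p + b) (p′ + b) λ j j< →
        subst₂ (λ x y → inp x ∧ inp y ≡ false) (sym (+-assoc p b j)) (sym (+-assoc p′ b j)) (dis (b + j) (ℤ.+<+ (+-<-minus⁻ j (suc r) b j<)))

  blocks-disjoint⁻ : ∀ fuel z p p′ → z ℤ.≤ + fuel → Listwise Disjoint (blocks fuel z p) (blocks fuel z p′) → DisjointBelow z p p′
  blocks-disjoint⁻ zero       z         p p′ z≤ dis j j< = contradiction (ℤₚ.<-≤-trans j< z≤) λ { (ℤ.+<+ ()) }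
  blocks-disjoint⁻ (suc fuel) (+ zero)  p p′ z≤ dis j (ℤ.+<+ ())
  blocks-disjoint⁻ (suc fuel) -[1+ r ]  p p′ z≤ dis j ()
  blocks-disjoint⁻ (suc fuel) (+ suc r) p p′ (ℤ.+≤+ (s≤s r≤)) (dis ∷ rest) j (ℤ.+<+ j<) with b ≤? j
  ... | no  b≰j = readBlock-disjoint⁻ {suc r} {p} {p′} b 0 dis j z≤n (≰⇒> b≰j) j<
  ... | yes b≤j = subst₂ (λ x y → inp x ∧ inp y ≡ false) (position p) (position p′)
      (blocks-disjoint⁻ fuel (+ suc r ℤ.- + b) (p + b) (p′ + b) (remaining-≤ b>0 r≤) rest (j ∸ b)
        (+-<-minus (j ∸ b) (suc r) b (subst (_< suc r) (sym (m+[n∸m]≡n b≤j)) j<)))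
    where
    position : ∀ p → p + b + (j ∸ b) ≡ p + j
    position p = trans (+-assoc p b (j ∸ b)) (cong (λ x → p + x) (m+[n∸m]≡n b≤j))

  ∈-expandLevel : ∀ {as q k a} → k ∈ q → a ∈ as → k * N + a ∈ expandLevel as q
  ∈-expandLevel {as} {q} {k} k∈ a∈ = ∈-concatMap⁺ (λ k → extend k as) (Any.map (λ { refl → ∈-map⁺ (λ a → k * N + a) a∈ }) k∈)

  ∈-expandLevel⁻ : ∀ as q {l} → l ∈ expandLevel as q → ∃[ k ] ∃[ a ] k ∈ q × a ∈ as × l ≡ k * N + a
  ∈-expandLevel⁻ as q l∈ = find (∈-concatMap⁻ (λ k → extend k as) {xs = q} l∈)
    where
    find : ∀ {l q} → Any.Any (λ k → l ∈ extend k as) q → ∃[ k ] ∃[ a ] k ∈ q × a ∈ as × l ≡ k * N + a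
    find {q = k ∷ q} (here l∈) = let a , a∈ , eq = ∈-map⁻ (λ a → k * N + a) l∈ in k , a , here refl , a∈ , eq
    find (there l∈) = let k , a , k∈ , a∈ , eq = find l∈ in k , a , there k∈ , a∈ , eq

  module Keys (A A′ : Vec Bool b → List ℕ) (marked : Marked A) (marked′ : Marked A′)
    (sound : ∀ {x y k} → k ∈ A x → k ∈ A′ y → Disjoint x y)
    (complete : ∀ {x y} → Disjoint x y → ∃[ k ] k ∈ A x × k ∈ A′ y) where

    -- The digit of the first block is appended first, so the induction strips the later digits and
    -- reaches a common key of the first level. By `digits-unique` it splits into a common digit,
    -- which `sound` interprets, and a common prefix.
    expand-meet : ∀ xs ys {q q′ k} → length xs ≡ length ys → k ∈ expand A xs q → k ∈ expand A′ ys q′ →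
                  Listwise Disjoint xs ys × ∃[ l ] l ∈ q × l ∈ q′
    expand-meet []       []       eq k∈ k∈′ = [] , _ , k∈ , k∈′
    expand-meet (x ∷ xs) (y ∷ ys) {q} {q′} eq k∈ k∈′ with expand-meet xs ys (suc-injective eq) k∈ k∈′
    ... | dis , l , l∈ , l∈′ with ∈-expandLevel⁻ (A x) q l∈ | ∈-expandLevel⁻ (A′ y) q′ l∈′
    ...   | k₀ , a , k₀∈ , a∈ , refl | k₁ , a′ , k₁∈ , a′∈ , eq′
      with digits-unique N k₀ k₁ (All.lookup (Marked.range marked x) a∈) (All.lookup (Marked.range marked′ y) a′∈) eq′
    ...     | refl , refl = sound a∈ a′∈ ∷ dis , k₀ , k₀∈ , k₁∈

    expand-common : ∀ {xs ys q q′ l} → Listwise Disjoint xs ys → l ∈ q → l ∈ q′ → ∃[ k ] k ∈ expand A xs q × k ∈ expand A′ ys q′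
    expand-common []          l∈ l∈′ = _ , l∈ , l∈′
    expand-common (dis ∷ rest) l∈ l∈′ = let a , a∈ , a∈′ = complete dis in
      expand-common rest (∈-expandLevel l∈ a∈) (∈-expandLevel l∈′ a∈′)

    open Enumeration A marked using (keysAt; length-blocks)
    open Enumeration A′ marked′ using () renaming (keysAt to keysAt′)

    keys-meet⇒disjoint : ∀ p p′ {k} → k ∈ keysAt p → k ∈ keysAt′ p′ → DisjointBelow (+ d) p p′
    keys-meet⇒disjoint p p′ k∈ k∈′ = blocks-disjoint⁻ d (+ d) p p′ ℤₚ.≤-refl
      (proj₁ (expand-meet (blocks d (+ d) p) (blocks d (+ d) p′) (length-blocks d (+ d) p p′) k∈ k∈′))

    disjoint⇒keys-meet : ∀ p p′ → DisjointBelow (+ d) p p′ → ∃[ k ] k ∈ keysAt p × k ∈ keysAt′ p′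
    disjoint⇒keys-meet p p′ dis = expand-common (blocks-disjoint d (+ d) p p′ dis) (here refl) (here refl)

  -- `Φ` can become true only at a key with `H`, becomes true there, and stays true. One use is for
  -- the mark of a fixed key; the other is for the answer, where `Inv` says that the marks no longer
  -- change, so that `H` is a fixed set of keys.
  module Folding (A : Vec Bool b → List ℕ) (marked : Marked A) (step : ℕ → Progress → Progress)
    (Inv Φ : Progress → Set) (H : ℕ → Set) (preserved : ∀ {k D} → Inv D → Inv (step k D))
    (split : ∀ {k D} → Inv D → Φ (step k D) → Φ D ⊎ H k)
    (keep : ∀ {k D} → Inv D → Φ D → Φ (step k D)) (hit : ∀ {k D} → Inv D → H k → Φ (step k D)) where

    open Enumeration A marked using (keysAt; phaseData)

    private
      visit : List ℕ → Progress → Progress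
      visit q D = foldl (λ D k → step k D) D q

    visit-preserved : ∀ q {D} → Inv D → Inv (visit q D)
    visit-preserved []      inv = inv
    visit-preserved (k ∷ q) inv = visit-preserved q (preserved inv)

    visit-split : ∀ q {D} → Inv D → Φ (visit q D) → Φ D ⊎ ∃[ k ] k ∈ q × H k
    visit-split []      inv φ = inj₁ φ
    visit-split (k ∷ q) inv φ with visit-split q (preserved inv) φ
    ... | inj₂ (l , l∈ , h) = inj₂ (l , there l∈ , h)
    ... | inj₁ φ′ with split inv φ′
    ...   | inj₁ φ″ = inj₁ φ″
    ...   | inj₂ h  = inj₂ (k , here refl , h)

    visit-keep : ∀ q {D} → Inv D → Φ D → Φ (visit q D)
    visit-keep []      inv φ = φ
    visit-keep (k ∷ q) inv φ = visit-keep q (preserved inv) (keep inv φ)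

    visit-hit : ∀ {q D k} → Inv D → k ∈ q → H k → Φ (visit q D)
    visit-hit {k ∷ q} inv (here refl) h = visit-keep q (preserved inv) (hit inv h)
    visit-hit {k ∷ q} inv (there k∈)  h = visit-hit (preserved inv) k∈ h

    phase-preserved : ∀ cnt p {D} → Inv D → Inv (phaseData step cnt p D)
    phase-preserved zero      p inv = inv
    phase-preserved (suc cnt) p inv = phase-preserved cnt (p + d) (visit-preserved (keysAt p) inv)

    phase-split : ∀ cnt p {D} → Inv D → Φ (phaseData step cnt p D) → Φ D ⊎ ∃[ i ] i < cnt × ∃[ k ] k ∈ keysAt (p + i * d) × H k
    phase-split zero      p inv φ = inj₁ φ
    phase-split (suc cnt) p inv φ with phase-split cnt (p + d) (visit-preserved (keysAt p) inv) φ
    ... | inj₂ (i , i< , k , k∈ , h) = inj₂ (suc i , s≤s i< , k , subst (λ p → k ∈ keysAt p) (+-assoc p d (i * d)) k∈ , h)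
    ... | inj₁ φ′ with visit-split (keysAt p) inv φ′
    ...   | inj₁ φ″            = inj₁ φ″
    ...   | inj₂ (k , k∈ , h) = inj₂ (0 , z<s , k , subst (λ p → k ∈ keysAt p) (sym (+-identityʳ p)) k∈ , h)

    phase-keep : ∀ cnt p {D} → Inv D → Φ D → Φ (phaseData step cnt p D)
    phase-keep zero      p inv φ = φ
    phase-keep (suc cnt) p inv φ = phase-keep cnt (p + d) (visit-preserved (keysAt p) inv) (visit-keep (keysAt p) inv φ)

    phase-hit : ∀ cnt p {D} → Inv D → ∀ i → i < cnt → ∀ {k} → k ∈ keysAt (p + i * d) → H k → Φ (phaseData step cnt p D)
    phase-hit (suc cnt) p inv zero    i< {k} k∈ h = phase-keep cnt (p + d) (visit-preserved (keysAt p) inv)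
      (visit-hit inv (subst (λ p → k ∈ keysAt p) (+-identityʳ p) k∈) h)
    phase-hit (suc cnt) p inv (suc i) (s≤s i<) {k} k∈ h = phase-hit cnt (p + d) (visit-preserved (keysAt p) inv) i i<
      (subst (λ p → k ∈ keysAt p) (sym (+-assoc p d (i * d))) k∈) h

  blocks-length-≤ : ∀ fuel z p → length (blocks fuel z p) ≤ fuel
  blocks-length-≤ zero       z         p = z≤n
  blocks-length-≤ (suc fuel) (+ zero)  p = z≤n
  blocks-length-≤ (suc fuel) (+ suc r) p = s≤s (blocks-length-≤ fuel (+ suc r ℤ.- + b) (p + b))
  blocks-length-≤ (suc fuel) -[1+ r ]  p = z≤n

  blocks-cover : ∀ fuel z p → z ℤ.≤ + fuel → z ℤ.≤ + (length (blocks fuel z p) * b)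
  blocks-cover zero       z         p z≤ = z≤
  blocks-cover (suc fuel) (+ zero)  p z≤ = ℤ.+≤+ z≤n
  blocks-cover (suc fuel) -[1+ r ]  p z≤ = ℤ.-≤+
  blocks-cover (suc fuel) (+ suc r) p (ℤ.+≤+ (s≤s r≤)) = subst (ℤ._≤ + (b + length (blocks fuel z′ (p + b)) * b)) whole
      (ℤₚ.+-monoʳ-≤ (+ b) (blocks-cover fuel z′ (p + b) (remaining-≤ b>0 r≤)))
    where
    z′ = + suc r ℤ.- + b
    whole : + b ℤ.+ z′ ≡ + suc r
    whole = trans (ℤₚ.+-comm (+ b) z′) (trans (ℤₚ.+-assoc (+ suc r) (ℤ.- + b) (+ b))
      (trans (cong (λ x → + suc r ℤ.+ x) (ℤₚ.+-inverseˡ (+ b))) (ℤₚ.+-identityʳ (+ suc r))))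

  -- With `blocks-cover` this makes the number of blocks equal to `d / b` rounded up. The overshoot
  -- of less than `b` coordinates costs only a constant factor in the end.
  blocks-length-< : ∀ fuel z p r → z ℤ.≤ + r → length (blocks fuel z p) * b < r + b
  blocks-length-< zero       z         p r z≤ = ≤-trans b>0 (m≤n+m b r)
  blocks-length-< (suc fuel) (+ zero)  p r z≤ = ≤-trans b>0 (m≤n+m b r)
  blocks-length-< (suc fuel) -[1+ _ ]  p r z≤ = ≤-trans b>0 (m≤n+m b r)
  blocks-length-< (suc fuel) (+ suc s) p r (ℤ.+≤+ s<r) = subst (b + l * b <_) (+-comm b r) (+-monoʳ-< b (shorter (b ≤? r)))
    where
    l = length (blocks fuel (+ suc s ℤ.- + b) (p + b))
    IH : l * b < (r ∸ b) + b
    IH = blocks-length-< fuel (+ suc s ℤ.- + b) (p + b) (r ∸ b) (ℤₚ.≤-trans (ℤₚ.+-monoˡ-≤ (ℤ.- + b) (ℤ.+≤+ s<r)) (minus-≤ r b))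
      where
      minus-≤ : ∀ r c → + r ℤ.- + c ℤ.≤ + (r ∸ c)
      minus-≤ r c with c ≤? r
      ... | yes c≤r rewrite ℤₚ.m-n≡m⊖n r c | ℤₚ.⊖-≥ c≤r = ℤₚ.≤-refl
      ... | no  c≰r rewrite ℤₚ.m-n≡m⊖n r c | ℤₚ.⊖-≤ (<⇒≤ (≰⇒> c≰r)) = ℤₚ.neg-≤-pos
    shorter : Dec (b ≤ r) → l * b < r
    shorter (yes b≤r) = subst (l * b <_) (m∸n+n≡m b≤r) IH
    shorter (no  b≰r) = ≤-<-trans (≤-reflexive (cong (_* b) l≡0)) (≤-trans (s≤s z≤n) s<r)
      where
      l≡0 : l ≡ 0
      l≡0 = n<1⇒n≡0 (*-cancelʳ-< b l 1 (subst (l * b <_) (trans (cong (_+ b) (m≤n⇒m∸n≡0 (<⇒≤ (≰⇒> b≰r)))) (sym (*-identityˡ b))) IH))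

-- Inner products and the bits in memory

isOne : ℤ → Bool
isOne (+ 1) = true
isOne _     = false

𝟙-isOne : ∀ (x : Fin 2) → + toℕ x ≡ + 𝟙 (isOne (+ toℕ x))
𝟙-isOne fzero        = refl
𝟙-isOne (fsuc fzero) = refl

-- The inner product is moved to natural numbers because there a sum vanishes only if every summand
-- does.
inner : ∀ {d} → Vector (Fin 2) d → Vector (Fin 2) d → ℕ
inner {zero}  x y = 0
inner {suc d} x y = toℕ (x fzero) * toℕ (y fzero) + inner (x ∘ fsuc) (y ∘ fsuc)

⟨⟩≡inner : ∀ {d} (x y : Vector (Fin 2) d) → ⟨ x , y ⟩ ≡ + inner x y
⟨⟩≡inner {zero}  x y = refl
⟨⟩≡inner {suc d} x y = cong₂ ℤ._+_ (sym (ℤₚ.pos-* (toℕ (x fzero)) (toℕ (y fzero)))) (⟨⟩≡inner (x ∘ fsuc) (y ∘ fsuc))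

bothOne : Fin 2 → Fin 2 → Bool
bothOne x y = isOne (+ toℕ x) ∧ isOne (+ toℕ y)

product-zero : ∀ (x y : Fin 2) → toℕ x * toℕ y ≡ 0 → bothOne x y ≡ false
product-zero fzero        y            _ = refl
product-zero (fsuc fzero) fzero        _ = refl
product-zero (fsuc fzero) (fsuc fzero) ()

product-zero⁻ : ∀ (x y : Fin 2) → bothOne x y ≡ false → toℕ x * toℕ y ≡ 0
product-zero⁻ fzero        y            _ = refl
product-zero⁻ (fsuc fzero) fzero        _ = refl
product-zero⁻ (fsuc fzero) (fsuc fzero) ()

inner-zero : ∀ {d} (x y : Vector (Fin 2) d) → inner x y ≡ 0 → ∀ k → bothOne (x k) (y k) ≡ false
inner-zero x y eq fzero    = product-zero (x fzero) (y fzero) (m+n≡0⇒m≡0 (toℕ (x fzero) * toℕ (y fzero)) eq)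
inner-zero x y eq (fsuc k) = inner-zero (x ∘ fsuc) (y ∘ fsuc) (m+n≡0⇒n≡0 (toℕ (x fzero) * toℕ (y fzero)) eq) k

inner-zero⁻ : ∀ {d} (x y : Vector (Fin 2) d) → (∀ k → bothOne (x k) (y k) ≡ false) → inner x y ≡ 0
inner-zero⁻ {zero}  x y dis = refl
inner-zero⁻ {suc d} x y dis = cong₂ _+_ (product-zero⁻ (x fzero) (y fzero) (dis fzero)) (inner-zero⁻ (x ∘ fsuc) (y ∘ fsuc) (dis ∘ fsuc))

concat-combine : ∀ {n d} (u : Vector (Vector (Fin 2) d) n) i k → Functional.concat u (combine i k) ≡ u i k
concat-combine {n} {d} u i k = cong (λ p → u (proj₂ p) (proj₁ p)) (cong swap (remQuot-combine {n} {d} i k))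

module Input {n d} (u v : Vector (Vector (Fin 2) d) n) where

  memory-at : ∀ (c : Fin (n * d + n * d)) → memory (input u v) (+ toℕ c) ≡ + toℕ ((Functional.concat u Functional.++ Functional.concat v) c)
  memory-at c with toℕ c <? n * d + n * d
  ... | yes p = cong (λ c → + toℕ ((Functional.concat u Functional.++ Functional.concat v) c)) (toℕ-injective (toℕ-fromℕ< p))
  ... | no ¬p = contradiction (toℕ<n c) ¬p

  memory-bit : ∀ a → ∃[ x ] memory (input u v) (+ a) ≡ + toℕ {2} x
  memory-bit a with a <? n * d + n * d
  ... | yes p = (Functional.concat u Functional.++ Functional.concat v) (fromℕ< p) , refl
  ... | no  _ = fzero , refl

  inp : ℕ → Bool
  inp a = isOne (memory (input u v) (+ a))

  memory-inp : ∀ a → memory (input u v) (+ a) ≡ + 𝟙 (inp a)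
  memory-inp a = let x , eq = memory-bit a in trans eq (trans (𝟙-isOne x) (cong (λ z → + 𝟙 (isOne z)) (sym eq)))

  inp-u : ∀ i k → inp (toℕ i * d + toℕ k) ≡ isOne (+ toℕ (u i k))
  inp-u i k = cong isOne (trans (cong (λ a → memory (input u v) (+ a)) position)
    (trans (memory-at (combine i k ↑ˡ (n * d))) (cong (λ x → + toℕ x)
      (trans (cong (Sum.[_,_] (Functional.concat u) (Functional.concat v)) (splitAt-↑ˡ (n * d) (combine i k) (n * d))) (concat-combine u i k)))))
    where
    position : toℕ i * d + toℕ k ≡ toℕ (combine i k ↑ˡ (n * d))
    position = trans (cong (_+ toℕ k) (*-comm (toℕ i) d)) (trans (sym (toℕ-combine i k)) (sym (toℕ-↑ˡ (combine i k) (n * d))))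

  inp-v : ∀ i k → inp (n * d + toℕ i * d + toℕ k) ≡ isOne (+ toℕ (v i k))
  inp-v i k = cong isOne (trans (cong (λ a → memory (input u v) (+ a)) position)
    (trans (memory-at ((n * d) ↑ʳ combine i k)) (cong (λ x → + toℕ x)
      (trans (cong (Sum.[_,_] (Functional.concat u) (Functional.concat v)) (splitAt-↑ʳ (n * d) (n * d) (combine i k))) (concat-combine v i k)))))
    where
    position : n * d + toℕ i * d + toℕ k ≡ toℕ ((n * d) ↑ʳ combine i k)
    position = trans (+-assoc (n * d) _ _) (trans (cong (λ x → n * d + x) (trans (cong (_+ toℕ k) (*-comm (toℕ i) d)) (sym (toℕ-combine i k))))
                 (sym (toℕ-↑ʳ (n * d) (combine i k))))

  orthogonal⇒disjoint : ∀ i j → ⟨ u i , v j ⟩ ≡ 0ℤ →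
                        ∀ k → + k ℤ.< + d → inp (toℕ i * d + k) ∧ inp (n * d + toℕ j * d + k) ≡ false
  orthogonal⇒disjoint i j eq k (ℤ.+<+ k<) = subst (λ k → inp (toℕ i * d + k) ∧ inp (n * d + toℕ j * d + k) ≡ false) (toℕ-fromℕ< k<)
    (trans (cong₂ _∧_ (inp-u i (fromℕ< k<)) (inp-v j (fromℕ< k<)))
      (inner-zero (u i) (v j) (ℤₚ.+-injective (trans (sym (⟨⟩≡inner (u i) (v j))) eq)) (fromℕ< k<)))

  disjoint⇒orthogonal : ∀ i j → (∀ k → + k ℤ.< + d → inp (toℕ i * d + k) ∧ inp (n * d + toℕ j * d + k) ≡ false) →
                        ⟨ u i , v j ⟩ ≡ 0ℤ
  disjoint⇒orthogonal i j dis = trans (⟨⟩≡inner (u i) (v j)) (cong +_ (inner-zero⁻ (u i) (v j) λ k →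
    trans (sym (cong₂ _∧_ (inp-u i k) (inp-v j k))) (dis (toℕ k) (ℤ.+<+ (toℕ<n k)))))

-- Running time

n<2^n : ∀ n → n < 2 ^ n
n<2^n zero    = z<s
n<2^n (suc n) = begin-strict
  1 + n              <⟨ +-mono-≤-< (m^n>0 2 n) (n<2^n n) ⟩
  2 ^ n + 2 ^ n      ≡⟨ cong (λ x → 2 ^ n + x) (+-identityʳ (2 ^ n)) ⟨
  2 ^ suc n          ∎

n<2^1+log : ∀ n → n < 2 ^ suc ⌊log₂ n ⌋
n<2^1+log n = ≰⇒> λ le → contradiction (subst (_≤ ⌊log₂ n ⌋) (⌊log₂[2^n]⌋≡n (suc ⌊log₂ n ⌋)) (⌊log₂⌋-mono-≤ le)) 1+n≰n

empty-disjoint : ∀ n → Disjoint (replicate n false) (replicate n false)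
empty-disjoint zero    = []
empty-disjoint (suc n) = refl ∷ empty-disjoint n

-- For `g = N + suc L + b`: with at most `d` blocks, `g * d` bits hold every key and the tail of the
-- queue, as `N` and `suc L` are below `2 ^ g`; addresses need at most `d + g + l + 3` bits.
word-length : (g d l : ℕ) → ℕ
word-length g d l = g * (d + 2) + 3 + l

word-length-linear : ∀ g d l → suc (word-length g d l) ≤ (2 * g + 4) * (1 + d + l)
word-length-linear g d l = begin
  suc (g * (d + 2) + 3 + l)                                            ≤⟨ m≤m+n _ (g * d + 4 * d + (2 * g + 3) * l) ⟩
  suc (g * (d + 2) + 3 + l) + (g * d + 4 * d + (2 * g + 3) * l)        ≡⟨ e g d l ⟩
  (2 * g + 4) * (1 + d + l)                                            ∎
  where
  e : ∀ g d l → 1 + (g * (d + 2) + 3 + l) + (g * d + 4 * d + (2 * g + 3) * l) ≡ (2 * g + 4) * (1 + d + l)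
  e = solve-∀

steps-bound : ∀ n m d E L b → 1 ≤ n → m ≤ d → 1 ≤ E →
  let s = n * (m * (E * (4 * L + 6) + (b + 9)) + 11 + E * 7 + 5) + 3 in
  suc (s + suc (s + 1)) ≤ n * E * (1 + d) * (2 * (4 * L + b + 38) + 9)
steps-bound n m d E L b 1≤n m≤d 1≤E = begin
  suc (s + suc (s + 1))
    ≡⟨ e₁ (n * (m * (E * (4 * L + 6) + (b + 9)) + 11 + E * 7 + 5)) ⟩
  2 * (n * (m * (E * (4 * L + 6) + (b + 9)) + 11 + E * 7 + 5)) + 9 * 1
    ≤⟨ +-mono-≤ (*-monoʳ-≤ 2 (*-monoʳ-≤ n per-vector)) (*-monoʳ-≤ 9 (*-mono-≤ (*-mono-≤ 1≤n 1≤E) (s≤s (z≤n {d})))) ⟩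
  2 * (n * (E * (1 + d) * (4 * L + b + 38))) + 9 * (n * E * (1 + d))
    ≡⟨ e₂ n E (1 + d) (4 * L + b + 38) ⟩
  n * E * (1 + d) * (2 * (4 * L + b + 38) + 9) ∎
  where
  s = n * (m * (E * (4 * L + 6) + (b + 9)) + 11 + E * 7 + 5) + 3
  e₁ : ∀ x → 1 + ((x + 3) + (1 + ((x + 3) + 1))) ≡ 2 * x + 9 * 1
  e₁ = solve-∀
  e₂ : ∀ n E d c → 2 * (n * (E * d * c)) + 9 * (n * E * d) ≡ n * E * d * (2 * c + 9)
  e₂ = solve-∀
  e₃ : ∀ d E L b → d * (E * (4 * L + 6) + E * (b + 9)) + 11 * E + E * 7 + 5 * E + (E * (4 * L + b) + E * 15 + E * d * 23) ≡ E * (1 + d) * (4 * L + b + 38)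
  e₃ = solve-∀
  scale : ∀ c → c ≤ c * E
  scale c = m≤m*n c E {{>-nonZero 1≤E}}
  per-vector : m * (E * (4 * L + 6) + (b + 9)) + 11 + E * 7 + 5 ≤ E * (1 + d) * (4 * L + b + 38)
  per-vector = begin
    m * (E * (4 * L + 6) + (b + 9)) + 11 + E * 7 + 5
      ≤⟨ +-mono-≤ (+-monoˡ-≤ (E * 7) (+-mono-≤ (*-mono-≤ m≤d (+-monoʳ-≤ (E * (4 * L + 6)) (m≤n*m (b + 9) E {{>-nonZero 1≤E}}))) (scale 11))) (scale 5) ⟩
    d * (E * (4 * L + 6) + E * (b + 9)) + 11 * E + E * 7 + 5 * E
      ≤⟨ m≤m+n _ (E * (4 * L + b) + E * 15 + E * d * 23) ⟩
    d * (E * (4 * L + 6) + E * (b + 9)) + 11 * E + E * 7 + 5 * E + (E * (4 * L + b) + E * 15 + E * d * 23)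
      ≡⟨ e₃ d E L b ⟩
    E * (1 + d) * (4 * L + b + 38) ∎

-- Of the exponent 3, two come from the square of the word length in the cost of a step and one from
-- the number of blocks, at most `d`.
time-bound : ∀ {t s n E d l c₁ c₂ g p q r} → t ≤ s * (50 * (g * g)) → s ≤ n * E * (1 + d) * c₁ → g ≤ c₂ * (1 + d + l) → E * q ≤ r * p →
             t * q ≤ 50 * c₁ * (c₂ * c₂) * r * (n * p) * (1 + d + l) ^ 3
time-bound {t} {s} {n} {E} {d} {l} {c₁} {c₂} {g} {p} {q} {r} t≤ s≤ g≤ Eq≤ = begin
  t * q
    ≤⟨ *-monoˡ-≤ q t≤ ⟩
  s * (50 * (g * g)) * q
    ≤⟨ *-monoˡ-≤ q (*-mono-≤ s≤ (*-monoʳ-≤ 50 (*-mono-≤ g≤ g≤))) ⟩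
  n * E * (1 + d) * c₁ * (50 * (c₂ * w * (c₂ * w))) * q
    ≤⟨ *-monoˡ-≤ q (*-monoˡ-≤ (50 * (c₂ * w * (c₂ * w))) (*-monoˡ-≤ c₁ (*-monoʳ-≤ (n * E) (m≤m+n (1 + d) l)))) ⟩
  n * E * w * c₁ * (50 * (c₂ * w * (c₂ * w))) * q
    ≡⟨ e₁ n E w c₁ 50 c₂ q ⟩
  50 * c₁ * (c₂ * c₂) * n * (w * (w * (w * 1))) * (E * q)
    ≤⟨ *-monoʳ-≤ (50 * c₁ * (c₂ * c₂) * n * (w * (w * (w * 1)))) Eq≤ ⟩
  50 * c₁ * (c₂ * c₂) * n * (w * (w * (w * 1))) * (r * p)
    ≡⟨ e₂ (50 * c₁ * (c₂ * c₂)) n (w * (w * (w * 1))) r p ⟩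
  50 * c₁ * (c₂ * c₂) * r * (n * p) * (w * (w * (w * 1))) ∎
  where
  w = 1 + d + l
  e₁ : ∀ n E w c k e q → n * E * w * c * (k * (e * w * (e * w))) * q ≡ k * c * (e * e) * n * (w * (w * (w * 1))) * (E * q)
  e₁ = solve-∀
  e₂ : ∀ k n x r p → k * n * x * (r * p) ≡ k * r * (n * p) * x
  e₂ = solve-∀

-- The vector is padded to `m * b` coordinates, where the bound holds block by block. Going back to
-- `d` costs at most `1155 ^ b`, which enters the constant.
blocks-saving : ∀ b L m d → L * 1000 ^ b ≤ 1155 ^ b → d ≤ m * b → m * b ≤ d + b → L ^ m * 1000 ^ d ≤ 1155 ^ b * 1155 ^ d
blocks-saving b L m d L-small d≤ ≤d+b = begin
  L ^ m * 1000 ^ d             ≤⟨ *-monoʳ-≤ (L ^ m) (^-monoʳ-≤ 1000 d≤) ⟩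
  L ^ m * 1000 ^ (m * b)       ≡⟨ cong (λ x → L ^ m * x) (trans (cong (1000 ^_) (*-comm m b)) (sym (^-*-assoc 1000 b m))) ⟩
  L ^ m * (1000 ^ b) ^ m       ≡⟨ ^-distribʳ-* m L (1000 ^ b) ⟨
  (L * 1000 ^ b) ^ m           ≤⟨ ^-monoˡ-≤ m L-small ⟩
  (1155 ^ b) ^ m               ≡⟨ trans (^-*-assoc 1155 b m) (cong (1155 ^_) (*-comm b m)) ⟩
  1155 ^ (m * b)               ≤⟨ ^-monoʳ-≤ 1155 ≤d+b ⟩
  1155 ^ (d + b)               ≡⟨ trans (^-distribˡ-+-* 1155 d b) (*-comm (1155 ^ d) (1155 ^ b)) ⟩
  1155 ^ b * 1155 ^ d          ∎

-- The algorithm with its answer and its running time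

∨-split : ∀ p {q} → p ∨ q ≡ true → q ≡ true ⊎ p ≡ true
∨-split true  _  = inj₂ refl
∨-split false eq = inj₁ eq

∨-keep : ∀ p {q} → q ≡ true → p ∨ q ≡ true
∨-keep true  _  = refl
∨-keep false eq = eq

module Main (G : Gadget) where
  open Gadget G

  L>0 : 0 < L
  -- The empty block is disjoint from itself, so it has at least one key.
  L>0 = nonempty (few (replicate b false)) (proj₁ (proj₂ (complete (empty-disjoint b))))
    where
    nonempty : ∀ {k ks} → length ks ≤ L → k ∈ ks → 0 < L
    nonempty le (here _)  = ≤-trans (s≤s z≤n) le
    nonempty le (there _) = ≤-trans (s≤s z≤n) le

  g : ℕ
  g = N + suc L + b

  algorithm : Cmd
  algorithm = Program.program b N A A′

  constant : ℕ
  constant = 50 * (2 * (4 * L + b + 38) + 9) * ((2 * g + 4) * (2 * g + 4)) * 1155 ^ b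

  module _ (n d : ℕ) .{{_ : NonZero n}} (u v : Vector (Vector (Fin 2) d) n) where
    open Input u v

    l β : ℕ
    l = ⌊log₂ n ⌋
    β = word-length g d l

    g>0 : 0 < g
    g>0 = ≤-trans (≤-trans N>0 (m≤m+n N (suc L))) (m≤m+n (N + suc L) b)

    2^-mono : ∀ {i j} → i ≤ j → 2 ^ i ≤ 2 ^ j
    2^-mono = ^-monoʳ-≤ 2

    gd<β : g * (d + 2) < β
    gd<β = ≤-trans (m<m+n (g * (d + 2)) z<s) (m≤m+n (g * (d + 2) + 3) l)

    d+g≤ : d + g ≤ g * (d + 2)
    d+g≤ = begin
      d + g                ≤⟨ +-mono-≤ (m≤n*m d g {{>-nonZero g>0}}) (m≤m*n g 2) ⟩
      g * d + g * 2        ≡⟨ *-distribˡ-+ g d 2 ⟨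
      g * (d + 2)          ∎

    β≥2 : 2 ≤ β
    β≥2 = ≤-trans (≤-trans (s≤s (s≤s z≤n)) (m≤n+m 3 (g * (d + 2)))) (m≤m+n (g * (d + 2) + 3) l)

    below : ∀ {k} → k ≤ g → k < 2 ^ β
    below {k} k≤ = <-≤-trans (n<2^n k) (2^-mono (≤-trans k≤ (≤-trans (≤-trans (m≤n+m g d) d+g≤) (<⇒≤ gd<β))))

    N≤g : N ≤ g
    N≤g = ≤-trans (m≤m+n N (suc L)) (m≤m+n (N + suc L) b)

    sL≤g : suc L ≤ g
    sL≤g = ≤-trans (m≤n+m (suc L) N) (m≤m+n (N + suc L) b)

    d< : d < 2 ^ β
    d< = <-≤-trans (n<2^n d) (2^-mono (≤-trans (≤-trans (m≤m+n d g) d+g≤) (<⇒≤ gd<β)))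

    b< : b < 2 ^ β
    b< = below (m≤n+m b (N + suc L))

    N< : N < 2 ^ β
    N< = below N≤g

    open Correctness b N L b>0 N>0 L>0 n d inp β β≥2 b< N< d<
    open Execution b N L b>0 N>0 L>0 n d inp β β≥2 b< N< d<
    open Timed β (≤-trans (s≤s z≤n) β≥2)

    marked : Marked A
    marked = record { range = A<N ; few = few }

    marked′ : Marked A′
    marked′ = record { range = A′<N ; few = few′ }

    m P : ℕ
    m = blockCount
    P = n * d + n * d

    m≤d : m ≤ d
    m≤d = blocks-length-≤ d (+ d) 0

    power-fits : ∀ {x} → x ≤ g → x ^ m < 2 ^ β
    power-fits {x} x≤ = begin-strict
      x ^ m                ≤⟨ ^-monoˡ-≤ m (≤-trans x≤ (<⇒≤ (n<2^n g))) ⟩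
      (2 ^ g) ^ m          ≡⟨ ^-*-assoc 2 g m ⟩
      2 ^ (g * m)          ≤⟨ 2^-mono (*-monoʳ-≤ g (≤-trans m≤d (m≤m+n d 2))) ⟩
      2 ^ (g * (d + 2))    <⟨ ^-monoʳ-< 2 (s≤s (s≤s z≤n)) gd<β ⟩
      2 ^ β                ∎

    address-fits : P + (d + b) ≤ 2 ^ β
    address-fits = begin
      n * d + n * d + (d + b)
        ≤⟨ +-mono-≤ (+-mono-≤ nd nd) (+-mono-≤ (≤-trans (<⇒≤ (n<2^n d)) (small d≤)) (≤-trans (<⇒≤ (n<2^n b)) (small b≤))) ⟩
      X + X + (X + X)
        ≡⟨ e X ⟩
      2 ^ 2 * X
        ≡⟨ ^-distribˡ-+-* 2 2 (suc l + (d + g)) ⟨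
      2 ^ (2 + (suc l + (d + g)))
        ≤⟨ 2^-mono (≤-trans (≤-reflexive (e′ l (d + g))) (+-monoˡ-≤ l (+-monoˡ-≤ 3 d+g≤))) ⟩
      2 ^ β ∎
      where
      X = 2 ^ (suc l + (d + g))
      e : ∀ x → x + x + (x + x) ≡ 4 * x
      e = solve-∀
      e′ : ∀ l x → 2 + ((1 + l) + x) ≡ x + 3 + l
      e′ = solve-∀
      d≤ : d ≤ d + g
      d≤ = m≤m+n d g
      b≤ : b ≤ d + g
      b≤ = ≤-trans (m≤n+m b (N + suc L)) (m≤n+m g d)
      small : ∀ {k} → k ≤ d + g → 2 ^ k ≤ X
      small k≤ = 2^-mono (≤-trans k≤ (m≤n+m (d + g) (suc l)))
      nd : n * d ≤ X
      nd = begin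
        n * d                        ≤⟨ *-mono-≤ (<⇒≤ (n<2^1+log n)) (<⇒≤ (n<2^n d)) ⟩
        2 ^ suc l * 2 ^ d            ≡⟨ ^-distribˡ-+-* 2 (suc l) d ⟨
        2 ^ (suc l + d)              ≤⟨ 2^-mono (+-monoʳ-≤ (suc l) d≤) ⟩
        X                            ∎

    P-fits : P + m * b < 2 ^ β
    P-fits = <-≤-trans (+-monoʳ-< P (blocks-length-< d (+ d) 0 d ℤₚ.≤-refl)) address-fits

    P< : P < 2 ^ β
    P< = ≤-<-trans (m≤m+n P (m * b)) P-fits

    open Enumeration
    module Marking = Phases A marked (<⇒≤ (power-fits N≤g)) (power-fits sL≤g) P P-fits P<
    module Testing = Phases A′ marked′ (<⇒≤ (power-fits N≤g)) (power-fits sL≤g) P P-fits P<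

    D₀ D₁ D₂ : Progress
    D₀ = (λ _ → false) , false
    D₁ = phaseData A marked setMark n 0 D₀
    D₂ = phaseData A′ marked′ test n (n * d) D₁

    n< : n < 2 ^ β
    n< = <-≤-trans (n<2^1+log n) (2^-mono (≤-trans (m≤n+m (suc l) (g * (d + 2) + 2)) (≤-reflexive (e (g * (d + 2)) l))))
      where
      e : ∀ x l → x + 2 + (1 + l) ≡ x + 3 + l
      e = solve-∀

    initial : Rep 0 0 0ℤ 0 0 0 [] D₀ (input u v)
    initial = record
      { r0 = refl ; r1 = refl ; r2 = refl ; r3 = refl ; r4 = refl ; r5 = refl ; r6 = refl ; r7 = refl ; r8 = refl ; r9 = refl
      ; bounded = bounds small-regs small-memory
      ; inputs = memory-inp ; marks = λ _ → refl ; queued = tt }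
      where
      small-regs : ∀ r → Small (regs (input u v) r)
      small-regs 0             = n<
      small-regs 1             = d<
      small-regs (suc (suc r)) = small-0
      small-memory : ∀ a → Small (memory (input u v) a)
      small-memory (+ a)    = let x , eq = memory-bit a in subst Small (sym eq) (<-≤-trans (toℕ<n x) (<⇒≤ small-2))
      small-memory -[1+ a ] = small-0

    module MarkFolding (k : ℕ) = Folding A marked setMark (λ D → proj₂ D ≡ false) (λ D → proj₁ D k ≡ true) (λ k′ → (k ≡ᵇ k′) ≡ true)
      (λ inv → inv) (λ {k′} _ → ∨-split (k ≡ᵇ k′)) (λ {k′} _ → ∨-keep (k ≡ᵇ k′)) (λ {k′} {D} _ eq → cong (λ p → p ∨ proj₁ D k) eq)

    module TestFolding = Folding A′ marked′ test (λ D → proj₁ D ≡ proj₁ D₁) (λ D → proj₂ D ≡ true) (λ k → proj₁ D₁ k ≡ true)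
      (λ inv → inv)
      (λ {k} {D} inv eq → Sum.map₂ (trans (cong (λ M → M k) (sym inv))) (∨-split (proj₁ D k) eq))
      (λ {k} {D} inv → ∨-keep (proj₁ D k))
      (λ {k} {D} inv eq → cong (λ p → p ∨ proj₂ D) (trans (cong (λ M → M k) inv) eq))

    open Keys A A′ marked marked′ sound complete

    found⇒orthogonal : proj₂ D₂ ≡ true → HasOrthogonalPair u v
    found⇒orthogonal eq with TestFolding.phase-split n (n * d) refl eq
    ... | inj₁ eq′ = contradiction (trans (sym eq′) (MarkFolding.phase-preserved 0 n 0 refl)) λ ()
    ... | inj₂ (j , j< , k , k∈′ , marked-k) with MarkFolding.phase-split k n 0 refl marked-k
    ...   | inj₂ (i , i< , k′ , k∈ , k≡) = fromℕ< i< , fromℕ< j< , disjoint⇒orthogonal (fromℕ< i<) (fromℕ< j<)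
            (subst₂ (λ i j → DisjointBelow (+ d) (i * d) (n * d + j * d)) (sym (toℕ-fromℕ< i<)) (sym (toℕ-fromℕ< j<))
              (keys-meet⇒disjoint (i * d) (n * d + j * d)
                (subst (_∈ keysAt A marked (i * d)) (sym (≡ᵇ⇒≡ k k′ (subst T (sym k≡) tt))) k∈) k∈′))

    orthogonal⇒found : HasOrthogonalPair u v → proj₂ D₂ ≡ true
    orthogonal⇒found (i , j , eq) =
      let k , k∈ , k∈′ = disjoint⇒keys-meet (toℕ i * d) (n * d + toℕ j * d) (orthogonal⇒disjoint i j eq)
      in TestFolding.phase-hit n (n * d) refl (toℕ j) (toℕ<n j) k∈′
           (MarkFolding.phase-hit k n 0 refl (toℕ i) (toℕ<n i) k∈ (≡ᵇ-refl k))

    answer-correct : CorrectAnswer u v (+ 𝟙 (proj₂ D₂))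
    answer-correct = decide (proj₂ D₂) refl
      where
      decide : ∀ f → proj₂ D₂ ≡ f → CorrectAnswer u v (+ 𝟙 f)
      decide true  eq = inj₁ (refl , found⇒orthogonal eq)
      decide false eq = inj₂ (refl , λ pair → contradiction (trans (sym (orthogonal⇒found pair)) eq) λ ())

    correct-in-time : ∃[ t ] ∃[ σ ] (algorithm ⊢ input u v ⇓[ t ] σ) × CorrectAnswer u v (output σ)
                      × TimeBound 1155 1000 constant 3 n d t
    correct-in-time =
      let τ₁ , _ , _ , _ , _ , _ , run₁ , R₁ = Marking.phase-run mark-performs initial (m≤m+n (n * d) (n * d))
          τ₂ , _ , _ , _ , _ , _ , run₂ , R₂ = Testing.phase-run test-performs R₁ ≤-refl
          whole = run₁ ⟫ (run₂ ⟫ run-reg (Rep.bounded R₂) 0 (reg 9) tt (≤ᵇ⇒≤ _ _ tt))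
      in Run.time whole , setReg 0 (regs τ₂ 9) τ₂ , Run.halts whole
       , subst (CorrectAnswer u v) (sym (Rep.r9 R₂)) answer-correct
       , time-bound {n = n} {L ^ m} {d} {l} {2 * (4 * L + b + 38) + 9} {2 * g + 4} {suc β} {1155 ^ d} {1000 ^ d} {1155 ^ b} (Run.in-time whole)
           (steps-bound n m d (L ^ m) L b (>-nonZero⁻¹ n) m≤d (m^n>0 L {{>-nonZero L>0}} m))
           (word-length-linear g d l)
           (blocks-saving b L m d L-small (ℤₚ.drop‿+≤+ (blocks-cover d (+ d) 0 ℤₚ.≤-refl)) (<⇒≤ (blocks-length-< d (+ d) 0 d ℤₚ.≤-refl)))

theorem1p3 :
  ∃[ P ] ∃[ C ] ∃[ k ]
    ((n d : ℕ) .{{_ : NonZero n}} (u v : Vector (Vector (Fin 2) d) n) →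
      ∃[ t ] ∃[ σ ]
        (P ⊢ input u v ⇓[ t ] σ) ×
        CorrectAnswer u v (output σ) ×
        TimeBound 1155 1000 C k n d t)
theorem1p3 = algorithm , constant , 3 , λ n d u v → correct-in-time n d u v
  where open Main gadget
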